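{- For every $n\ge1$, $$\dim\big(\mathbf{PQSym}^{*\infty}_n\big)=\sum_{k=1}^n A^{\infty}_{n,k}$$ and this number equals the number of rooted labeled non-planar trees on $[n]$ whose maximal decreasing subtree is a chain.
   Context: Words are finite words on $\mathbb{N}\setminus\{0\}$. A word $u=u_1\dots u_n$ is a parking function if its nondecreasing rearrangement $u'$ satisfies $u'_i\le i$ for all $i$; prime if moreover $u'_i<i$ for $i\ge 2$. Parkization: for $w$ of length $n$ let $d(w)=\min\{i\ge1:\#\{j:w_j\le i\}<i\}$; if $d(w)=n+1$ then $\mathrm{Park}(w)=w$, else $\mathrm{Park}(w)=\mathrm{Park}(w')$ with $w'$ obtained by decreasing by one all letters greater than $d(w)$. $\mathbf{PQSym}^*$ is the span over a field of characteristic $0$ of $\mathbf{G}_u=\sum_{\mathrm{Park}(w)=u}w$ ($u$ parking function), graded by the length of $u$. $\mathrm{BW}$: infinite sequences of columns $(L_i,M_i)$, $L_i$ finite sets of positive integers whose nonempty members form in order a set composition of $[n]$, $M_i$ a prime parking function of length $|L_i|$. With $\|L\|=|L|$ for $L\ne\emptyset$, $\|\emptyset\|=1$, the bijection $\Phi:\mathrm{BW}\to$ words sends $m$ to $w$ with $w_p=(t\text{ -th letter of }M_j)+\sum_{q<j}\|L_q\|$ when $p$ is the $t$-th smallest element of $L_j$; words are identified with elements of $\mathrm{BW}$. The $\infty$-action of $\mathfrak{S}_\infty=\langle s_i=(i,i+1)\rangle$ on $\mathrm{BW}$ lets $s_i$ swap columns $i$ and $i+1$ (always); $\mathbf{PQSym}^{*\infty}$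 is the space of elements of $\mathbf{PQSym}^*$ invariant under this action (extended to words linearly), and $\mathbf{PQSym}^{*\infty}_n$ its intersection with the span of the $\mathbf{G}_u$, $u$ of length $n$. $A^{\infty}_{n,k}=\sum\prod_{i=1}^k(|Q_i|-1)^{|Q_i|-1}$, the sum over set partitions $\{Q_1,\dots,Q_k\}$ of $[n]$ into $k$ blocks, with $0^0=1$. For a rooted labeled tree $T$, its maximal decreasing subtree is the maximal subtree containing the root all of whose edges go from a parent to a child with smaller label; it is a chain if it is a path starting at the root. -}

module Defs where

open import Level using (Level; _⊔_) renaming (suc to lsuc)
import Data.Nat as N
open import Data.Nat using (ℕ; zero; suc; _∸_; _^_; _≤_; _<_; _≤ᵇ_; _<ᵇ_; _≡ᵇ_)
open import Data.Nat.Properties using (≤-decTotalOrder)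
open import Data.Bool using (Bool; true; false; _∧_; _∨_; not; if_then_else_; T)
open import Data.Nat.ListAction using (sum; product)
open import Data.List using (List; []; _∷_; length; map; foldr; filter; concat; concatMap; zip; upTo; _++_; replicate)
open import Data.List.Relation.Binary.Permutation.Propositional using (_↭_)
open import Data.List.Relation.Unary.All using (All)
open import Data.Maybe using (Maybe; just; nothing)
open import Data.Fin using (Fin; toℕ)
open import Data.Product using (_×_; _,_; proj₁; proj₂; Σ)
open import Relation.Nullary using (¬_)
open import Relation.Binary.PropositionalEquality using (_≡_)
open import Algebra.Bundles using (CommutativeRing)
import Data.List.Sort.InsertionSort.Base as ISort

natMul : ∀ {c ℓ} (R : CommutativeRing c ℓ) → ℕ → CommutativeRing.Carrier R
natMul R zero    = CommutativeRing.0# R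
natMul R (suc n) = CommutativeRing._+_ R (CommutativeRing.1# R) (natMul R n)

record Field0 (c ℓ : Level) : Set (lsuc (c ⊔ ℓ)) where
  field
    commRing : CommutativeRing c ℓ
  open CommutativeRing commRing public
  field
    1≉0     : ¬ (1# ≈ 0#)
    inverse : ∀ x → ¬ (x ≈ 0#) → Σ Carrier (λ y → (x * y) ≈ 1#)
    char0   : ∀ n → ¬ (natMul commRing (suc n) ≈ 0#)

Word : Set
Word = List ℕ

positive : Word → Bool
positive = foldr (λ a b → (1 ≤ᵇ a) ∧ b) true

sortW : Word → Word
sortW = ISort.sort ≤-decTotalOrder

indexed : Word → List (ℕ × ℕ)
indexed w = zip (map suc (upTo (length w))) w

isPF : Word → Bool
isPF u = positive u ∧ foldr (λ p b → (proj₂ p ≤ᵇ proj₁ p) ∧ b) true (indexed (sortW u))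

isPrimePF : Word → Bool
isPrimePF u = isPF u ∧
  foldr (λ p b → ((proj₁ p ≤ᵇ 1) ∨ (proj₂ p <ᵇ proj₁ p)) ∧ b) true (indexed (sortW u))

countLe : ℕ → Word → ℕ
countLe i w = length (filter (λ a → a Data.Nat.≤? i) w)

dSearch : ℕ → ℕ → Word → ℕ
dSearch zero     s w = s
dSearch (suc fl) s w = if countLe s w <ᵇ s then s else dSearch fl (suc s) w

-- d(w) = min { i ≥ 1 : #{j : w_j ≤ i} < i }  (always ≤ n+1, so n+1 steps suffice)
dW : Word → ℕ
dW w = dSearch (suc (length w)) 1 w

decAbove : ℕ → Word → Word
decAbove d = map (λ a → if d <ᵇ a then a ∸ 1 else a)

-- each non-terminal step strictly decreases the sum of letters, so
-- `sum w` steps of fuel are enough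
parkFuel : ℕ → Word → Word
parkFuel zero     w = w
parkFuel (suc fl) w =
  if dW w ≡ᵇ suc (length w) then w else parkFuel fl (decAbove (dW w) w)

Park : Word → Word
Park w = parkFuel (sum w) w

-- BW: sequences of columns (L_i , M_i).  An element is given by a finite
-- list of columns, all further columns being (∅ , empty word).

Column : Set
Column = List ℕ × Word

emptyCol : Column
emptyCol = ([] , [])

data StrictlyIncreasing : List ℕ → Set where
  si-[]  : StrictlyIncreasing []
  si-[x] : ∀ {x} → StrictlyIncreasing (x ∷ [])
  si-∷   : ∀ {x y l} → x < y → StrictlyIncreasing (y ∷ l) → StrictlyIncreasing (x ∷ y ∷ l)

ValidColumn : Column → Set
ValidColumn (L , M) = StrictlyIncreasing L × (length M ≡ length L) × T (isPrimePF M)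

ValidBW : ℕ → List Column → Set
ValidBW n cols = All ValidColumn cols × (concat (map proj₁ cols) ↭ map suc (upTo n))

normL : List ℕ → ℕ
normL []       = 1
normL (x ∷ xs) = length (x ∷ xs)

assign : ℕ → List Column → List (ℕ × ℕ)
assign off []              = []
assign off ((L , M) ∷ cs) = zip L (map (λ a → a N.+ off) M) ++ assign (off N.+ normL L) cs

lookupAssoc : ℕ → List (ℕ × ℕ) → ℕ
lookupAssoc p []             = 0
lookupAssoc p ((q , v) ∷ xs) = if p ≡ᵇ q then v else lookupAssoc p xs

Φ : ℕ → List Column → Word
Φ n cols = map (λ p → lookupAssoc p (assign 0 cols)) (map suc (upTo n))

-- s_{k+1} swaps columns k+1 and k+2 (columns numbered from 1)
swapCols : ℕ → List Column → List Column
swapCols zero    []           = []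
swapCols zero    (a ∷ [])     = emptyCol ∷ a ∷ []
swapCols zero    (a ∷ b ∷ cs) = b ∷ a ∷ cs
swapCols (suc k) []           = []
swapCols (suc k) (a ∷ cs)     = a ∷ swapCols k cs

-- PQSym*_n over a field K: an element Σ_u c_u G_u is its coefficient
-- function c, vanishing outside parking functions of length n.
-- Its coefficient on a word w is c (Park w).

module _ {c ℓ} (K : Field0 c ℓ) where
  open Field0 K

  ∑ : (N : ℕ) → (Fin N → Carrier) → Carrier
  ∑ zero    f = 0#
  ∑ (suc N) f = f Data.Fin.zero + ∑ N (λ j → f (Data.Fin.suc j))

  InPQSym : ℕ → (Word → Carrier) → Set ℓ
  InPQSym n f = ∀ u → ¬ (T (isPF u) × length u ≡ n) → f u ≈ 0#

  -- invariance of Σ_w f(Park w) w under every s_i of the ∞-action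
  Invariant : ℕ → (Word → Carrier) → Set ℓ
  Invariant n f = ∀ (cols : List Column) → ValidBW n cols → ∀ (k : ℕ) →
    f (Park (Φ n (swapCols k cols))) ≈ f (Park (Φ n cols))

  InPQSymInf : ℕ → (Word → Carrier) → Set ℓ
  InPQSymInf n f = InPQSym n f × Invariant n f

  HasDim : ℕ → ℕ → Set (c ⊔ ℓ)
  HasDim n N = Σ (Fin N → Word → Carrier) λ b →
    (∀ j → InPQSymInf n (b j)) ×
    (∀ (a : Fin N → Carrier) → (∀ u → ∑ N (λ j → a j * b j u) ≈ 0#) → ∀ j → a j ≈ 0#) ×
    (∀ f → InPQSymInf n f → Σ (Fin N → Carrier) λ a → ∀ u → f u ≈ ∑ N (λ j → a j * b j u))

insertEach : ℕ → List (List ℕ) → List (List (List ℕ))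
insertEach x []       = []
insertEach x (B ∷ Bs) = ((x ∷ B) ∷ Bs) ∷ map (B ∷_) (insertEach x Bs)

setPartitions : ℕ → List (List (List ℕ))
setPartitions zero    = [] ∷ []
setPartitions (suc n) =
  concatMap (λ P → ((suc n ∷ []) ∷ P) ∷ insertEach (suc n) P) (setPartitions n)

-- (|Q|-1)^(|Q|-1), with 0^0 = 1 (as for _^_ on ℕ)
blockWeight : List ℕ → ℕ
blockWeight Q = (length Q ∸ 1) ^ (length Q ∸ 1)

Ainf : ℕ → ℕ → ℕ
Ainf n k = sum (map (λ P → product (map blockWeight P))
                    (filter (λ P → length P Data.Nat.≟ k) (setPartitions n)))

sumFrom1 : ℕ → (ℕ → ℕ) → ℕ
sumFrom1 zero    f = 0
sumFrom1 (suc n) f = sumFrom1 n f N.+ f (suc n)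

-- Rooted labeled (non-planar) trees on [n], as parent maps:
-- vertex i (label i+1) has parent `par i` (nothing for the root)

ParentMap : ℕ → Set
ParentMap n = List (Maybe ℕ)   -- entry i: parent label of vertex with label i+1

allParentMaps : ℕ → ℕ → List (List (Maybe ℕ))
allParentMaps n zero    = [] ∷ []
allParentMaps n (suc m) =
  concatMap (λ rest → map (λ x → x ∷ rest) (nothing ∷ map (λ l → just (suc l)) (upTo n)))
            (allParentMaps n m)

parentOf : List (Maybe ℕ) → ℕ → Maybe ℕ
parentOf []       _       = nothing
parentOf (x ∷ xs) 1       = x
parentOf (x ∷ xs) (suc (suc v)) = parentOf xs (suc v)
parentOf (x ∷ xs) zero    = nothing

labels : ℕ → List ℕ
labels n = map suc (upTo n)

isRootB : List (Maybe ℕ) → ℕ → Bool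
isRootB par v with parentOf par v
... | nothing = true
... | just _  = false

reachesRoot : List (Maybe ℕ) → ℕ → ℕ → Bool
reachesRoot par zero     v = isRootB par v
reachesRoot par (suc fl) v with parentOf par v
... | nothing = true
... | just p  = reachesRoot par fl p

countB : (ℕ → Bool) → List ℕ → ℕ
countB p l = length (filter (λ x → Data.Bool._≟_ (p x) true) l)

isTree : ℕ → List (Maybe ℕ) → Bool
isTree n par = (countB (isRootB par) (labels n) ≡ᵇ 1) ∧
               foldr (λ v b → reachesRoot par n v ∧ b) true (labels n)

-- v is in the maximal decreasing subtree: every edge on the path from the
-- root to v goes from a parent to a smaller child
inDecSub : List (Maybe ℕ) → ℕ → ℕ → Bool
inDecSub par zero     v = isRootB par v
inDecSub par (suc fl) v with parentOf par v
... | nothing = true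
... | just p  = (v <ᵇ p) ∧ inDecSub par fl p

-- the maximal decreasing subtree is a chain (a path from the root):
-- no two distinct vertices of it share a parent
decSubIsChain : ℕ → List (Maybe ℕ) → Bool
decSubIsChain n par =
  foldr (λ u b → foldr (λ v b' → not (sameParentDistinct u v) ∧ b') true (labels n) ∧ b)
        true (labels n)
  where
  sameParentDistinct : ℕ → ℕ → Bool
  sameParentDistinct u v with parentOf par u | parentOf par v
  ... | just p | just q = not (u ≡ᵇ v) ∧ (p ≡ᵇ q) ∧ inDecSub par n u ∧ inDecSub par n v
  ... | _      | _      = false

treesChainCount : ℕ → ℕ
treesChainCount n =
  length (filter (λ par → Data.Bool._≟_ (isTree n par ∧ decSubIsChain n par) true)
                 (allParentMaps n n))

{-# OPTIONS --safe #-}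
module Submission where

-- Words are sequences of columns, and Park deletes the empty columns. So an invariant
-- element is a function on sets of nonempty columns, i.e. on set partitions of [n] whose
-- blocks Q carry prime parking functions of length |Q|.
-- Prime parking functions and rooted trees whose root is smaller than its children obey
-- one recursion. A prime parking function is the set of the positions of its letters 1
-- and then a queue that is served until it is empty; such a tree is the set consisting of
-- its root and the root's children and then a forest hanging below the children. Abel's
-- formula s(s+r)^(r−1) for the forests gives (m−1)^(m−1) in both cases.
-- Cutting the edges of the chain turns a tree counted by treesChainCount into a set of
-- trees of this kind; the chain is recovered by ordering the roots. Hence the
-- dimension and the number of trees both satisfy c(0) = 1 and c(n+1) = Σ_i C(n,i) i^i c(n−i).

open import Defs
open import Level using (Level)
open import Data.Bool as Bool using (Bool; true; false; if_then_else_; T; _∧_; _∨_; not)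
open import Data.Bool.Properties using (T-∧; T-≡; T?)
open import Data.Empty using (⊥; ⊥-elim)
open import Data.Fin as Fin using (Fin)
import Data.Fin.Properties as FinP
open import Data.List hiding (sum; product; and; or; all; any)
open import Data.List.Membership.Propositional using (_∈_; lose)
open import Data.List.Membership.Propositional.Properties
  using (∈-map⁺; ∈-map⁻; ∈-upTo⁺; ∈-++⁻; ∈-++⁺ˡ; ∈-++⁺ʳ; ∈-∃++; ∈-concat⁻′; ∈-filter⁺; ∈-concatMap⁺; ∈-lookup)
open import Data.List.Properties
open import Data.List.Relation.Binary.Permutation.Propositional as Perm
  using (_↭_; ↭-sym; ↭-trans; ↭-refl; ↭-reflexive; prep)
import Data.List.Relation.Binary.Permutation.Propositional.Properties as PermP
import Data.List.Relation.Binary.Permutation.Setoid.Properties as SetoidPermP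
open import Data.List.Relation.Unary.All as All using (All; []; _∷_)
import Data.List.Relation.Unary.All.Properties as AllP
open import Data.List.Relation.Unary.AllPairs as AllPairs using (AllPairs; []; _∷_)
import Data.List.Relation.Unary.AllPairs.Properties as AllPairsP
open import Data.List.Relation.Unary.Any using (here; there; index)
open import Data.List.Relation.Unary.Any.Properties using (lookup-index)
open import Data.List.Relation.Unary.Linked.Properties using (Linked⇒AllPairs)
open import Data.List.Relation.Unary.Unique.Propositional using (Unique)
import Data.List.Relation.Unary.Unique.Propositional.Properties as UniqueP
import Data.List.Sort.InsertionSort.Properties as ISortP
open import Data.Maybe using (Maybe; just; nothing)
import Data.Maybe.Properties as MaybeP
open import Data.Nat
open import Data.Nat.ListAction using (sum; product)
open import Data.Nat.Properties
open import Data.Nat.Tactic.RingSolver using (solve-∀)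
open import Data.Product using (_×_; _,_; proj₁; proj₂; Σ)
open import Data.Sum using (_⊎_; inj₁; inj₂)
open import Data.Unit using (⊤; tt)
open import Function using (_∘_; id; case_of_)
open import Function.Bundles using (Equivalence)
open import Relation.Binary.Definitions using (tri<; tri≈; tri>)
open import Relation.Binary.PropositionalEquality
open import Relation.Nullary
open import Relation.Nullary.Decidable using (¬?)
open import Relation.Unary using (Decidable; Pred)

-- Exponential generating functions

-- All counting stays in ℕ, without division or subtraction: sums over subsets stand for exponential
-- generating functions, and the exponent r-1 of Abel's formula is handled by multiplying an
-- identity by the total number of vertices. A child of a chain vertex that is not itself on the
-- chain is larger than its parent, since otherwise the edge would belong to the maximal decreasing
-- subtree; hence the pieces left after cutting have roots smaller than their children. The cutting
-- is never carried out on parent maps. A tree is counted together with a tagging of its vertices by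
-- their distance to the chain: a tree of the required kind fits exactly one tagging, and for a
-- fixed tagging the parents are chosen independently, so the count is a product. This product
-- couples all the roots, because a child may choose any smaller root; the two partial derivatives
-- of the resulting generating function show that it is the exponential of the one for a single
-- piece. For column sequences the recursion takes the column of the least label, which gives the
-- factor i^i for a prime parking function of length i + 1.

-- binom n f = Σ_j C(n,j) f(j, n−j), read as a sum over the subsets of an n-element set.
binom : ℕ → (ℕ → ℕ → ℕ) → ℕ
binom zero    f = f 0 0
binom (suc n) f = binom n (λ i j → f (suc i) j) + binom n (λ i j → f i (suc j))

binom-cong-local : ∀ n {f g : ℕ → ℕ → ℕ} → (∀ i j → i + j ≡ n → f i j ≡ g i j) → binom n f ≡ binom n g
binom-cong-local zero    e = e 0 0 refl
binom-cong-local (suc n) e = cong₂ _+_ (binom-cong-local n (λ i j q → e (suc i) j (cong suc q)))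
  (binom-cong-local n (λ i j q → e i (suc j) (trans (+-suc i j) (cong suc q))))

binom-cong : ∀ n {f g : ℕ → ℕ → ℕ} → (∀ i j → f i j ≡ g i j) → binom n f ≡ binom n g
binom-cong n e = binom-cong-local n (λ i j _ → e i j)

+-interchange : ∀ a b c d → (a + b) + (c + d) ≡ (a + c) + (b + d)
+-interchange = solve-∀

+-rotate : ∀ a b c → a + (b + c) ≡ b + (a + c)
+-rotate = solve-∀

*-rotate : ∀ a b c → a * (b * c) ≡ b * (a * c)
*-rotate = solve-∀

binom-+ : ∀ n (f g : ℕ → ℕ → ℕ) → binom n (λ i j → f i j + g i j) ≡ binom n f + binom n g
binom-+ zero    f g = refl
binom-+ (suc n) f g = trans (cong₂ _+_ (binom-+ n _ _) (binom-+ n _ _))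
  (+-interchange (binom n (λ i j → f (suc i) j)) _ _ _)

binom-*ˡ : ∀ n c (f : ℕ → ℕ → ℕ) → binom n (λ i j → c * f i j) ≡ c * binom n f
binom-*ˡ zero    c f = refl
binom-*ˡ (suc n) c f = trans (cong₂ _+_ (binom-*ˡ n c _) (binom-*ˡ n c _))
  (sym (*-distribˡ-+ c (binom n (λ i j → f (suc i) j)) _))

binom-*ʳ : ∀ n c (f : ℕ → ℕ → ℕ) → binom n (λ i j → f i j * c) ≡ binom n f * c
binom-*ʳ n c f = trans (binom-cong n (λ i j → *-comm (f i j) c))
  (trans (binom-*ˡ n c f) (*-comm c _))

binom-zero : ∀ n → binom n (λ _ _ → 0) ≡ 0
binom-zero zero    = refl
binom-zero (suc n) = cong₂ _+_ (binom-zero n) (binom-zero n)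

binom-swap : ∀ m n (f : ℕ → ℕ → ℕ → ℕ → ℕ) →
  binom m (λ i j → binom n (λ k l → f i j k l)) ≡ binom n (λ k l → binom m (λ i j → f i j k l))
binom-swap zero    n f = refl
binom-swap (suc m) n f = trans (cong₂ _+_ (binom-swap m n _) (binom-swap m n _))
  (sym (binom-+ n (λ k l → binom m (λ i j → f (suc i) j k l)) _))

-- There is one summand for each distribution of n elements over three boxes; the two sides differ
-- only in which of the first two boxes is filled first.
binom-leftComm : ∀ n (f : ℕ → ℕ → ℕ → ℕ) →
  binom n (λ i j → binom j (λ k l → f i k l)) ≡ binom n (λ i j → binom j (λ k l → f k i l))
binom-leftComm zero    f = refl
binom-leftComm (suc n) f = begin
  binom n (λ i j → binom j (λ k l → f (suc i) k l)) + binom n (λ i j → binom (suc j) (λ k l → f i k l))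
    ≡⟨ cong₂ _+_ (binom-leftComm n _) (binom-+ n _ _) ⟩
  U (λ k i l → f (suc i) k l) + (U (λ i k l → f i (suc k) l) + U (λ i k l → f i k (suc l)))
    ≡⟨ cong₂ (λ x y → U (λ k i l → f (suc i) k l) + (x + y)) (binom-leftComm n _) (binom-leftComm n _) ⟩
  U (λ k i l → f (suc i) k l) + (U (λ k i l → f i (suc k) l) + U (λ k i l → f i k (suc l)))
    ≡⟨ +-rotate (U (λ k i l → f (suc i) k l)) (U (λ k i l → f i (suc k) l)) _ ⟩
  U (λ k i l → f i (suc k) l) + (U (λ k i l → f (suc i) k l) + U (λ k i l → f i k (suc l)))
    ≡⟨ cong (U (λ k i l → f i (suc k) l) +_) (binom-+ n _ _) ⟨
  binom n (λ i j → binom j (λ k l → f k (suc i) l)) + binom n (λ i j → binom (suc j) (λ k l → f k i l)) ∎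
  where
  open ≡-Reasoning
  U : (ℕ → ℕ → ℕ → ℕ) → ℕ
  U h = binom n (λ i j → binom j (λ k l → h i k l))

-- Both sides distribute n elements over the four arguments of f.
binom-diagonal : ∀ n (f : ℕ → ℕ → ℕ → ℕ → ℕ) →
  binom n (λ m o → binom m (λ i j → binom o (λ k l → f i k j l))) ≡
  binom n (λ p q → binom p (λ i k → binom q (λ j l → f i k j l)))
binom-diagonal zero    f = refl
binom-diagonal (suc n) f = begin
  binom n (λ m o → binom (suc m) (λ i j → binom o (λ k l → f i k j l))) +
  binom n (λ m o → binom m (λ i j → binom (suc o) (λ k l → f i k j l)))
    ≡⟨ cong₂ _+_ (binom-+ n _ _) (trans (binom-cong n (λ m o → binom-+ m _ _)) (binom-+ n _ _)) ⟩
  (L (λ i k j l → f (suc i) k j l) + L (λ i k j l → f i k (suc j) l)) +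
  (L (λ i k j l → f i (suc k) j l) + L (λ i k j l → f i k j (suc l)))
    ≡⟨ +-interchange (L (λ i k j l → f (suc i) k j l)) _ _ _ ⟩
  (L (λ i k j l → f (suc i) k j l) + L (λ i k j l → f i (suc k) j l)) +
  (L (λ i k j l → f i k (suc j) l) + L (λ i k j l → f i k j (suc l)))
    ≡⟨ cong₂ _+_ (cong₂ _+_ (binom-diagonal n _) (binom-diagonal n _))
                 (cong₂ _+_ (binom-diagonal n _) (binom-diagonal n _)) ⟩
  (R (λ i k j l → f (suc i) k j l) + R (λ i k j l → f i (suc k) j l)) +
  (R (λ i k j l → f i k (suc j) l) + R (λ i k j l → f i k j (suc l)))
    ≡⟨ cong₂ _+_ (sym (binom-+ n _ _)) (trans (sym (binom-+ n _ _)) (binom-cong n (λ p q → sym (binom-+ p _ _)))) ⟩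
  binom n (λ p q → binom (suc p) (λ i k → binom q (λ j l → f i k j l))) +
  binom n (λ p q → binom p (λ i k → binom (suc q) (λ j l → f i k j l))) ∎
  where
  open ≡-Reasoning
  L R : (ℕ → ℕ → ℕ → ℕ → ℕ) → ℕ
  L h = binom n (λ m o → binom m (λ i j → binom o (λ k l → h i k j l)))
  R h = binom n (λ p q → binom p (λ i k → binom q (λ j l → h i k j l)))

binom-product : ∀ m n (f g : ℕ → ℕ → ℕ) →
  binom m (λ i j → binom n (λ k l → f i j * g k l)) ≡ binom m f * binom n g
binom-product m n f g = trans (binom-cong m (λ i j → binom-*ˡ n (f i j) g)) (binom-*ʳ m (binom n g) f)

binomial-theorem : ∀ n s t → binom n (λ i j → s ^ i * t ^ j) ≡ (s + t) ^ n
binomial-theorem zero    s t = refl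
binomial-theorem (suc n) s t = begin
  binom n (λ i j → s * s ^ i * t ^ j) + binom n (λ i j → s ^ i * (t * t ^ j))
    ≡⟨ cong₂ _+_ (trans (binom-cong n (λ i j → *-assoc s (s ^ i) (t ^ j))) (binom-*ˡ n s _))
                 (trans (binom-cong n (λ i j → *-rotate (s ^ i) t (t ^ j))) (binom-*ˡ n t _)) ⟩
  s * binom n (λ i j → s ^ i * t ^ j) + t * binom n (λ i j → s ^ i * t ^ j)
    ≡⟨ *-distribʳ-+ (binom n (λ i j → s ^ i * t ^ j)) s t ⟨
  (s + t) * binom n (λ i j → s ^ i * t ^ j)
    ≡⟨ cong ((s + t) *_) (binomial-theorem n s t) ⟩
  (s + t) * (s + t) ^ n ∎
  where
  open ≡-Reasoning

-- The operator s·d/ds applied to the binomial theorem. The size is a successor so that the lowered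
-- exponent on the right needs no subtraction.
binomial-mean : ∀ n s t → binom (suc n) (λ i j → i * (s ^ i * t ^ j)) ≡ suc n * s * (s + t) ^ n
binomial-mean n s t = begin
  binom n (λ i j → suc i * (s * s ^ i * t ^ j)) + binom n (λ i j → i * (s ^ i * (t * t ^ j)))
    ≡⟨ cong₂ _+_ (trans (binom-cong n (λ i j → expand i s (s ^ i) (t ^ j))) (binom-+ n _ _)) refl ⟩
  binom n (λ i j → s * (s ^ i * t ^ j)) + binom n (λ i j → s * (i * (s ^ i * t ^ j))) +
  binom n (λ i j → i * (s ^ i * (t * t ^ j)))
    ≡⟨ cong₂ _+_ (cong₂ _+_ (trans (binom-*ˡ n s _) (cong (s *_) (binomial-theorem n s t))) (binom-*ˡ n s _))
                 (trans (binom-cong n (λ i j → rot i (s ^ i) t (t ^ j))) (binom-*ˡ n t _)) ⟩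
  s * (s + t) ^ n + s * M n + t * M n
    ≡⟨ mean n ⟩
  suc n * s * (s + t) ^ n ∎
  where
  open ≡-Reasoning
  M : ℕ → ℕ
  M n = binom n (λ i j → i * (s ^ i * t ^ j))
  expand : ∀ i s x y → suc i * (s * x * y) ≡ s * (x * y) + s * (i * (x * y))
  expand = solve-∀
  rot : ∀ i a b c → i * (a * (b * c)) ≡ b * (i * (a * c))
  rot = solve-∀
  collect₀ : ∀ s t → s * 1 + s * 0 + t * 0 ≡ 1 * s * 1
  collect₀ = solve-∀
  collect : ∀ n s t x → s * ((s + t) * x) + s * (suc n * s * x) + t * (suc n * s * x) ≡ suc (suc n) * s * ((s + t) * x)
  collect = solve-∀
  -- The remaining sums `M n` are known from `binomial-mean` at the predecessor of n; at n = 0 they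
  -- vanish.
  mean : ∀ n → s * (s + t) ^ n + s * M n + t * M n ≡ suc n * s * (s + t) ^ n
  mean zero    = collect₀ s t
  mean (suc n) = trans (cong (λ x → s * (s + t) ^ suc n + s * x + t * x) (binomial-mean n s t))
    (collect n s t ((s + t) ^ n))

-- The number s(s+r)^(r−1) of forests in which r vertices hang below s given roots.
forests : ℕ → ℕ → ℕ
forests s zero    = 1
forests s (suc r) = s * (s + suc r) ^ r

-- Multiplication by the total number of vertices removes the exponent r-1, so that r = 0 and r > 0
-- obey one formula. All Abel identities below are proved after such a multiplication.
forests-closed : ∀ s r {n} → s + r ≡ n → n * forests s r ≡ s * n ^ r
forests-closed s zero    refl = cong (_* 1) (+-identityʳ s)
forests-closed s (suc r) refl = *-rotate (s + suc r) s _

-- The i vertices hanging directly below the s given roots choose their parents in s^i ways and are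
-- roots for the other j. After multiplication by the total i + j, `forests i j` turns into i times
-- a power, and the sum is a binomial mean.
forests-layer : ∀ r s → binom r (λ i j → s ^ i * forests i j) ≡ forests s r
forests-layer zero    s = refl
forests-layer (suc r) s = *-cancelˡ-≡ _ _ (suc r) (begin
  suc r * binom (suc r) (λ i j → s ^ i * forests i j)
    ≡⟨ binom-*ˡ (suc r) (suc r) (λ i j → s ^ i * forests i j) ⟨
  binom (suc r) (λ i j → suc r * (s ^ i * forests i j))
    ≡⟨ binom-cong-local (suc r) (λ i j q → trans (*-rotate (suc r) (s ^ i) _)
         (trans (cong (s ^ i *_) (forests-closed i j q)) (*-rotate (s ^ i) i _))) ⟩
  binom (suc r) (λ i j → i * (s ^ i * suc r ^ j))
    ≡⟨ binomial-mean r s (suc r) ⟩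
  suc r * s * (s + suc r) ^ r
    ≡⟨ *-assoc (suc r) s _ ⟩
  suc r * forests s (suc r) ∎)
  where
  open ≡-Reasoning

-- A forest splits according to which of two sets of roots its trees belong to. Peeling the first
-- layer off both factors leaves the same identity for the o vertices below that layer, which are
-- fewer unless the layer is empty; n bounds r for this induction.
forests-conv-≤ : ∀ n r → r ≤ n → ∀ s t → binom r (λ i j → forests s i * forests t j) ≡ forests (s + t) r
forests-conv-≤ n       zero    _  s t = refl
forests-conv-≤ (suc n) (suc r) (s≤s r≤n) s t = begin
  binom (suc r) (λ i j → forests s i * forests t j)
    ≡⟨ binom-cong (suc r) (λ i j → cong₂ _*_ (sym (forests-layer i s)) (sym (forests-layer j t))) ⟩
  binom (suc r) (λ i j → binom i (λ a b → s ^ a * forests a b) * binom j (λ c d → t ^ c * forests c d))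
    ≡⟨ binom-cong (suc r) (λ i j → sym (binom-product i j (λ a b → s ^ a * forests a b) (λ c d → t ^ c * forests c d))) ⟩
  binom (suc r) (λ i j → binom i (λ a b → binom j (λ c d → s ^ a * forests a b * (t ^ c * forests c d))))
    ≡⟨ binom-diagonal (suc r) (λ a b c d → s ^ a * forests a b * (t ^ c * forests c d)) ⟨
  binom (suc r) (λ m o → binom m (λ a c → binom o (λ b d → s ^ a * forests a b * (t ^ c * forests c d))))
    ≡⟨ binom-cong-local (suc r) (λ m o q → binom-cong-local m (λ a c q′ → trans
         (binom-cong o (λ b d → rearrange (s ^ a) (forests a b) (t ^ c) (forests c d)))
         (trans (binom-*ˡ o (s ^ a * t ^ c) _) (cong (s ^ a * t ^ c *_) (trans (combine m o q a c q′) (cong (λ x → forests x o) q′)))))) ⟩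
  binom (suc r) (λ m o → binom m (λ a c → s ^ a * t ^ c * forests m o))
    ≡⟨ binom-cong (suc r) (λ m o → trans (binom-*ʳ m (forests m o) _) (cong (_* forests m o) (binomial-theorem m s t))) ⟩
  binom (suc r) (λ m o → (s + t) ^ m * forests m o)
    ≡⟨ forests-layer (suc r) (s + t) ⟩
  forests (s + t) (suc r) ∎
  where
  open ≡-Reasoning
  rearrange : ∀ a b c d → a * b * (c * d) ≡ a * c * (b * d)
  rearrange = solve-∀
  combine : ∀ m o → m + o ≡ suc r → ∀ a c → a + c ≡ m →
    binom o (λ b d → forests a b * forests c d) ≡ forests (a + c) o
  -- With an empty first layer no smaller instance is available, but both sides vanish: without
  -- roots there is no forest on a nonempty set of vertices.
  combine zero    o refl zero zero refl = empty r
    where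
    empty : ∀ r → binom (suc r) (λ b d → forests 0 b * forests 0 d) ≡ 0
    empty zero    = refl
    empty (suc r) = cong₂ _+_ (binom-zero (suc r)) (trans (binom-cong (suc r) (λ b d → *-zeroʳ (forests 0 b))) (binom-zero (suc r)))
  combine (suc m) o q    a    c    q′   = forests-conv-≤ n o (≤-trans (m≤n+m o m) (≤-trans (≤-reflexive (suc-injective q)) r≤n)) a c

forests-conv : ∀ r s t → binom r (λ i j → forests s i * forests t j) ≡ forests (s + t) r
forests-conv r = forests-conv-≤ r r ≤-refl

-- One of the s + 1 roots is removed and its i children become roots. The total s + r + 1 is the
-- factor that makes `forests-closed` applicable; the terms with s and with i are then the binomial
-- theorem and the binomial mean.
forests-root : ∀ r s → binom r (λ i j → forests (s + i) j) ≡ forests (suc s) r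
forests-root zero    s = refl
forests-root (suc r) s = *-cancelˡ-≡ _ _ (suc (s + r)) (begin
  suc (s + r) * binom (suc r) (λ i j → forests (s + i) j)
    ≡⟨ binom-*ˡ (suc r) (suc (s + r)) (λ i j → forests (s + i) j) ⟨
  binom (suc r) (λ i j → suc (s + r) * forests (s + i) j)
    ≡⟨ binom-cong-local (suc r) (λ i j q → trans (forests-closed (s + i) j (total i j q)) (trans (*-distribʳ-+ (M ^ j) s i)
         (cong₂ (λ x y → s * x + i * y) (one i (M ^ j)) (one i (M ^ j))))) ⟩
  binom (suc r) (λ i j → s * (1 ^ i * M ^ j) + i * (1 ^ i * M ^ j))
    ≡⟨ trans (binom-+ (suc r) (λ i j → s * (1 ^ i * M ^ j)) (λ i j → i * (1 ^ i * M ^ j)))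
         (cong₂ _+_ (trans (binom-*ˡ (suc r) s (λ i j → 1 ^ i * M ^ j)) (cong (s *_) (binomial-theorem (suc r) 1 M))) (binomial-mean r 1 M)) ⟩
  s * ((1 + M) * (1 + M) ^ r) + suc r * 1 * (1 + M) ^ r
    ≡⟨ collect s r ((1 + M) ^ r) ⟩
  M * (suc s * (1 + M) ^ r)
    ≡⟨ cong (λ x → M * (suc s * x ^ r)) (cong suc (sym (+-suc s r))) ⟩
  suc (s + r) * forests (suc s) (suc r) ∎)
  where
  open ≡-Reasoning
  M : ℕ
  M = suc (s + r)
  total : ∀ i j → i + j ≡ suc r → s + i + j ≡ suc (s + r)
  total i j q = trans (+-assoc s i j) (trans (cong (s +_) q) (+-suc s r))
  one : ∀ i x → x ≡ 1 ^ i * x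
  one i x = sym (trans (cong (_* x) (^-zeroˡ i)) (*-identityˡ x))
  collect : ∀ s r x → s * ((1 + suc (s + r)) * x) + suc r * 1 * x ≡ suc (s + r) * (suc s * x)
  collect = solve-∀

-- A root with i − 1 children and j further vertices below them; also: a prime
-- parking function with i letters 1 and j others.
planted : ℕ → ℕ → ℕ
planted zero    o = 0
planted (suc i) o = forests i o

primes : ℕ → ℕ
primes n = binom n planted

-- For i ≥ 1, N times `planted i j` is (i-1)·N^j. The subtraction is avoided by adding 1^i·N^j to
-- both sides, and 0^i·N^j corrects the case i = 0; the three sums that arise are then binomial.
primes-closed : ∀ n → primes (suc n) ≡ n ^ n
primes-closed zero    = refl
primes-closed (suc n) = *-cancelˡ-≡ _ _ N (+-cancelʳ-≡ (suc N ^ suc N) _ _ (begin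
  N * primes (suc N) + suc N ^ suc N
    ≡⟨ cong₂ _+_ (sym (binom-*ˡ (suc N) N planted)) (sym (binomial-theorem (suc N) 1 N)) ⟩
  binom (suc N) (λ i j → N * planted i j) + binom (suc N) (λ i j → 1 ^ i * N ^ j)
    ≡⟨ binom-+ (suc N) (λ i j → N * planted i j) (λ i j → 1 ^ i * N ^ j) ⟨
  binom (suc N) (λ i j → N * planted i j + 1 ^ i * N ^ j)
    ≡⟨ binom-cong-local (suc N) pointwise ⟩
  binom (suc N) (λ i j → i * (1 ^ i * N ^ j) + 0 ^ i * N ^ j)
    ≡⟨ binom-+ (suc N) (λ i j → i * (1 ^ i * N ^ j)) (λ i j → 0 ^ i * N ^ j) ⟩
  binom (suc N) (λ i j → i * (1 ^ i * N ^ j)) + binom (suc N) (λ i j → 0 ^ i * N ^ j)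
    ≡⟨ cong₂ _+_ (binomial-mean N 1 N) (binomial-theorem (suc N) 0 N) ⟩
  suc N * 1 * suc N ^ N + N ^ suc N
    ≡⟨ collect N (suc N ^ N) (N ^ N) ⟩
  N * N ^ N + suc N ^ suc N ∎))
  where
  open ≡-Reasoning
  N : ℕ
  N = suc n
  collect : ∀ n x y → suc n * 1 * x + n * y ≡ n * y + suc n * x
  collect = solve-∀
  pointwise : ∀ i j → i + j ≡ suc N → N * planted i j + 1 ^ i * N ^ j ≡ i * (1 ^ i * N ^ j) + 0 ^ i * N ^ j
  pointwise zero    j _ = cong (_+ 1 * N ^ j) (*-zeroʳ N)
  pointwise (suc i) j q rewrite ^-zeroˡ i | *-identityˡ (N ^ j) =
    trans (cong (_+ N ^ j) (forests-closed i j (suc-injective q))) (trans (+-comm (i * N ^ j) _) (sym (+-identityʳ _)))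

-- Products of exponential generating functions in two variables

conv₂ : (ℕ → ℕ → ℕ) → (ℕ → ℕ → ℕ) → ℕ → ℕ → ℕ
conv₂ f g m o = binom m (λ i j → binom o (λ k l → f i k * g j l))

conv₂-+ʳ : ∀ f g h m o → conv₂ f (λ i j → g i j + h i j) m o ≡ conv₂ f g m o + conv₂ f h m o
conv₂-+ʳ f g h m o = trans (binom-cong m (λ i j → trans (binom-cong o (λ k l → *-distribˡ-+ (f i k) _ _)) (binom-+ o _ _)))
  (binom-+ m _ _)

conv₂-*ʳ : ∀ f c g m o → conv₂ f (λ i j → c * g i j) m o ≡ c * conv₂ f g m o
conv₂-*ʳ f c g m o = trans (binom-cong m (λ i j → trans (binom-cong o (λ k l → *-rotate (f i k) c _)) (binom-*ˡ o c _)))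
  (binom-*ˡ m c _)

conv₂-cong-≤ : ∀ f {g h : ℕ → ℕ → ℕ} m o → (∀ j l → j ≤ m → g j l ≡ h j l) → conv₂ f g m o ≡ conv₂ f h m o
conv₂-cong-≤ f m o e = binom-cong-local m (λ i j q → binom-cong o (λ k l → cong (f i k *_) (e j l (subst (j ≤_) q (m≤n+m j i)))))

conv₂-leftComm : ∀ f g h m o → conv₂ f (conv₂ g h) m o ≡ conv₂ g (conv₂ f h) m o
conv₂-leftComm f g h m o = begin
  conv₂ f (conv₂ g h) m o
    ≡⟨ flatten f g ⟩
  binom m (λ i j → binom j (λ i′ j′ → binom o (λ k l → binom l (λ k′ l′ → f i k * (g i′ k′ * h j′ l′)))))
    ≡⟨ binom-leftComm m (λ i i′ j′ → binom o (λ k l → binom l (λ k′ l′ → f i k * (g i′ k′ * h j′ l′)))) ⟩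
  binom m (λ i j → binom j (λ i′ j′ → binom o (λ k l → binom l (λ k′ l′ → f i′ k * (g i k′ * h j′ l′)))))
    ≡⟨ binom-cong m (λ i j → binom-cong j (λ i′ j′ → trans (binom-leftComm o (λ k k′ l′ → f i′ k * (g i k′ * h j′ l′)))
         (binom-cong o (λ k l → binom-cong l (λ k′ l′ → *-rotate (f i′ k′) (g i k) _))))) ⟩
  binom m (λ i j → binom j (λ i′ j′ → binom o (λ k l → binom l (λ k′ l′ → g i k * (f i′ k′ * h j′ l′)))))
    ≡⟨ flatten g f ⟨
  conv₂ g (conv₂ f h) m o ∎
  where
  open ≡-Reasoning
  flatten : ∀ f g → conv₂ f (conv₂ g h) m o ≡
    binom m (λ i j → binom j (λ i′ j′ → binom o (λ k l → binom l (λ k′ l′ → f i k * (g i′ k′ * h j′ l′)))))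
  flatten f g = binom-cong m (λ i j → trans
    (binom-cong o (λ k l → trans (sym (binom-*ˡ j (f i k) _)) (binom-cong j (λ i′ j′ → sym (binom-*ˡ l (f i k) _)))))
    (binom-swap o j _))

-- rooted m k j o counts the ways to let m further labels, in increasing order, become
-- roots or children of one of the roots already present (k of them), and then to hang
-- o vertices below the children (j of them already present).
rooted : ℕ → ℕ → ℕ → ℕ → ℕ
rooted zero    k j o = forests j o
rooted (suc m) k j o = rooted m (suc k) j o + k * rooted m k (suc j) o

-- The piece of one distinguished root, which already has i children, is split off: the next label
-- becomes its child or is treated by the remaining structure with k roots. When no label is left,
-- the forest splits by `forests-conv`.
rooted-add : ∀ m k i j o → rooted m (suc k) (i + j) o ≡ conv₂ (λ a → forests (i + a)) (λ a → rooted a k j) m o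
rooted-add zero    k i j o = trans (sym (forests-conv o i j))
  (binom-cong o (λ a b → cong (λ x → forests x a * forests j b) (sym (+-identityʳ i))))
rooted-add (suc m) k i j o = begin
  rooted m (2 + k) (i + j) o + (rooted m (suc k) (suc (i + j)) o + k * rooted m (suc k) (suc (i + j)) o)
    ≡⟨ +-rotate (rooted m (2 + k) (i + j) o) (rooted m (suc k) (suc i + j) o) _ ⟩
  rooted m (suc k) (suc i + j) o + (rooted m (2 + k) (i + j) o + k * rooted m (suc k) (suc (i + j)) o)
    ≡⟨ cong₂ _+_ (rooted-add m k (suc i) j o) (cong₂ _+_ (rooted-add m (suc k) i j o)
         (cong (k *_) (trans (cong (λ x → rooted m (suc k) x o) (sym (+-suc i j))) (rooted-add m k i (suc j) o)))) ⟩
  conv₂ (λ a → forests (suc i + a)) (λ a → rooted a k j) m o +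
    (conv₂ (λ a → forests (i + a)) (λ a → rooted a (suc k) j) m o + k * conv₂ (λ a → forests (i + a)) (λ a → rooted a k (suc j)) m o)
    ≡⟨ cong₂ _+_ (binom-cong m (λ a b → binom-cong o (λ c d → cong (λ x → forests x c * rooted b k j d) (sym (+-suc i a)))))
         (sym (trans (conv₂-+ʳ f _ _ m o) (cong (conv₂ f (λ a → rooted a (suc k) j) m o +_) (conv₂-*ʳ f k _ m o)))) ⟩
  conv₂ f (λ a → rooted a k j) (suc m) o ∎
  where
  open ≡-Reasoning
  f : ℕ → ℕ → ℕ
  f a = forests (i + a)

-- Let G(t,x) and E(t,x) be the exponential generating functions of planted i o and
-- rooted i 0 0 o. Then rooted-add gives ∂E/∂t = ∂G/∂t · E; here ∂E/∂x = ∂G/∂x · E, so E = exp G.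
rooted-deriv-≤ : ∀ n m → m ≤ n → ∀ o → rooted m 0 0 (suc o) ≡ conv₂ (λ i j → planted i (suc j)) (λ a → rooted a 0 0) m o
rooted-deriv-≤ n       zero    _         o = sym (binom-zero o)
rooted-deriv-≤ (suc n) (suc m) (s≤s m≤n) o = begin
  rooted m 1 0 (suc o) + 0
    ≡⟨ +-identityʳ _ ⟩
  rooted m 1 0 (suc o)
    ≡⟨ rooted-add m 0 0 0 (suc o) ⟩
  conv₂ forests E m (suc o)
    ≡⟨ binom-+ m _ _ ⟩
  conv₂ (λ i j → forests i (suc j)) E m o + conv₂ forests (λ i j → E i (suc j)) m o
    ≡⟨ cong (conv₂ (λ i j → forests i (suc j)) E m o +_) (begin
         conv₂ forests (λ i j → E i (suc j)) m o
           ≡⟨ conv₂-cong-≤ forests m o (λ j l j≤m → rooted-deriv-≤ n j (≤-trans j≤m m≤n) l) ⟩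
         conv₂ forests (conv₂ P E) m o
           ≡⟨ conv₂-leftComm forests P E m o ⟩
         conv₂ P (conv₂ forests E) m o
           ≡⟨ conv₂-cong-≤ P m o (λ j l _ → sym (trans (+-identityʳ _) (rooted-add j 0 0 0 l))) ⟩
         conv₂ P (λ a → E (suc a)) m o ∎) ⟩
  conv₂ P E (suc m) o ∎
  where
  open ≡-Reasoning
  E P : ℕ → ℕ → ℕ
  E a = rooted a 0 0
  P i j = planted i (suc j)

-- Of the n vertices, m are roots or children of roots and o hang further below.
chains : ℕ → ℕ
chains n = binom n (λ m o → rooted m 0 0 o)

-- The additional vertex is of the first or of the second sort, which gives the two partial
-- derivatives. Both contain the factor `E`, and by the recursion of `binom` their cofactors add up
-- to `primes (suc i)`.
chains-suc : ∀ n → chains (suc n) ≡ binom n (λ i j → primes (suc i) * chains j)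
chains-suc n = begin
  binom n (λ m o → rooted m 1 0 o + 0) + binom n (λ m o → E m (suc o))
    ≡⟨ cong₂ _+_ (binom-cong n (λ m o → trans (+-identityʳ _) (rooted-add m 0 0 0 o)))
                 (binom-cong n (λ m o → rooted-deriv-≤ m m ≤-refl o)) ⟩
  binom n (conv₂ forests E) + binom n (conv₂ (λ i j → planted i (suc j)) E)
    ≡⟨ cong₂ _+_ (diagonal forests) (diagonal (λ i j → planted i (suc j))) ⟩
  binom n (λ p q → binom p forests * chains q) + binom n (λ p q → binom p (λ i j → planted i (suc j)) * chains q)
    ≡⟨ binom-+ n _ _ ⟨
  binom n (λ p q → binom p forests * chains q + binom p (λ i j → planted i (suc j)) * chains q)
    ≡⟨ binom-cong n (λ p q → sym (*-distribʳ-+ (chains q) (binom p forests) _)) ⟩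
  binom n (λ i j → primes (suc i) * chains j) ∎
  where
  open ≡-Reasoning
  E : ℕ → ℕ → ℕ
  E a = rooted a 0 0
  diagonal : ∀ f → binom n (conv₂ f E) ≡ binom n (λ p q → binom p f * chains q)
  diagonal f = trans (binom-diagonal n _) (binom-cong n (λ p q → binom-product p q f E))

recursion-unique-≤ : (p f g : ℕ → ℕ) → f 0 ≡ g 0 →
  (∀ n → f (suc n) ≡ binom n (λ i j → p i * f j)) → (∀ n → g (suc n) ≡ binom n (λ i j → p i * g j)) →
  ∀ n m → m ≤ n → f m ≡ g m
recursion-unique-≤ p f g e f-suc g-suc n       zero    _         = e
recursion-unique-≤ p f g e f-suc g-suc (suc n) (suc m) (s≤s m≤n) = trans (f-suc m) (trans
  (binom-cong-local m (λ i j q → cong (p i *_) (recursion-unique-≤ p f g e f-suc g-suc n j (≤-trans (subst (j ≤_) q (m≤n+m j i)) m≤n))))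
  (sym (g-suc m)))

recursion-unique : (p f g : ℕ → ℕ) → f 0 ≡ g 0 →
  (∀ n → f (suc n) ≡ binom n (λ i j → p i * f j)) → (∀ n → g (suc n) ≡ binom n (λ i j → p i * g j)) →
  ∀ n → f n ≡ g n
recursion-unique p f g e f-suc g-suc n = recursion-unique-≤ p f g e f-suc g-suc n n ≤-refl

-- Sums over lists

sumOver : ∀ {a} {A : Set a} → List A → (A → ℕ) → ℕ
sumOver []       f = 0
sumOver (x ∷ xs) f = f x + sumOver xs f

indicator : ∀ {p} {P : Set p} → Dec P → ℕ
indicator (yes _) = 1
indicator (no _)  = 0

module _ {a} {A : Set a} where

  sumOver-cong-All : ∀ {xs : List A} {f g : A → ℕ} → All (λ x → f x ≡ g x) xs → sumOver xs f ≡ sumOver xs g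
  sumOver-cong-All []       = refl
  sumOver-cong-All (e ∷ es) = cong₂ _+_ e (sumOver-cong-All es)

  sumOver-cong : ∀ (xs : List A) {f g : A → ℕ} → (∀ x → f x ≡ g x) → sumOver xs f ≡ sumOver xs g
  sumOver-cong []       e = refl
  sumOver-cong (x ∷ xs) e = cong₂ _+_ (e x) (sumOver-cong xs e)

  sumOver-+ : ∀ (xs : List A) f g → sumOver xs (λ x → f x + g x) ≡ sumOver xs f + sumOver xs g
  sumOver-+ []       f g = refl
  sumOver-+ (x ∷ xs) f g = trans (cong (f x + g x +_) (sumOver-+ xs f g)) (+-interchange (f x) (g x) _ _)

  sumOver-*ˡ : ∀ (xs : List A) c f → sumOver xs (λ x → c * f x) ≡ c * sumOver xs f
  sumOver-*ˡ []       c f = sym (*-zeroʳ c)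
  sumOver-*ˡ (x ∷ xs) c f = trans (cong (c * f x +_) (sumOver-*ˡ xs c f)) (sym (*-distribˡ-+ c (f x) _))

  sumOver-zero : ∀ (xs : List A) → sumOver xs (λ _ → 0) ≡ 0
  sumOver-zero []       = refl
  sumOver-zero (x ∷ xs) = sumOver-zero xs

  sumOver-++ : ∀ (xs ys : List A) f → sumOver (xs ++ ys) f ≡ sumOver xs f + sumOver ys f
  sumOver-++ []       ys f = refl
  sumOver-++ (x ∷ xs) ys f = trans (cong (f x +_) (sumOver-++ xs ys f)) (sym (+-assoc (f x) _ _))

  sumOver-filter : ∀ {p} {P : Pred A p} (P? : Decidable P) xs f →
    sumOver (filter P? xs) f ≡ sumOver xs (λ x → indicator (P? x) * f x)
  sumOver-filter P? []       f = refl
  sumOver-filter P? (x ∷ xs) f with P? x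
  ... | yes _ = cong₂ _+_ (sym (+-identityʳ (f x))) (sumOver-filter P? xs f)
  ... | no  _ = sumOver-filter P? xs f

  length-filter-sum : ∀ {p} {P : Pred A p} (P? : Decidable P) xs → length (filter P? xs) ≡ sumOver xs (λ x → indicator (P? x))
  length-filter-sum P? []       = refl
  length-filter-sum P? (x ∷ xs) with P? x
  ... | yes _ = cong suc (length-filter-sum P? xs)
  ... | no  _ = length-filter-sum P? xs

  sumOver-binom : ∀ (xs : List A) n (f : A → ℕ → ℕ → ℕ) →
    sumOver xs (λ x → binom n (f x)) ≡ binom n (λ i j → sumOver xs (λ x → f x i j))
  sumOver-binom []       n f = sym (binom-zero n)
  sumOver-binom (x ∷ xs) n f = trans (cong (binom n (f x) +_) (sumOver-binom xs n f)) (sym (binom-+ n (f x) _))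

  sum-map : ∀ (f : A → ℕ) xs → sum (map f xs) ≡ sumOver xs f
  sum-map f []       = refl
  sum-map f (x ∷ xs) = cong (f x +_) (sum-map f xs)

module _ {a b} {A : Set a} {B : Set b} where

  sumOver-map : ∀ (g : A → B) xs f → sumOver (map g xs) f ≡ sumOver xs (λ x → f (g x))
  sumOver-map g []       f = refl
  sumOver-map g (x ∷ xs) f = cong (f (g x) +_) (sumOver-map g xs f)

  sumOver-concatMap : ∀ (g : A → List B) xs f → sumOver (concatMap g xs) f ≡ sumOver xs (λ x → sumOver (g x) f)
  sumOver-concatMap g []       f = refl
  sumOver-concatMap g (x ∷ xs) f = trans (sumOver-++ (g x) _ f) (cong (sumOver (g x) f +_) (sumOver-concatMap g xs f))

  length-concatMap-sum : ∀ (g : A → List B) xs → length (concatMap g xs) ≡ sumOver xs (λ x → length (g x))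
  length-concatMap-sum g []       = refl
  length-concatMap-sum g (x ∷ xs) = trans (length-++ (g x)) (cong (length (g x) +_) (length-concatMap-sum g xs))

  sumOver-swap : ∀ (xs : List A) (ys : List B) (f : A → B → ℕ) →
    sumOver xs (λ x → sumOver ys (f x)) ≡ sumOver ys (λ y → sumOver xs (λ x → f x y))
  sumOver-swap []       ys f = sym (sumOver-zero ys)
  sumOver-swap (x ∷ xs) ys f = trans (cong (sumOver ys (f x) +_) (sumOver-swap xs ys f)) (sym (sumOver-+ ys (f x) _))

-- Words over a finite alphabet

-- The nesting of the loops is that of `allParentMaps`, so that the two lists coincide entry by
-- entry.
tuples : ∀ {a} {A : Set a} → List A → ℕ → List (List A)
tuples xs zero    = [] ∷ []
tuples xs (suc r) = concatMap (λ w → map (_∷ w) xs) (tuples xs r)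

sumOver-tuples : ∀ {a} {A : Set a} (xs : List A) r f →
  sumOver (tuples xs (suc r)) f ≡ sumOver (tuples xs r) (λ w → sumOver xs (λ x → f (x ∷ w)))
sumOver-tuples xs r f = trans (sumOver-concatMap _ (tuples xs r) f)
  (sumOver-cong (tuples xs r) (λ w → sumOver-map (_∷ w) xs f))

labels-suc : ∀ n → labels (suc n) ≡ 1 ∷ map suc (labels n)
labels-suc n = cong (λ l → 1 ∷ map suc l) (sym (map-upTo suc n))

ones : Word → ℕ
ones []          = 0
ones (1 ∷ w)     = suc (ones w)
ones (_ ∷ w)     = ones w

strip : Word → Word
strip []                = []
strip (suc (suc a) ∷ w) = suc a ∷ strip w
strip (_ ∷ w)           = strip w

-- A word over {1,...,b+1} amounts to the set of positions of its letters 1 and a word over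
-- {1,...,b} on the other positions.
sum-words-by-ones : ∀ b r (f : ℕ → Word → ℕ) → sumOver (tuples (labels (suc b)) r) (λ w → f (ones w) (strip w)) ≡
  binom r (λ i j → sumOver (tuples (labels b) j) (f i))
sum-words-by-ones b zero    f = refl
sum-words-by-ones b (suc r) f = begin
  sumOver (tuples (labels (suc b)) (suc r)) (λ w → f (ones w) (strip w))
    ≡⟨ sumOver-tuples (labels (suc b)) r (λ w → f (ones w) (strip w)) ⟩
  sumOver W (λ w → sumOver (labels (suc b)) (λ x → f (ones (x ∷ w)) (strip (x ∷ w))))
    ≡⟨ sumOver-cong W (λ w → trans (cong (λ l → sumOver l (λ x → f (ones (x ∷ w)) (strip (x ∷ w)))) (labels-suc b))
         (cong (f (suc (ones w)) (strip w) +_) (trans (sumOver-map suc (labels b) _)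
           (trans (sumOver-map suc (upTo b) _) (sym (sumOver-map suc (upTo b) _)))))) ⟩
  sumOver W (λ w → f (suc (ones w)) (strip w) + sumOver (labels b) (λ x → f (ones w) (x ∷ strip w)))
    ≡⟨ sumOver-+ W _ _ ⟩
  sumOver W (λ w → f (suc (ones w)) (strip w)) + sumOver W (λ w → sumOver (labels b) (λ x → f (ones w) (x ∷ strip w)))
    ≡⟨ cong₂ _+_ (sum-words-by-ones b r (λ i → f (suc i)))
         (sum-words-by-ones b r (λ i w → sumOver (labels b) (λ x → f i (x ∷ w)))) ⟩
  binom r (λ i j → sumOver (tuples (labels b) j) (f (suc i))) +
  binom r (λ i j → sumOver (tuples (labels b) j) (λ w → sumOver (labels b) (λ x → f i (x ∷ w))))
    ≡⟨ cong (binom r (λ i j → sumOver (tuples (labels b) j) (f (suc i))) +_)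
         (binom-cong r (λ i j → sym (sumOver-tuples (labels b) j (f i)))) ⟩
  binom (suc r) (λ i j → sumOver (tuples (labels b) j) (f i)) ∎
  where
  open ≡-Reasoning
  W : List Word
  W = tuples (labels (suc b)) r

-- Set partitions

module _ (w : ℕ → ℕ) where

  increments : List ℕ → List (List ℕ)
  increments []       = []
  increments (m ∷ ms) = (suc m ∷ ms) ∷ map (m ∷_) (increments ms)

  -- The total weight of the partitions obtained from blocks of sizes ms by adding n elements.
  completions : ℕ → List ℕ → ℕ
  completions zero    ms = product (map w ms)
  completions (suc n) ms = completions n (1 ∷ ms) + sumOver (increments ms) (completions n)

  -- The added elements that join the first block form a subset of size i, and the others do not see
  -- that block. If an element opens a new block in front, `binom-leftComm` exchanges it with the
  -- block of size m; this case uses the hypothesis twice, the second time for a smaller number of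
  -- elements, whence the bound N.
  completions-∷-≤ : ∀ N n → n ≤ N → ∀ m ms → completions n (m ∷ ms) ≡ binom n (λ i j → w (m + i) * completions j ms)
  completions-∷-≤ N       zero    _         m ms = cong (λ x → w x * product (map w ms)) (sym (+-identityʳ m))
  completions-∷-≤ (suc N) (suc n) (s≤s n≤N) m ms = begin
    completions n (1 ∷ m ∷ ms) + (completions n (suc m ∷ ms) + sumOver (map (m ∷_) (increments ms)) (completions n))
      ≡⟨ cong₂ _+_ newBlock (cong₂ _+_ sameBlock otherBlock) ⟩
    binom n (λ i j → w (m + i) * completions j (1 ∷ ms)) + (binom n (λ i j → w (m + suc i) * completions j ms) +
    binom n (λ i j → w (m + i) * sumOver (increments ms) (completions j)))
      ≡⟨ +-rotate (binom n (λ i j → w (m + i) * completions j (1 ∷ ms))) (binom n (λ i j → w (m + suc i) * completions j ms)) _ ⟩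
    binom n (λ i j → w (m + suc i) * completions j ms) + (binom n (λ i j → w (m + i) * completions j (1 ∷ ms)) +
    binom n (λ i j → w (m + i) * sumOver (increments ms) (completions j)))
      ≡⟨ cong (binom n (λ i j → w (m + suc i) * completions j ms) +_) (trans (sym (binom-+ n _ _))
           (binom-cong n (λ i j → sym (*-distribˡ-+ (w (m + i)) _ _)))) ⟩
    binom (suc n) (λ i j → w (m + i) * completions j ms) ∎
    where
    open ≡-Reasoning
    below : ∀ i j → i + j ≡ n → j ≤ N
    below i j q = ≤-trans (subst (j ≤_) q (m≤n+m j i)) n≤N
    newBlock : completions n (1 ∷ m ∷ ms) ≡ binom n (λ i j → w (m + i) * completions j (1 ∷ ms))
    newBlock = begin
      completions n (1 ∷ m ∷ ms)
        ≡⟨ trans (completions-∷-≤ N n n≤N 1 (m ∷ ms)) (binom-cong-local n (λ i j q → trans (cong (w (1 + i) *_) (completions-∷-≤ N j (below i j q) m ms))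
             (sym (binom-*ˡ j (w (1 + i)) _)))) ⟩
      binom n (λ i j → binom j (λ k l → w (1 + i) * (w (m + k) * completions l ms)))
        ≡⟨ binom-leftComm n (λ i k l → w (1 + i) * (w (m + k) * completions l ms)) ⟩
      binom n (λ i j → binom j (λ k l → w (1 + k) * (w (m + i) * completions l ms)))
        ≡⟨ binom-cong-local n (λ i j q → trans (trans (binom-cong j (λ k l → *-rotate (w (1 + k)) (w (m + i)) _))
             (binom-*ˡ j (w (m + i)) _)) (cong (w (m + i) *_) (sym (completions-∷-≤ N j (below i j q) 1 ms)))) ⟩
      binom n (λ i j → w (m + i) * completions j (1 ∷ ms)) ∎
    sameBlock : completions n (suc m ∷ ms) ≡ binom n (λ i j → w (m + suc i) * completions j ms)
    sameBlock = trans (completions-∷-≤ N n n≤N (suc m) ms)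
      (binom-cong n (λ i j → cong (λ x → w x * completions j ms) (sym (+-suc m i))))
    otherBlock : sumOver (map (m ∷_) (increments ms)) (completions n) ≡
      binom n (λ i j → w (m + i) * sumOver (increments ms) (completions j))
    otherBlock = trans (sumOver-map (m ∷_) (increments ms) (completions n))
      (trans (sumOver-cong (increments ms) (completions-∷-≤ N n n≤N m))
      (trans (sumOver-binom (increments ms) n _)
      (binom-cong n (λ i j → sumOver-*ˡ (increments ms) (w (m + i)) (completions j)))))

  completions-∷ : ∀ n m ms → completions n (m ∷ ms) ≡ binom n (λ i j → w (m + i) * completions j ms)
  completions-∷ n = completions-∷-≤ n n ≤-refl

  sizes-insertEach : ∀ x P → map (map length) (insertEach x P) ≡ increments (map length P)
  sizes-insertEach x []       = refl
  sizes-insertEach x (B ∷ P) = cong ((suc (length B) ∷ map length P) ∷_) (trans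
    (trans (sym (map-∘ (insertEach x P))) (map-∘ (insertEach x P)))
    (cong (map (length B ∷_)) (sizes-insertEach x P)))

  -- `setPartitions` inserts the elements in increasing order, so a partition of [k + n] extends one
  -- of [n], and the extensions depend only on its block sizes.
  sum-setPartitions : ∀ n k → sumOver (setPartitions (k + n)) (λ P → product (map w (map length P))) ≡
    sumOver (setPartitions n) (λ P → completions k (map length P))
  sum-setPartitions n zero    = refl
  sum-setPartitions n (suc k) = begin
    sumOver (setPartitions (suc k + n)) (λ P → product (map w (map length P)))
      ≡⟨ cong (λ m → sumOver (setPartitions m) (λ P → product (map w (map length P)))) (sym (+-suc k n)) ⟩
    sumOver (setPartitions (k + suc n)) (λ P → product (map w (map length P)))
      ≡⟨ sum-setPartitions (suc n) k ⟩
    sumOver (setPartitions (suc n)) (λ P → completions k (map length P))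
      ≡⟨ sumOver-concatMap _ (setPartitions n) _ ⟩
    sumOver (setPartitions n) (λ P → completions k (1 ∷ map length P) +
      sumOver (insertEach (suc n) P) (λ P′ → completions k (map length P′)))
      ≡⟨ sumOver-cong (setPartitions n) (λ P → cong (completions k (1 ∷ map length P) +_)
           (trans (sym (sumOver-map (map length) (insertEach (suc n) P) (completions k)))
                  (cong (λ l → sumOver l (completions k)) (sizes-insertEach (suc n) P)))) ⟩
    sumOver (setPartitions n) (λ P → completions (suc k) (map length P)) ∎
    where open ≡-Reasoning

length-insertEach : ∀ x P → All (λ P′ → length P′ ≡ length P) (insertEach x P)
length-insertEach x []      = []
length-insertEach x (B ∷ P) = refl ∷ AllP.map⁺ (All.map (cong suc) (length-insertEach x P))

length-setPartitions : ∀ n → All (λ P → length P ≤ n) (setPartitions n)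
length-setPartitions zero    = z≤n ∷ []
length-setPartitions (suc n) = AllP.concat⁺ (AllP.map⁺ (All.map
  (λ {P} ≤n → s≤s ≤n ∷ All.map (λ e → ≤-trans (≤-reflexive e) (m≤n⇒m≤1+n ≤n)) (length-insertEach (suc n) P))
  (length-setPartitions n)))

nonempty-setPartitions : ∀ n → All (λ P → 1 ≤ length P) (setPartitions (suc n))
nonempty-setPartitions n = AllP.concat⁺ (AllP.map⁺ (All.universal
  (λ { [] → s≤s z≤n ∷ [] ; P@(_ ∷ _) → s≤s z≤n ∷ All.map (λ e → subst (1 ≤_) (sym e) (s≤s z≤n)) (length-insertEach (suc n) P) })
  (setPartitions n)))

sumFrom1-cong : ∀ n {f g : ℕ → ℕ} → (∀ k → f k ≡ g k) → sumFrom1 n f ≡ sumFrom1 n g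
sumFrom1-cong zero    e = refl
sumFrom1-cong (suc n) e = cong₂ _+_ (sumFrom1-cong n e) (e (suc n))

sumFrom1-+ : ∀ n f g → sumFrom1 n (λ k → f k + g k) ≡ sumFrom1 n f + sumFrom1 n g
sumFrom1-+ zero    f g = refl
sumFrom1-+ (suc n) f g = trans (cong (_+ (f (suc n) + g (suc n))) (sumFrom1-+ n f g)) (+-interchange (sumFrom1 n f) _ _ _)

sumFrom1-zero : ∀ n f → (∀ k → k ≤ n → f k ≡ 0) → sumFrom1 n f ≡ 0
sumFrom1-zero zero    f e = refl
sumFrom1-zero (suc n) f e = cong₂ _+_ (sumFrom1-zero n f (λ k k≤n → e k (m≤n⇒m≤1+n k≤n))) (e (suc n) ≤-refl)

sumFrom1-pick : ∀ n l x → 1 ≤ l → l ≤ n → sumFrom1 n (λ k → indicator (l ≟ k) * x) ≡ x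
sumFrom1-pick zero    l x 1≤l l≤0 = ⊥-elim (<⇒≱ 1≤l l≤0)
sumFrom1-pick (suc n) l x 1≤l l≤n with l ≟ suc n
... | yes refl = cong₂ _+_ (sumFrom1-zero n _ (λ k k≤n → cong (_* x) (indicator-no k (λ e → <⇒≢ (s≤s k≤n) (sym e))))) (+-identityʳ x)
  where
  indicator-no : ∀ k → l ≢ k → indicator (l ≟ k) ≡ 0
  indicator-no k l≢k with l ≟ k
  ... | yes e = ⊥-elim (l≢k e)
  ... | no _  = refl
... | no  l≢   = trans (+-identityʳ _) (sumFrom1-pick n l x 1≤l (s≤s⁻¹ (≤∧≢⇒< l≤n l≢)))

sumFrom1-by-length : ∀ {A : Set} n (f : List A → ℕ) (xs : List (List A)) → All (λ P → 1 ≤ length P) xs → All (λ P → length P ≤ n) xs →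
  sumFrom1 n (λ k → sumOver (filter (λ P → length P ≟ k) xs) f) ≡ sumOver xs f
sumFrom1-by-length n f xs pos bd = trans (sumFrom1-cong n (λ k → sumOver-filter (λ P → length P ≟ k) xs f)) (go xs pos bd)
  where
  go : ∀ xs → All (λ P → 1 ≤ length P) xs → All (λ P → length P ≤ n) xs →
    sumFrom1 n (λ k → sumOver xs (λ P → indicator (length P ≟ k) * f P)) ≡ sumOver xs f
  go []       []        []       = sumFrom1-zero n _ (λ _ _ → refl)
  go (P ∷ xs) (p ∷ pos) (b ∷ bd) = trans (sumFrom1-+ n _ _) (cong₂ _+_ (sumFrom1-pick n (length P) (f P) p b) (go xs pos bd))

sum-Ainf : ∀ n → 1 ≤ n → sumFrom1 n (Ainf n) ≡ chains n
sum-Ainf n@(suc n′) _ = begin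
  sumFrom1 n (Ainf n)
    ≡⟨ sumFrom1-cong n (λ k → sum-map _ (filter (λ P → length P ≟ k) (setPartitions n))) ⟩
  sumFrom1 n (λ k → sumOver (filter (λ P → length P ≟ k) (setPartitions n)) (λ P → product (map blockWeight P)))
    ≡⟨ sumFrom1-by-length n _ (setPartitions n) (nonempty-setPartitions n′) (length-setPartitions n) ⟩
  sumOver (setPartitions n) (λ P → product (map blockWeight P))
    ≡⟨ sumOver-cong (setPartitions n) (λ P → cong product (map-∘ P)) ⟩
  sumOver (setPartitions n) (λ P → product (map w (map length P)))
    ≡⟨ cong (λ m → sumOver (setPartitions m) (λ P → product (map w (map length P)))) (sym (+-identityʳ n)) ⟩
  sumOver (setPartitions (n + 0)) (λ P → product (map w (map length P)))
    ≡⟨ trans (sum-setPartitions w 0 n) (+-identityʳ _) ⟩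
  completions w n []
    -- The first element opens a block of size 1; the i elements that join it give it the weight
    -- i^i, which is `primes (suc i)`.
    ≡⟨ recursion-unique (primes ∘ suc) (λ m → completions w m []) chains refl
         (λ m → trans (+-identityʳ _) (trans (completions-∷ w m 1 [])
           (binom-cong m (λ i j → cong (_* completions w j []) (sym (primes-closed i)))))) chains-suc n ⟩
  chains n ∎
  where
  open ≡-Reasoning
  w : ℕ → ℕ
  w m = (m ∸ 1) ^ (m ∸ 1)

-- Parking functions

T-∧⁻ : ∀ {x y} → T (x ∧ y) → T x × T y
T-∧⁻ = Equivalence.to T-∧

T-∧⁺ : ∀ {x y} → T x → T y → T (x ∧ y)
T-∧⁺ p q = Equivalence.from T-∧ (p , q)

countLe-accept : ∀ {i a w} → a ≤ i → countLe i (a ∷ w) ≡ suc (countLe i w)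
countLe-accept {i} p = cong length (filter-accept (λ a → a ≤? i) p)

countLe-reject : ∀ {i a w} → ¬ a ≤ i → countLe i (a ∷ w) ≡ countLe i w
countLe-reject {i} p = cong length (filter-reject (λ a → a ≤? i) p)

countLe-++ : ∀ i v w → countLe i (v ++ w) ≡ countLe i v + countLe i w
countLe-++ i v w = trans (cong length (filter-++ (λ a → a ≤? i) v w)) (length-++ (filter (λ a → a ≤? i) v))

countLe-↭ : ∀ i {v w} → v ↭ w → countLe i v ≡ countLe i w
countLe-↭ i p = PermP.↭-length (PermP.filter-↭ (λ a → a ≤? i) p)

countLe-all : ∀ {i w} → All (_≤ i) w → countLe i w ≡ length w
countLe-all {i} p = cong length (filter-all (λ a → a ≤? i) p)

countLe-none : ∀ {i w} → All (i <_) w → countLe i w ≡ 0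
countLe-none {i} p = cong length (filter-none (λ a → a ≤? i) (All.map <⇒≱ p))

countLe-≤length : ∀ i w → countLe i w ≤ length w
countLe-≤length i w = length-filter (λ a → a ≤? i) w

countLe-full : ∀ i w → length w ≤ countLe i w → All (_≤ i) w
countLe-full i w p = subst (All (_≤ i)) (filter-complete (λ a → a ≤? i) (≤-antisym (countLe-≤length i w) p))
  (AllP.all-filter (λ a → a ≤? i) w)

-- A common form of both index conditions: on a sorted word the parking condition is `belowFrom 1`,
-- and primality is `belowFrom 1` of its tail.
belowFrom : ℕ → Word → Bool
belowFrom k []      = true
belowFrom k (x ∷ s) = (x ≤ᵇ k) ∧ belowFrom (suc k) s

belowFrom-indexed : ∀ k (f : ℕ → ℕ) → (∀ i → f i ≡ k + i) → ∀ s →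
  foldr (λ p b → (proj₂ p ≤ᵇ proj₁ p) ∧ b) true (zip (applyUpTo f (length s)) s) ≡ belowFrom k s
belowFrom-indexed k f e []      = refl
belowFrom-indexed k f e (x ∷ s) = cong₂ _∧_ (cong (x ≤ᵇ_) (trans (e 0) (+-identityʳ k)))
  (belowFrom-indexed (suc k) (f ∘ suc) (λ i → trans (e (suc i)) (+-suc k i)) s)

<ᵇ-suc : ∀ m n → (m <ᵇ suc n) ≡ (m ≤ᵇ n)
<ᵇ-suc zero    n = refl
<ᵇ-suc (suc m) n = refl

-- All indices are at least 2 here, so the first alternative fails, and a strict bound by k + 2 is a
-- weak bound by k + 1.
belowFrom-strict : ∀ k (f : ℕ → ℕ) → (∀ i → f i ≡ suc (suc k) + i) → ∀ s →
  foldr (λ p b → ((proj₁ p ≤ᵇ 1) ∨ (proj₂ p <ᵇ proj₁ p)) ∧ b) true (zip (applyUpTo f (length s)) s) ≡ belowFrom (suc k) s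
belowFrom-strict k f e []      = refl
belowFrom-strict k f e (x ∷ s) = cong₂ _∧_
  (trans (cong (λ m → (m ≤ᵇ 1) ∨ (x <ᵇ m)) (trans (e 0) (+-identityʳ (suc (suc k))))) (<ᵇ-suc x (suc k)))
  (belowFrom-strict (suc k) (f ∘ suc) (λ i → trans (e (suc i)) (+-suc (suc (suc k)) i)) s)

belowFrom⇒count : ∀ k s → T (belowFrom (suc k) s) → ∀ i → i ≤ length s → i ≤ countLe (k + i) s
belowFrom⇒count k s       p zero    _ = z≤n
belowFrom⇒count k (x ∷ s) p (suc i) (s≤s i≤) = subst (suc i ≤_) (sym (countLe-accept (≤-trans x≤ (≤-trans (s≤s (m≤m+n k i)) (≤-reflexive (sym (+-suc k i)))))))
  (s≤s (subst (λ m → i ≤ countLe m s) (sym (+-suc k i)) (belowFrom⇒count (suc k) s (proj₂ (T-∧⁻ p)) i i≤)))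
  where
  x≤ : x ≤ suc k
  x≤ = ≤ᵇ⇒≤ x (suc k) (proj₁ (T-∧⁻ {x ≤ᵇ suc k} p))

-- In a sorted word, a first letter above k + 1 would leave no letter at most k + 1, against the
-- count for i = 1.
count⇒belowFrom : ∀ k s → AllPairs _≤_ s → (∀ i → i ≤ length s → i ≤ countLe (k + i) s) → T (belowFrom (suc k) s)
count⇒belowFrom k []      _        c = tt
count⇒belowFrom k (x ∷ s) (q ∷ qs) c = T-∧⁺ (≤⇒≤ᵇ x≤) (count⇒belowFrom (suc k) s qs (λ i i≤ →
  s≤s⁻¹ (subst (suc i ≤_) (trans (cong (λ m → countLe m (x ∷ s)) (+-suc k i)) (countLe-accept (≤-trans x≤ (s≤s (m≤m+n k i))))) (c (suc i) (s≤s i≤)))))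
  where
  x≤ : x ≤ suc k
  x≤ = case x ≤? suc k of λ
    { (yes p) → p
    ; (no ¬p) → ⊥-elim (1+n≰n (subst (1 ≤_) (trans (cong (λ m → countLe m (x ∷ s)) (+-comm k 1)) (countLe-none (≰⇒> ¬p ∷ All.map (≤-trans (≰⇒> ¬p)) q))) (c 1 (s≤s z≤n)))) }

sortW-↭ : ∀ u → sortW u ↭ u
sortW-↭ = ISortP.sort-↭ ≤-decTotalOrder

sortW-sorted : ∀ u → AllPairs _≤_ (sortW u)
sortW-sorted u = Linked⇒AllPairs ≤-trans (ISortP.sort-↗ ≤-decTotalOrder u)

positive⁻ : ∀ u → T (positive u) → All (1 ≤_) u
positive⁻ []      _ = []
positive⁻ (a ∷ u) p = ≤ᵇ⇒≤ 1 a (proj₁ (T-∧⁻ {1 ≤ᵇ a} p)) ∷ positive⁻ u (proj₂ (T-∧⁻ {1 ≤ᵇ a} p))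

positive⁺ : ∀ {u} → All (1 ≤_) u → T (positive u)
positive⁺ []       = tt
positive⁺ (p ∷ ps) = T-∧⁺ (≤⇒≤ᵇ p) (positive⁺ ps)

-- The condition on the sorted word in terms of counts. These do not depend on the order of the
-- letters, so sorting can be forgotten from here on.
IsParking : Word → Set
IsParking u = All (1 ≤_) u × (∀ i → i ≤ length u → i ≤ countLe i u)

-- The letter at index i + 1 of the sorted word is at most i exactly when more than i letters are at
-- most i.
IsPrime : Word → Set
IsPrime u = IsParking u × (∀ i → 1 ≤ i → i < length u → i < countLe i u)

isPF-belowFrom : ∀ s → foldr (λ p b → (proj₂ p ≤ᵇ proj₁ p) ∧ b) true (indexed s) ≡ belowFrom 1 s
isPF-belowFrom s = trans (cong (λ l → foldr (λ p b → (proj₂ p ≤ᵇ proj₁ p) ∧ b) true (zip l s)) (map-upTo suc (length s)))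
  (belowFrom-indexed 1 suc (λ _ → refl) s)

isPF⇒parking : ∀ u → T (isPF u) → IsParking u
isPF⇒parking u p = positive⁻ u (proj₁ (T-∧⁻ {positive u} p)) , λ i i≤ → subst (i ≤_) (countLe-↭ i (sortW-↭ u))
  (belowFrom⇒count 0 (sortW u) (subst T (isPF-belowFrom (sortW u)) (proj₂ (T-∧⁻ {positive u} p))) i
    (subst (i ≤_) (sym (PermP.↭-length (sortW-↭ u))) i≤))

parking⇒isPF : ∀ u → IsParking u → T (isPF u)
parking⇒isPF u (pos , c) = T-∧⁺ (positive⁺ pos) (subst T (sym (isPF-belowFrom (sortW u)))
  (count⇒belowFrom 0 (sortW u) (sortW-sorted u) (λ i i≤ → subst (i ≤_) (countLe-↭ i (↭-sym (sortW-↭ u)))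
    (c i (subst (i ≤_) (PermP.↭-length (sortW-↭ u)) i≤)))))

strictTail : Word → Bool
strictTail s = foldr (λ p b → ((proj₁ p ≤ᵇ 1) ∨ (proj₂ p <ᵇ proj₁ p)) ∧ b) true (indexed s)

strictTail-belowFrom : ∀ x s → strictTail (x ∷ s) ≡ belowFrom 1 s
strictTail-belowFrom x s = trans
  (cong (λ l → foldr (λ p b → ((proj₁ p ≤ᵇ 1) ∨ (proj₂ p <ᵇ proj₁ p)) ∧ b) true (zip l (x ∷ s))) (map-upTo suc (suc (length s))))
  (belowFrom-strict 0 (suc ∘ suc) (λ _ → refl) s)

strictTail⇒count : ∀ s → (1 ≤ length s → 1 ≤ countLe 1 s) → AllPairs _≤_ s → T (strictTail s) →
  ∀ i → 1 ≤ i → i < length s → i < countLe i s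
strictTail⇒count (x ∷ s) one (q ∷ _) p i 1≤i (s≤s i≤) = subst (i <_) (sym (countLe-accept x≤i))
  (s≤s (belowFrom⇒count 0 s (subst T (strictTail-belowFrom x s) p) i i≤))
  where
  x≤i : x ≤ i
  x≤i = case x ≤? 1 of λ
    { (yes x≤1) → ≤-trans x≤1 1≤i
    ; (no x≰1)  → ⊥-elim (1+n≰n (subst (1 ≤_) (countLe-none (≰⇒> x≰1 ∷ All.map (≤-trans (≰⇒> x≰1)) q)) (one (s≤s z≤n)))) }

count⇒strictTail : ∀ s → AllPairs _≤_ s → (∀ i → 1 ≤ i → i < length s → i < countLe i s) → T (strictTail s)
count⇒strictTail []      _        c = tt
count⇒strictTail (x ∷ s) (_ ∷ qs) c = subst T (sym (strictTail-belowFrom x s)) (count⇒belowFrom 0 s qs bound)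
  where
  bound : ∀ i → i ≤ length s → i ≤ countLe i s
  bound zero    _  = z≤n
  bound (suc i) i≤ with x ≤? suc i
  ... | yes p = s≤s⁻¹ (subst (suc i <_) (countLe-accept p) (c (suc i) (s≤s z≤n) (s≤s i≤)))
  ... | no ¬p = <⇒≤ (subst (suc i <_) (countLe-reject ¬p) (c (suc i) (s≤s z≤n) (s≤s i≤)))

isPrimePF⇒prime : ∀ u → T (isPrimePF u) → IsPrime u
isPrimePF⇒prime u p = park , λ i 1≤i i< → subst (i <_) (countLe-↭ i (sortW-↭ u))
  (strictTail⇒count (sortW u) (λ l → subst (1 ≤_) (countLe-↭ 1 (↭-sym (sortW-↭ u))) (proj₂ park 1 (subst (1 ≤_) (PermP.↭-length (sortW-↭ u)) l)))
    (sortW-sorted u) (proj₂ (T-∧⁻ {isPF u} p)) i 1≤i (subst (i <_) (sym (PermP.↭-length (sortW-↭ u))) i<))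
  where
  park : IsParking u
  park = isPF⇒parking u (proj₁ (T-∧⁻ {isPF u} p))

prime⇒isPrimePF : ∀ u → IsPrime u → T (isPrimePF u)
prime⇒isPrimePF u (park , c) = T-∧⁺ (parking⇒isPF u park)
  (count⇒strictTail (sortW u) (sortW-sorted u) (λ i 1≤i i< → subst (i <_) (countLe-↭ i (↭-sym (sortW-↭ u)))
    (c i 1≤i (subst (i <_) (PermP.↭-length (sortW-↭ u)) i<))))

countLe-strip : ∀ i {w} → All (1 ≤_) w → countLe (suc i) w ≡ ones w + countLe i (strip w)
countLe-strip i []                             = refl
countLe-strip i {1 ∷ w}           (_ ∷ ps)     = trans (countLe-accept {suc i} {1} {w} (s≤s z≤n)) (cong suc (countLe-strip i ps))
countLe-strip i {suc (suc a) ∷ w} (_ ∷ ps) with suc a ≤? i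
... | yes p = trans (countLe-accept (s≤s p)) (trans (cong suc (countLe-strip i ps))
                (trans (sym (+-suc (ones w) _)) (cong (ones w +_) (sym (countLe-accept p)))))
... | no ¬p = trans (countLe-reject (λ q → ¬p (s≤s⁻¹ q))) (trans (countLe-strip i ps) (cong (ones w +_) (sym (countLe-reject ¬p))))

strip-positive : ∀ w → All (1 ≤_) (strip w)
strip-positive []                = []
strip-positive (zero ∷ w)        = strip-positive w
strip-positive (suc zero ∷ w)    = strip-positive w
strip-positive (suc (suc a) ∷ w) = s≤s z≤n ∷ strip-positive w

-- s customers wait before time 1, w lists the arrival times of the others, one customer
-- is served per time unit: is the queue nonempty at times 1, …, b?
busy : ℕ → ℕ → Word → Bool
busy zero    s       w = true
busy (suc b) zero    w = false
busy (suc b) (suc s) w = busy b (s + ones w) (strip w)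

busy⇒count : ∀ b s w → All (1 ≤_) w → T (busy b s w) → ∀ i → i < b → i < s + countLe i w
busy⇒count (suc b) (suc s) w pos p zero    _         = s≤s z≤n
busy⇒count (suc b) (suc s) w pos p (suc i) (s≤s i<b) = s≤s (subst (i <_)
  (trans (+-assoc s (ones w) _) (cong (s +_) (sym (countLe-strip i pos))))
  (busy⇒count b (s + ones w) (strip w) (strip-positive w) p i i<b))

count⇒busy : ∀ b s w → All (1 ≤_) w → (∀ i → i < b → i < s + countLe i w) → T (busy b s w)
count⇒busy zero    s       w pos c = tt
count⇒busy (suc b) zero    w pos c = ⊥-elim (1+n≰n (subst (1 ≤_) (countLe-none pos) (c 0 (s≤s z≤n))))
count⇒busy (suc b) (suc s) w pos c = count⇒busy b (s + ones w) (strip w) (strip-positive w) (λ i i<b →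
  subst (i <_) (sym (trans (+-assoc s (ones w) _) (cong (s +_) (sym (countLe-strip i pos))))) (s≤s⁻¹ (c (suc i) (s≤s i<b))))

-- If one of s + 1 customers is served and i arrive, then s + i are waiting: this is the recursion
-- `forests-root`. The hypothesis says that there are as many customers as time units.
sum-busy : ∀ b s r → s + r ≡ b → sumOver (tuples (labels b) r) (λ w → indicator (T? (busy b s w))) ≡ forests s r
sum-busy zero    zero    zero    refl = refl
sum-busy (suc b) zero    (suc r) refl = sumOver-zero (tuples (labels (suc b)) (suc r))
sum-busy (suc b) (suc s) r       e    = trans (sum-words-by-ones b r (λ i w → indicator (T? (busy b (s + i) w))))
  (trans (binom-cong-local r (λ i j q → sum-busy b (s + i) j (trans (+-assoc s i j) (trans (cong (s +_) q) (suc-injective e)))))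
    (forests-root r s))

primeWords : ℕ → List Word
primeWords m = filter (λ w → T? (isPrimePF w)) (tuples (labels m) m)

All-tuples : ∀ {a p} {A : Set a} {P : Pred A p} {xs : List A} → All P xs → ∀ r → All (λ w → length w ≡ r × All P w) (tuples xs r)
All-tuples ps zero    = (refl , []) ∷ []
All-tuples ps (suc r) = AllP.concat⁺ (AllP.map⁺ (All.map
  (λ { (l , qs) → AllP.map⁺ (All.map (λ p → cong suc l , p ∷ qs) ps) }) (All-tuples ps r)))

labels-positive : ∀ n → All (1 ≤_) (labels n)
labels-positive n = AllP.map⁺ (All.universal (λ _ → s≤s z≤n) (upTo n))

indicator-⇔ : ∀ {p q} {P : Set p} {Q : Set q} (P? : Dec P) (Q? : Dec Q) → (P → Q) → (Q → P) → indicator P? ≡ indicator Q?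
indicator-⇔ (yes _) (yes _) f g = refl
indicator-⇔ (yes p) (no ¬q) f g = ⊥-elim (¬q (f p))
indicator-⇔ (no ¬p) (yes q) f g = ⊥-elim (¬p (g q))
indicator-⇔ (no _)  (no _)  f g = refl

-- One letter 1 stands for the customer served in the first time unit; the other letters 1 form the
-- initial queue, and the stripped word lists the later arrivals. The strict inequalities of
-- primality say that this queue is nonempty for b further time units.
length-primeWords : ∀ b → length (primeWords (suc b)) ≡ primes (suc b)
length-primeWords b = begin
  length (primeWords (suc b))
    ≡⟨ length-filter-sum (λ w → T? (isPrimePF w)) W ⟩
  sumOver W (λ w → indicator (T? (isPrimePF w)))
    ≡⟨ sumOver-cong-All (All.map (λ { {w} (l , pos) → indicator-⇔ (T? (isPrimePF w)) (T? (queue (ones w) (strip w)))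
         (λ p → to w l pos (isPrimePF⇒prime w p)) (λ q → prime⇒isPrimePF w (from w l pos q)) })
         (All-tuples (labels-positive (suc b)) (suc b))) ⟩
  sumOver W (λ w → indicator (T? (queue (ones w) (strip w))))
    ≡⟨ sum-words-by-ones b (suc b) (λ i w → indicator (T? (queue i w))) ⟩
  binom (suc b) (λ i j → sumOver (tuples (labels b) j) (λ w → indicator (T? (queue i w))))
    ≡⟨ binom-cong-local (suc b) count ⟩
  binom (suc b) planted ∎
  where
  open ≡-Reasoning
  W : List Word
  W = tuples (labels (suc b)) (suc b)
  queue : ℕ → Word → Bool
  queue zero    w = false
  queue (suc i) w = busy b i w
  count : ∀ i j → i + j ≡ suc b → sumOver (tuples (labels b) j) (λ w → indicator (T? (queue i w))) ≡ planted i j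
  count zero    j e = sumOver-zero (tuples (labels b) j)
  count (suc i) j e = sum-busy b i j (suc-injective e)
  ones≡countLe : ∀ w → All (1 ≤_) w → countLe 1 w ≡ ones w
  ones≡countLe w pos = trans (countLe-strip 0 pos) (trans (cong (ones w +_) (countLe-none (strip-positive w))) (+-identityʳ _))
  to : ∀ w → length w ≡ suc b → All (1 ≤_) w → IsPrime w → T (queue (ones w) (strip w))
  to w l pos (park , c) with ones w in eq
  ... | zero  = 1+n≰n (subst (1 ≤_) (trans (ones≡countLe w pos) eq) (proj₂ park 1 (subst (1 ≤_) (sym l) (s≤s z≤n))))
  ... | suc k = count⇒busy b k (strip w) (strip-positive w) (λ i i<b → s≤s⁻¹ (subst (suc i <_)
                  (trans (countLe-strip i pos) (cong (_+ countLe i (strip w)) eq))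
                  (c (suc i) (s≤s z≤n) (subst (suc i <_) (sym l) (s≤s i<b)))))
  from : ∀ w → length w ≡ suc b → All (1 ≤_) w → T (queue (ones w) (strip w)) → IsPrime w
  from w l pos q with ones w in eq
  ... | suc k = (pos , park) , λ { (suc i) _ i< → strict i (s≤s⁻¹ (subst (suc i <_) l i<)) }
    where
    busyCount : ∀ i → i < b → i < k + countLe i (strip w)
    busyCount = busy⇒count b k (strip w) (strip-positive w) q
    value : ∀ i → countLe (suc i) w ≡ suc (k + countLe i (strip w))
    value i = trans (countLe-strip i pos) (cong (_+ countLe i (strip w)) eq)
    strict : ∀ i → i < b → suc i < countLe (suc i) w
    strict i i<b = subst (suc i <_) (sym (value i)) (s≤s (busyCount i i<b))
    park : ∀ i → i ≤ length w → i ≤ countLe i w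
    park zero          _ = z≤n
    park (suc zero)    _ = subst (1 ≤_) (sym (value 0)) (s≤s z≤n)
    park (suc (suc i)) i≤ = ≤-trans (strict i (s≤s⁻¹ (subst (suc (suc i) ≤_) l i≤)))
                              (subst₂ _≤_ (sym (value i)) (sym (value (suc i)))
                                (s≤s (+-monoʳ-≤ k (mono (strip w)))))
      where
      mono : ∀ w → countLe i w ≤ countLe (suc i) w
      mono []      = z≤n
      mono (a ∷ w) with a ≤? i
      ... | yes p = subst₂ _≤_ (sym (countLe-accept p)) (sym (countLe-accept (m≤n⇒m≤1+n p))) (s≤s (mono w))
      ... | no ¬p with a ≤? suc i
      ...   | yes p′ = subst₂ _≤_ (sym (countLe-reject ¬p)) (sym (countLe-accept p′)) (m≤n⇒m≤1+n (mono w))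
      ...   | no ¬p′ = subst₂ _≤_ (sym (countLe-reject ¬p)) (sym (countLe-reject ¬p′)) (mono w)

-- Counting level structures

prodAt : ∀ {a} {A : Set a} → (ℕ → A → ℕ) → List A → ℕ
prodAt φ []       = 1
prodAt φ (x ∷ xs) = φ 1 x * prodAt (φ ∘ suc) xs

prodTo : ℕ → (ℕ → ℕ) → ℕ
prodTo zero    c = 1
prodTo (suc r) c = c 1 * prodTo r (c ∘ suc)

prodTo-cong : ∀ r {c d : ℕ → ℕ} → (∀ v → 1 ≤ v → v ≤ r → c v ≡ d v) → prodTo r c ≡ prodTo r d
prodTo-cong zero    e = refl
prodTo-cong (suc r) e = cong₂ _*_ (e 1 (s≤s z≤n) (s≤s z≤n)) (prodTo-cong r (λ v 1≤v v≤r → e (suc v) (s≤s z≤n) (s≤s v≤r)))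

prodAt-cong : ∀ {a} {A : Set a} {φ ψ : ℕ → A → ℕ} → (∀ v x → φ v x ≡ ψ v x) → ∀ xs → prodAt φ xs ≡ prodAt ψ xs
prodAt-cong e []       = refl
prodAt-cong e (x ∷ xs) = cong₂ _*_ (e 1 x) (prodAt-cong (λ v → e (suc v)) xs)

-- Distributivity; it expresses that, for a fixed tagging, the vertices choose their parents
-- independently.
sum-prodAt : ∀ {a} {A : Set a} (X : List A) r (φ : ℕ → A → ℕ) →
  sumOver (tuples X r) (prodAt φ) ≡ prodTo r (λ v → sumOver X (φ v))
sum-prodAt X zero    φ = refl
sum-prodAt X (suc r) φ = begin
  sumOver (tuples X (suc r)) (prodAt φ)
    ≡⟨ sumOver-tuples X r (prodAt φ) ⟩
  sumOver (tuples X r) (λ w → sumOver X (λ x → φ 1 x * prodAt (φ ∘ suc) w))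
    ≡⟨ sumOver-cong (tuples X r) (λ w → trans (sumOver-cong X (λ x → *-comm (φ 1 x) _)) (trans (sumOver-*ˡ X (prodAt (φ ∘ suc) w) (φ 1)) (*-comm (prodAt (φ ∘ suc) w) (sumOver X (φ 1))))) ⟩
  sumOver (tuples X r) (λ w → sumOver X (φ 1) * prodAt (φ ∘ suc) w)
    ≡⟨ sumOver-*ˡ (tuples X r) (sumOver X (φ 1)) _ ⟩
  sumOver X (φ 1) * sumOver (tuples X r) (prodAt (φ ∘ suc))
    ≡⟨ cong (sumOver X (φ 1) *_) (sum-prodAt X r (φ ∘ suc)) ⟩
  prodTo (suc r) (λ v → sumOver X (φ v)) ∎
  where open ≡-Reasoning

tagOf : List ℕ → ℕ → ℕ
tagOf []      _             = 0
tagOf (x ∷ l) zero          = 0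
tagOf (x ∷ l) (suc zero)    = x
tagOf (x ∷ l) (suc (suc v)) = tagOf l (suc v)

prodTo-tagOf : ∀ (ψ : ℕ → ℕ → ℕ) l → prodTo (length l) (λ v → ψ v (tagOf l v)) ≡ prodAt ψ l
prodTo-tagOf ψ []      = refl
prodTo-tagOf ψ (x ∷ l) = cong (ψ 1 x *_) (trans (prodTo-cong (length l) (λ { (suc v) _ _ → refl })) (prodTo-tagOf (ψ ∘ suc) l))

occ : ℕ → List ℕ → ℕ
occ t l = sumOver l (λ x → indicator (x ≟ t))

sum-labels-suc : ∀ n f → sumOver (labels (suc n)) f ≡ f 1 + sumOver (labels n) (f ∘ suc)
sum-labels-suc n f = trans (cong (λ l → sumOver l f) (labels-suc n)) (cong (f 1 +_) (sumOver-map suc (labels n) f))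

All-labels : ∀ {p} {P : ℕ → Set p} n → (∀ v → 1 ≤ v → v ≤ n → P v) → All P (labels n)
All-labels n f = AllP.map⁺ (AllP.applyUpTo⁺₁ id n (λ {i} i<n → f (suc i) (s≤s z≤n) i<n))

All-labels⁻ : ∀ {p} {P : ℕ → Set p} n → All P (labels n) → ∀ v → 1 ≤ v → v ≤ n → P v
All-labels⁻ n ps (suc v) _ v≤n = AllP.applyUpTo⁻ id n (AllP.map⁻ ps) v≤n

sum-labels-cong : ∀ n {f g : ℕ → ℕ} → (∀ v → 1 ≤ v → v ≤ n → f v ≡ g v) → sumOver (labels n) f ≡ sumOver (labels n) g
sum-labels-cong n e = sumOver-cong-All (All-labels n e)

sum-labels-tagOf : ∀ l (f : ℕ → ℕ) → sumOver (labels (length l)) (λ u → f (tagOf l u)) ≡ sumOver l f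
sum-labels-tagOf []      f = refl
sum-labels-tagOf (x ∷ l) f = trans (sum-labels-suc (length l) (λ u → f (tagOf (x ∷ l) u))) (cong (f x +_)
  (trans (sum-labels-cong (length l) (λ { (suc v) _ _ → refl })) (sum-labels-tagOf l f)))

-- With tag 0 marking the chain, this is the number of possible parents of a vertex v of tag 1.
zerosBefore : List ℕ → ℕ → ℕ
zerosBefore []      v       = 0
zerosBefore (x ∷ l) zero    = 0
zerosBefore (x ∷ l) (suc zero) = 0
zerosBefore (x ∷ l) (suc (suc v)) = indicator (x ≟ 0) + zerosBefore l (suc v)

zerosBefore-sum : ∀ l v → 1 ≤ v → sumOver (labels (length l)) (λ u → indicator ((u <? v) ×-dec (tagOf l u ≟ 0))) ≡ zerosBefore l v
zerosBefore-sum []      v             _ = refl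
zerosBefore-sum (x ∷ l) (suc zero)    _ = trans
  (sum-labels-cong (suc (length l)) {λ u → indicator ((u <? 1) ×-dec (tagOf (x ∷ l) u ≟ 0))} {λ _ → 0} (λ { (suc u) _ _ → refl }))
  (sumOver-zero (labels (suc (length l))))
zerosBefore-sum (x ∷ l) (suc (suc v)) _ = trans (sum-labels-suc (length l) _) (cong₂ _+_
  (indicator-⇔ ((1 <? suc (suc v)) ×-dec (x ≟ 0)) (x ≟ 0) proj₂ (λ e → s≤s (s≤s z≤n) , e))
  (trans (sum-labels-cong (length l) (λ { (suc u) _ _ → indicator-⇔ ((suc (suc u) <? suc (suc v)) ×-dec (tagOf l (suc u) ≟ 0))
    ((suc u <? suc v) ×-dec (tagOf l (suc u) ≟ 0)) (λ { (p , q) → s≤s⁻¹ p , q }) (λ { (p , q) → s≤s p , q }) }))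
    (zerosBefore-sum l (suc v) (s≤s z≤n))))

prodOver : List ℕ → (ℕ → ℕ) → ℕ
prodOver []      g = 1
prodOver (a ∷ w) g = g a * prodOver w g

prodOver-strip : ∀ {w} → All (1 ≤_) w → ∀ g → prodOver w g ≡ g 1 ^ ones w * prodOver (strip w) (g ∘ suc)
prodOver-strip {[]}              []       g = refl
prodOver-strip {1 ∷ w}           (_ ∷ ps) g = trans (cong (g 1 *_) (prodOver-strip ps g)) (sym (*-assoc (g 1) _ _))
prodOver-strip {suc (suc a) ∷ w} (_ ∷ ps) g = trans (cong (g (2 + a) *_) (prodOver-strip ps g)) (*-rotate (g (2 + a)) (g 1 ^ ones w) _)

occ-ones : ∀ {w} → All (1 ≤_) w → occ 1 w ≡ ones w
occ-ones {[]}              []       = refl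
occ-ones {1 ∷ w}           (_ ∷ ps) = cong suc (occ-ones ps)
occ-ones {suc (suc a) ∷ w} (_ ∷ ps) = occ-ones ps

occ-strip : ∀ {w} → All (1 ≤_) w → ∀ a → occ (2 + a) w ≡ occ (1 + a) (strip w)
occ-strip {[]}              []       a = refl
occ-strip {1 ∷ w}           (_ ∷ ps) a = occ-strip ps a
occ-strip {suc (suc b) ∷ w} (_ ∷ ps) a = cong₂ _+_
  (indicator-⇔ (2 + b ≟ 2 + a) (1 + b ≟ 1 + a) suc-injective (cong suc)) (occ-strip ps a)

-- The number of parent choices for vertices with levels w ∈ {1,…,b}* below s vertices of level 0.
hang : ℕ → ℕ → Word → ℕ
hang zero    s w = 1
hang (suc b) s w = s ^ ones w * hang b (ones w) (strip w)

strip-bounded : ∀ b {w} → All (_≤ suc b) w → All (_≤ b) (strip w)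
strip-bounded b {[]}              []       = []
strip-bounded b {zero ∷ w}        (_ ∷ ps) = strip-bounded b ps
strip-bounded b {suc zero ∷ w}    (_ ∷ ps) = strip-bounded b ps
strip-bounded b {suc (suc a) ∷ w} (p ∷ ps) = s≤s⁻¹ p ∷ strip-bounded b ps

-- The value of g on every level but the first is the size of the preceding level. The value `g 1`,
-- the number of vertices of level 0, stays free so that one level can be stripped at a time.
prodOver-hang : ∀ b w (g : ℕ → ℕ) → All (1 ≤_) w → All (_≤ b) w → (∀ a → g (2 + a) ≡ occ (1 + a) w) → prodOver w g ≡ hang b (g 1) w
prodOver-hang zero    []      g pos       bd       e = refl
prodOver-hang zero    (a ∷ w) g (p ∷ _)   (q ∷ _)  e = ⊥-elim (<⇒≱ p q)
prodOver-hang (suc b) w       g pos       bd       e = trans (prodOver-strip pos g) (cong (g 1 ^ ones w *_)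
  (trans (prodOver-hang b (strip w) (g ∘ suc) (strip-positive w) (strip-bounded b bd) (λ a → trans (e (suc a)) (occ-strip pos a)))
    (cong (λ s → hang b s (strip w)) (trans (e 0) (occ-ones pos)))))

-- Nothing can hang below an empty level: 0^i kills every term with i > 0, and i = 0 only passes on
-- to the next level.
sum-hang-0 : ∀ b q → sumOver (tuples (labels b) (suc q)) (hang b 0) ≡ 0
sum-hang-0 zero    q = trans (sumOver-tuples [] q (hang 0 0)) (sumOver-zero (tuples [] q))
sum-hang-0 (suc b) q = trans (sum-words-by-ones b (suc q) (λ i w → 0 ^ i * hang b i w))
  (trans (binom-cong-local (suc q) {g = λ _ _ → 0} vanish) (binom-zero (suc q)))
  where
  vanish : ∀ i j → i + j ≡ suc q → sumOver (tuples (labels b) j) (λ w → 0 ^ i * hang b i w) ≡ 0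
  vanish (suc i) j e    = sumOver-zero (tuples (labels b) j)
  vanish zero    j refl = trans (sumOver-cong (tuples (labels b) (suc q)) (λ w → +-identityʳ _)) (sum-hang-0 b q)

-- Every nonempty level uses up a vertex, so b ≥ q levels suffice; the terms in which vertices
-- follow an empty level contribute 0.
sum-hang : ∀ b q → q ≤ b → ∀ s → sumOver (tuples (labels b) q) (hang b s) ≡ forests s q
sum-hang zero    zero    _   s = refl
sum-hang (suc b) q       q≤b s = trans (sum-words-by-ones b q (λ i w → s ^ i * hang b i w))
  (trans (binom-cong-local q (λ i j e → trans (sumOver-*ˡ (tuples (labels b) j) (s ^ i) (hang b i)) (cong (s ^ i *_) (below i j e)))) (forests-layer q s))
  where
  below : ∀ i j → i + j ≡ q → sumOver (tuples (labels b) j) (hang b i) ≡ forests i j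
  below zero    zero    e    = empty b
    where
    empty : ∀ b → hang b 0 [] + 0 ≡ 1
    empty zero    = refl
    empty (suc b) = trans (cong (_+ 0) (+-identityʳ (hang b 0 []))) (empty b)
  below zero    (suc j) e    = sum-hang-0 b j
  below (suc i) j       refl = sum-hang b j (≤-trans (m≤n+m j i) (s≤s⁻¹ q≤b)) (suc i)

-- Levels are counted from the vertices of tag 1, which have level 0 and are left out together with
-- the chain.
levelsOf : List ℕ → Word
levelsOf []                = []
levelsOf (suc (suc t) ∷ l) = suc t ∷ levelsOf l
levelsOf (_ ∷ l)           = levelsOf l

-- The contribution of the vertices of tag 1 when the labels are read in increasing order; k chain
-- vertices have already been passed.
rootChoices : ℕ → List ℕ → ℕ
rootChoices k []          = 1
rootChoices k (0 ∷ l)     = rootChoices (suc k) l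
rootChoices k (1 ∷ l)     = k * rootChoices k l
rootChoices k (suc (suc _) ∷ l) = rootChoices k l

-- The parent of a chain vertex is forced; a vertex of tag 1 chooses among the `z v` smaller chain
-- vertices, a deeper one among all vertices of the preceding tag.
parentChoices : (ℕ → ℕ) → (ℕ → ℕ) → ℕ → ℕ → ℕ
parentChoices z g v 0             = 1
parentChoices z g v 1             = z v
parentChoices z g v (suc (suc t)) = g (suc t)

prodAt-parentChoices : ∀ l k (z g : ℕ → ℕ) → (∀ v → z (suc v) ≡ k + zerosBefore l (suc v)) →
  prodAt (parentChoices z g) l ≡ rootChoices k l * prodOver (levelsOf l) g
prodAt-parentChoices []      k z g e = refl
prodAt-parentChoices (0 ∷ l) k z g e = trans (+-identityʳ _) (trans
  (prodAt-cong (λ { v 0 → refl ; v 1 → refl ; v (suc (suc t)) → refl }) l)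
  (prodAt-parentChoices l (suc k) (z ∘ suc) g (λ v → trans (e (suc v)) (+-suc k _))))
prodAt-parentChoices (1 ∷ l) k z g e = trans (cong₂ _*_ (trans (e 0) (+-identityʳ k)) (trans
  (prodAt-cong (λ { v 0 → refl ; v 1 → refl ; v (suc (suc t)) → refl }) l)
  (prodAt-parentChoices l k (z ∘ suc) g (λ v → e (suc v))))) (sym (*-assoc k _ _))
prodAt-parentChoices (suc (suc t) ∷ l) k z g e = trans (cong (g (suc t) *_) (trans
  (prodAt-cong (λ { v 0 → refl ; v 1 → refl ; v (suc (suc t)) → refl }) l)
  (prodAt-parentChoices l k (z ∘ suc) g (λ v → e (suc v))))) (*-rotate (g (suc t)) (rootChoices k l) _)

tags : ℕ → List ℕ
tags b = 0 ∷ 1 ∷ map suc (labels b)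

-- The recursion of `rooted` with an arbitrary last stage g, applied to the number of children that
-- the k roots and the later ones have received.
process : ℕ → ℕ → (ℕ → ℕ) → ℕ
process zero    k g = g 0
process (suc m) k g = process m (suc k) g + k * process m k (g ∘ suc)

process-cong : ∀ m k {g h : ℕ → ℕ} → (∀ j → g j ≡ h j) → process m k g ≡ process m k h
process-cong zero    k e = e 0
process-cong (suc m) k e = cong₂ (λ x y → x + k * y) (process-cong m (suc k) e) (process-cong m k (e ∘ suc))

process-forests : ∀ m k j o → process m k (λ i → forests (j + i) o) ≡ rooted m k j o
process-forests zero    k j o = cong (λ x → forests x o) (+-identityʳ j)
process-forests (suc m) k j o = cong₂ (λ x y → x + k * y) (process-forests m (suc k) j o)
  (trans (process-cong m k (λ i → cong (λ x → forests x o) (+-suc j i))) (process-forests m k (suc j) o))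

-- The positions with tags above 1 form the part of size o. On the other m positions the tags 0 and
-- 1, read in increasing order of the labels, reproduce `process`: a 0 raises k and a 1 contributes
-- the factor k.
sum-tags : ∀ b n k (f : ℕ → Word → ℕ) →
  sumOver (tuples (tags b) n) (λ l → rootChoices k l * f (occ 1 l) (levelsOf l)) ≡
  binom n (λ m o → process m k (λ i → sumOver (tuples (labels b) o) (f i)))
sum-tags b zero    k f = trans (+-identityʳ _) (trans (+-identityʳ _) (sym (+-identityʳ _)))
sum-tags b (suc n) k f = begin
  sumOver (tuples (tags b) (suc n)) h
    ≡⟨ sumOver-tuples (tags b) n h ⟩
  sumOver W (λ l → h (0 ∷ l) + (h (1 ∷ l) + sumOver (map suc (labels b)) (λ x → h (x ∷ l))))
    ≡⟨ trans (sumOver-+ W _ _) (cong (sumOver W (λ l → h (0 ∷ l)) +_) (sumOver-+ W _ _)) ⟩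
  sumOver W (λ l → h (0 ∷ l)) + (sumOver W (λ l → h (1 ∷ l)) + sumOver W (λ l → sumOver (map suc (labels b)) (λ x → h (x ∷ l))))
    ≡⟨ cong₂ _+_ (sum-tags b n (suc k) f) (cong₂ _+_ ones′ levels) ⟩
  binom n (λ m o → process m (suc k) (F o)) + (binom n (λ m o → k * process m k (F o ∘ suc)) + binom n (λ m o → process m k (F (suc o))))
    ≡⟨ trans (sym (+-assoc (binom n (λ m o → process m (suc k) (F o))) _ _))
         (cong (_+ binom n (λ m o → process m k (F (suc o)))) (sym (binom-+ n _ _))) ⟩
  binom (suc n) (λ m o → process m k (F o)) ∎
  where
  open ≡-Reasoning
  W : List (List ℕ)
  W = tuples (tags b) n
  F : ℕ → ℕ → ℕ
  F o i = sumOver (tuples (labels b) o) (f i)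
  h : List ℕ → ℕ
  h l = rootChoices k l * f (occ 1 l) (levelsOf l)
  ones′ : sumOver W (λ l → h (1 ∷ l)) ≡ binom n (λ m o → k * process m k (F o ∘ suc))
  ones′ = trans (sumOver-cong W (λ l → *-assoc k (rootChoices k l) _)) (trans (sumOver-*ˡ W k _)
    (trans (cong (k *_) (sum-tags b n k (λ i → f (suc i)))) (sym (binom-*ˡ n k _))))
  levels : sumOver W (λ l → sumOver (map suc (labels b)) (λ x → h (x ∷ l))) ≡ binom n (λ m o → process m k (F (suc o)))
  levels = trans (sumOver-cong W (λ l → trans (sumOver-map suc (labels b) _) (trans (sumOver-map suc (upTo b) _)
    (trans (sym (sumOver-map suc (upTo b) _)) (sumOver-*ˡ (labels b) (rootChoices k l) (λ x → f (occ 1 l) (x ∷ levelsOf l)))))))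
    (trans (sum-tags b n k (λ i w → sumOver (labels b) (λ x → f i (x ∷ w))))
    (binom-cong n (λ m o → process-cong m k (λ i → sym (sumOver-tuples (labels b) o (f i))))))

sum-tags-hang : ∀ n → sumOver (tuples (tags n) n) (λ l → rootChoices 0 l * hang n (occ 1 l) (levelsOf l)) ≡ chains n
sum-tags-hang n = trans (sum-tags n n 0 (hang n)) (binom-cong-local n (λ m o e →
  trans (process-cong m 0 (λ i → sum-hang n o (subst (o ≤_) e (m≤n+m o m)) i)) (process-forests m 0 0 o)))

-- Parent maps

module _ {a} {A : Set a} where

  sumOver-mono : ∀ (xs : List A) {f g : A → ℕ} → (∀ x → f x ≤ g x) → sumOver xs f ≤ sumOver xs g
  sumOver-mono []       le = z≤n
  sumOver-mono (x ∷ xs) le = +-mono-≤ (le x) (sumOver-mono xs le)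

  sumOver-mono-< : ∀ {xs : List A} {x} {f g : A → ℕ} → (∀ x → f x ≤ g x) → x ∈ xs → f x < g x → sumOver xs f < sumOver xs g
  sumOver-mono-< {x ∷ xs} le (here refl) lt = +-mono-<-≤ lt (sumOver-mono xs le)
  sumOver-mono-< {x ∷ xs} le (there x∈)  lt = +-mono-≤-< (le x) (sumOver-mono-< le x∈ lt)

  sumOver-indicator-≤ : ∀ {p} {P : Pred A p} (P? : Decidable P) xs → sumOver xs (λ x → indicator (P? x)) ≤ length xs
  sumOver-indicator-≤ P? []       = z≤n
  sumOver-indicator-≤ P? (x ∷ xs) = +-mono-≤ (bound (P? x)) (sumOver-indicator-≤ P? xs)
    where
    bound : ∀ {p} {P : Set p} (d : Dec P) → indicator d ≤ 1
    bound (yes _) = s≤s z≤n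
    bound (no _)  = z≤n

indicator-≤ : ∀ {p q} {P : Set p} {Q : Set q} (P? : Dec P) (Q? : Dec Q) → (P → Q) → indicator P? ≤ indicator Q?
indicator-≤ (no _)  _       f = z≤n
indicator-≤ (yes _) (yes _) f = ≤-refl
indicator-≤ (yes p) (no ¬q) f = ⊥-elim (¬q (f p))

indicator-yes : ∀ {p} {P : Set p} (P? : Dec P) → P → indicator P? ≡ 1
indicator-yes (yes _) p = refl
indicator-yes (no ¬p) p = ⊥-elim (¬p p)

indicator-no : ∀ {p} {P : Set p} (P? : Dec P) → ¬ P → indicator P? ≡ 0
indicator-no (yes p) ¬p = ⊥-elim (¬p p)
indicator-no (no _)  ¬p = refl

length-labels : ∀ n → length (labels n) ≡ n
length-labels n = trans (length-map suc (upTo n)) (length-upTo n)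

∈-labels : ∀ {n v} → 1 ≤ v → v ≤ n → v ∈ labels n
∈-labels {n} {suc v} _ v<n = ∈-map⁺ suc (∈-upTo⁺ v<n)

sum-labels-pick : ∀ n v → 1 ≤ v → v ≤ n → sumOver (labels n) (λ u → indicator (u ≟ v)) ≡ 1
sum-labels-pick (suc n) 1             _ _         = trans (sum-labels-suc n (λ u → indicator (u ≟ 1)))
  (cong suc (trans (sum-labels-cong n {g = λ _ → 0} (λ { (suc u) _ _ → refl })) (sumOver-zero (labels n))))
sum-labels-pick (suc n) (suc (suc v)) _ (s≤s v≤n) = trans (sum-labels-suc n (λ u → indicator (u ≟ suc (suc v))))
  (trans (sum-labels-cong n (λ u _ _ → indicator-⇔ (suc u ≟ suc (suc v)) (u ≟ suc v) suc-injective (cong suc)))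
    (sum-labels-pick n (suc v) (s≤s z≤n) v≤n))

T-foldr⁺ : ∀ {A : Set} (f : A → Bool) {xs} → All (T ∘ f) xs → T (foldr (λ x b → f x ∧ b) true xs)
T-foldr⁺ f []       = tt
T-foldr⁺ f (p ∷ ps) = T-∧⁺ p (T-foldr⁺ f ps)

T-foldr⁻ : ∀ {A : Set} (f : A → Bool) xs → T (foldr (λ x b → f x ∧ b) true xs) → All (T ∘ f) xs
T-foldr⁻ f []       _ = []
T-foldr⁻ f (x ∷ xs) p = proj₁ (T-∧⁻ {f x} p) ∷ T-foldr⁻ f xs (proj₂ (T-∧⁻ {f x} p))

T-not⁺ : ∀ {b} → ¬ T b → T (not b)
T-not⁺ {false} _ = tt
T-not⁺ {true}  p = p tt

T-not⁻ : ∀ {b} → T (not b) → ¬ T b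
T-not⁻ {false} _ ()

countB-one⁺ : ∀ n (f : ℕ → Bool) r → 1 ≤ r → r ≤ n → T (f r) → (∀ v → 1 ≤ v → v ≤ n → T (f v) → v ≡ r) → countB f (labels n) ≡ 1
countB-one⁺ n f r 1≤r r≤n fr only = trans (length-filter-sum (λ x → f x Bool.≟ true) (labels n))
  (trans (sum-labels-cong n (λ v 1≤v v≤n → indicator-⇔ (f v Bool.≟ true) (v ≟ r)
    (λ e → only v 1≤v v≤n (Equivalence.from T-≡ e)) (λ { refl → Equivalence.to T-≡ fr })))
  (sum-labels-pick n r 1≤r r≤n))

countB-one⁻ : ∀ n (f : ℕ → Bool) → countB f (labels n) ≡ 1 →
  ∀ u v → 1 ≤ u → u ≤ n → 1 ≤ v → v ≤ n → T (f u) → T (f v) → u ≡ v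
countB-one⁻ n f e u v 1≤u u≤n 1≤v v≤n fu fv with u ≟ v
... | yes u≡v = u≡v
... | no  u≢v = ⊥-elim (1+n≰n (begin
  2
    ≡⟨ cong₂ _+_ (sum-labels-pick n u 1≤u u≤n) (sum-labels-pick n v 1≤v v≤n) ⟨
  sumOver (labels n) (λ w → indicator (w ≟ u)) + sumOver (labels n) (λ w → indicator (w ≟ v))
    ≡⟨ sumOver-+ (labels n) _ _ ⟨
  sumOver (labels n) (λ w → indicator (w ≟ u) + indicator (w ≟ v))
    ≤⟨ sumOver-mono (labels n) bound ⟩
  sumOver (labels n) (λ w → indicator (f w Bool.≟ true))
    ≡⟨ length-filter-sum (λ x → f x Bool.≟ true) (labels n) ⟨
  countB f (labels n)
    ≡⟨ e ⟩
  1 ∎))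
  where
  open ≤-Reasoning
  bound : ∀ w → indicator (w ≟ u) + indicator (w ≟ v) ≤ indicator (f w Bool.≟ true)
  bound w with w ≟ u
  ... | yes refl = ≤-reflexive (trans (cong suc (indicator-no (u ≟ v) u≢v))
                     (sym (indicator-yes (f u Bool.≟ true) (Equivalence.to T-≡ fu))))
  ... | no _     = indicator-≤ (w ≟ v) (f w Bool.≟ true) (λ { refl → Equivalence.to T-≡ fv })

-- The sibling test is local to `decSubIsChain`; unification recovers it as the first component,
-- which gives it a name.
decSubIsChain-unfold : ∀ n par → Σ (ℕ → ℕ → Bool) λ s → decSubIsChain n par ≡
  foldr (λ u b → foldr (λ v b′ → not (s u v) ∧ b′) true (labels n) ∧ b) true (labels n)
decSubIsChain-unfold n par = _ , refl

module _ (n : ℕ) (par : List (Maybe ℕ)) where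

  parent : ℕ → Maybe ℕ
  parent = parentOf par

  siblings : ℕ → ℕ → Bool
  siblings = proj₁ (decSubIsChain-unfold n par)

  siblings⇒ : ∀ u v → T (siblings u v) → Σ ℕ λ a → parent u ≡ just a × parent v ≡ just a × u ≢ v × T (inDecSub par n u) × T (inDecSub par n v)
  siblings⇒ u v s with parentOf par u | parentOf par v
  ... | just p | just q = p , refl , cong just (sym (≡ᵇ⇒≡ p q (proj₁ s₂))) , (λ { refl → T-not⁻ (proj₁ s₁) (≡⇒≡ᵇ u u refl) }) , T-∧⁻ (proj₂ s₂)
    where
    s₁ : T (not (u ≡ᵇ v)) × T ((p ≡ᵇ q) ∧ inDecSub par n u ∧ inDecSub par n v)
    s₁ = T-∧⁻ s
    s₂ : T (p ≡ᵇ q) × T (inDecSub par n u ∧ inDecSub par n v)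
    s₂ = T-∧⁻ (proj₂ s₁)

  ⇒siblings : ∀ {u v a} → parent u ≡ just a → parent v ≡ just a → u ≢ v → T (inDecSub par n u) → T (inDecSub par n v) → T (siblings u v)
  ⇒siblings {u} {v} {a} pu pv u≢v Ku Kv with parentOf par u | parentOf par v
  ⇒siblings {u} {v} {a} refl refl u≢v Ku Kv | just _ | just _ =
    T-∧⁺ (T-not⁺ (λ e → u≢v (≡ᵇ⇒≡ u v e))) (T-∧⁺ (≡⇒≡ᵇ a a refl) (T-∧⁺ Ku Kv))

  isRootB-nothing : ∀ {v} → parent v ≡ nothing → T (isRootB par v)
  isRootB-nothing {v} e with parentOf par v
  ... | nothing = tt

  isRootB⇒nothing : ∀ {v} → T (isRootB par v) → parent v ≡ nothing
  isRootB⇒nothing {v} p with parentOf par v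
  ... | nothing = refl

  reaches-nothing : ∀ fl {v} → parent v ≡ nothing → T (reachesRoot par fl v)
  reaches-nothing zero     e = isRootB-nothing e
  reaches-nothing (suc fl) {v} e with parentOf par v
  ... | nothing = tt

  reaches-just⁺ : ∀ fl {v u} → parent v ≡ just u → T (reachesRoot par fl u) → T (reachesRoot par (suc fl) v)
  reaches-just⁺ fl {v} e p with parentOf par v
  reaches-just⁺ fl {v} refl p | just _ = p

  reaches-just⁻ : ∀ fl {v u} → parent v ≡ just u → T (reachesRoot par (suc fl) v) → T (reachesRoot par fl u)
  reaches-just⁻ fl {v} e p with parentOf par v
  reaches-just⁻ fl {v} refl p | just _ = p

  inDecSub-nothing : ∀ fl {v} → parent v ≡ nothing → T (inDecSub par fl v)
  inDecSub-nothing zero     e = isRootB-nothing e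
  inDecSub-nothing (suc fl) {v} e with parentOf par v
  ... | nothing = tt

  inDecSub-just⁺ : ∀ fl {v u} → parent v ≡ just u → v < u → T (inDecSub par fl u) → T (inDecSub par (suc fl) v)
  inDecSub-just⁺ fl {v} e lt p with parentOf par v
  inDecSub-just⁺ fl {v} refl lt p | just u = T-∧⁺ (<⇒<ᵇ lt) p

  inDecSub-just⁻ : ∀ fl {v u} → parent v ≡ just u → T (inDecSub par (suc fl) v) → v < u × T (inDecSub par fl u)
  inDecSub-just⁻ fl {v} e p with parentOf par v
  inDecSub-just⁻ fl {v} refl p | just u = <ᵇ⇒< v u (proj₁ (T-∧⁻ {v <ᵇ u} p)) , proj₂ (T-∧⁻ {v <ᵇ u} p)

  levelStep : Bool → Maybe ℕ → (ℕ → ℕ) → ℕ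
  levelStep true  _        f = 0
  levelStep false nothing  f = 0
  levelStep false (just u) f = suc (f u)

  -- The distance of v to the maximal decreasing subtree.
  level : ℕ → ℕ → ℕ
  level zero     v = 0
  level (suc fl) v = levelStep (inDecSub par n v) (parent v) (level fl)

  level-≤ : ∀ fl v → level fl v ≤ fl
  level-≤ zero     v = z≤n
  level-≤ (suc fl) v with inDecSub par n v | parent v
  ... | true  | _       = z≤n
  ... | false | nothing = z≤n
  ... | false | just u  = s≤s (level-≤ fl u)

  level-chain : ∀ fl {v} → T (inDecSub par n v) → level fl v ≡ 0
  level-chain zero     p = refl
  level-chain (suc fl) {v} p with inDecSub par n v
  ... | true = refl

  level-step : ∀ fl {v u} → ¬ T (inDecSub par n v) → parent v ≡ just u → level (suc fl) v ≡ suc (level fl u)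
  level-step fl {v} ¬p e with inDecSub par n v
  ... | true  = ⊥-elim (¬p tt)
  ... | false rewrite e = refl

  -- Fuel that suffices to reach the root suffices for the level as well, because the root lies in
  -- the decreasing subtree, where the level is 0 for any fuel.
  level-stable : ∀ fl {v} → T (reachesRoot par fl v) → level fl v ≡ level (suc fl) v
  level-stable zero     {v} r = sym (level-chain 1 {v} (inDecSub-nothing n (isRootB⇒nothing r)))
  level-stable (suc fl) {v} r = go (T? (inDecSub par n v)) (parent v) refl
    where
    go : Dec (T (inDecSub par n v)) → ∀ x → parent v ≡ x → level (suc fl) v ≡ level (suc (suc fl)) v
    go (yes p) _        e = trans (level-chain (suc fl) p) (sym (level-chain (suc (suc fl)) p))
    go (no ¬p) nothing  e = ⊥-elim (¬p (inDecSub-nothing n e))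
    go (no ¬p) (just u) e = trans (level-step fl ¬p e) (trans (cong suc (level-stable fl (reaches-just⁻ fl e r))) (sym (level-step (suc fl) ¬p e)))

-- Taggings that fit a parent map

nextZero : (ℕ → ℕ) → ℕ → ℕ → Maybe ℕ
nextZero t zero     v = nothing
nextZero t (suc fl) v with t (suc v) ≟ 0
... | yes _ = just (suc v)
... | no  _ = nextZero t fl (suc v)

nextZero-just : ∀ t fl v {u} → nextZero t fl v ≡ just u → v < u × u ≤ v + fl × t u ≡ 0 × (∀ w → v < w → w < u → t w ≢ 0)
nextZero-just t (suc fl) v e with t (suc v) ≟ 0
nextZero-just t (suc fl) v refl | yes z = ≤-refl , ≤-trans (s≤s (m≤m+n v fl)) (≤-reflexive (sym (+-suc v fl))) , z , λ w v<w w<u → ⊥-elim (<⇒≱ w<u v<w)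
... | no ¬z with nextZero-just t fl (suc v) e
...   | v<u , u≤ , z , none = <⇒≤ v<u , ≤-trans u≤ (≤-reflexive (sym (+-suc v fl))) , z , between
  where
  between : ∀ w → v < w → w < _ → t w ≢ 0
  between w v<w w<u with suc v ≟ w
  ... | yes refl = ¬z
  ... | no  v≢w  = none w (≤∧≢⇒< v<w v≢w) w<u

nextZero-nothing : ∀ t fl v → nextZero t fl v ≡ nothing → ∀ w → v < w → w ≤ v + fl → t w ≢ 0
nextZero-nothing t zero     v e w v<w w≤ = ⊥-elim (<⇒≱ v<w (≤-trans w≤ (≤-reflexive (+-identityʳ v))))
nextZero-nothing t (suc fl) v e w v<w w≤ with t (suc v) ≟ 0
... | no ¬z with suc v ≟ w
...   | yes refl = ¬z
...   | no v≢w   = nextZero-nothing t fl (suc v) e w (≤∧≢⇒< v<w v≢w) (≤-trans w≤ (≤-reflexive (+-suc v fl)))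

-- Tag 0 marks the chain, tag t + 1 the vertices at distance t + 1 below it. A chain vertex
-- hangs below the next larger one, a vertex with tag 1 below a smaller chain vertex.
Fits : (ℕ → ℕ) → ℕ → ℕ → ℕ → Maybe ℕ → Set
Fits t n v zero          x        = x ≡ nextZero t (n ∸ v) v
Fits t n v (suc zero)    nothing  = ⊥
Fits t n v (suc zero)    (just u) = u < v × t u ≡ 0
Fits t n v (suc (suc s)) nothing  = ⊥
Fits t n v (suc (suc s)) (just u) = t u ≡ suc s

fits? : ∀ t n v s x → Dec (Fits t n v s x)
fits? t n v zero          x        = MaybeP.≡-dec _≟_ x (nextZero t (n ∸ v) v)
fits? t n v (suc zero)    nothing  = no id
fits? t n v (suc zero)    (just u) = (u <? v) ×-dec (t u ≟ 0)
fits? t n v (suc (suc s)) nothing  = no id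
fits? t n v (suc (suc s)) (just u) = t u ≟ suc s

AllFit : (ℕ → ℕ) → ℕ → List (Maybe ℕ) → Set
AllFit t n par = ∀ v → 1 ≤ v → v ≤ n → Fits t n v (t v) (parentOf par v)

BoundedParents : ℕ → List (Maybe ℕ) → Set
BoundedParents n par = ∀ v u → parentOf par v ≡ just u → 1 ≤ u × u ≤ n

data ParentView (t : ℕ → ℕ) (n v : ℕ) : Maybe ℕ → Set where
  top   : t v ≡ 0 → (∀ w → v < w → w ≤ n → t w ≢ 0) → ParentView t n v nothing
  chain : ∀ {u} → t v ≡ 0 → t u ≡ 0 → v < u → (∀ w → v < w → w < u → t w ≢ 0) → ParentView t n v (just u)
  child : ∀ {u} → t v ≡ 1 → t u ≡ 0 → u < v → ParentView t n v (just u)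
  other : ∀ {u s} → t v ≡ suc (suc s) → t u ≡ suc s → ParentView t n v (just u)

parentView : ∀ t n v {s x} → t v ≡ s → v ≤ n → Fits t n v s x → ParentView t n v x
parentView t n v {zero}        {x}      e v≤n f with x
... | just u  = let v<u , _ , z , none = nextZero-just t (n ∸ v) v (sym f) in chain e z v<u none
... | nothing = top e (λ w v<w w≤n → nextZero-nothing t (n ∸ v) v (sym f) w v<w (subst (w ≤_) (sym (m+[n∸m]≡n v≤n)) w≤n))
parentView t n v {suc zero}    {just u} e v≤n (lt , z) = child e z lt
parentView t n v {suc (suc s)} {just u} e v≤n f = other e f

module FitTree (n : ℕ) (par : List (Maybe ℕ)) (bounded : BoundedParents n par) (t : ℕ → ℕ) (allFit : AllFit t n par) where

  view : ∀ v → 1 ≤ v → v ≤ n → ∀ x → parentOf par v ≡ x → ParentView t n v x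
  view v 1≤v v≤n x e = subst (ParentView t n v) e (parentView t n v refl v≤n (allFit v 1≤v v≤n))

  -- A quantity that drops from a vertex to its parent: on the chain the labels grow towards the
  -- root, and off the chain the tags decrease. The summand n puts every vertex off the chain above
  -- all chain vertices.
  key : ℕ → ℕ
  key v with t v
  ... | zero  = n ∸ v
  ... | suc s = suc s + n

  key-0 : ∀ {v} → t v ≡ 0 → key v ≡ n ∸ v
  key-0 {v} e with t v
  ... | zero = refl

  key-suc : ∀ {v s} → t v ≡ suc s → key v ≡ suc s + n
  key-suc {v} e with t v
  key-suc {v} refl | suc s = refl

  key-parent : ∀ v u → 1 ≤ v → v ≤ n → parentOf par v ≡ just u → key u < key v
  key-parent v u 1≤v v≤n e with view v 1≤v v≤n (just u) e
  ... | chain ev eu v<u _ = subst₂ _<_ (sym (key-0 eu)) (sym (key-0 ev)) (∸-monoʳ-< v<u (proj₂ (bounded v u e)))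
  ... | child ev eu _     = subst₂ _<_ (sym (key-0 eu)) (sym (key-suc ev)) (s≤s (m∸n≤m n u))
  ... | other ev eu       = subst₂ _<_ (sym (key-suc eu)) (sym (key-suc ev)) ≤-refl

  -- A key may exceed n, but its rank among the n keys does not; so the fuel n in `isTree` is enough
  -- to reach the root.
  rank : ℕ → ℕ
  rank v = sumOver (labels n) (λ u → indicator (key u <? key v))

  rank-parent : ∀ v u → 1 ≤ v → v ≤ n → parentOf par v ≡ just u → rank u < rank v
  rank-parent v u 1≤v v≤n e = sumOver-mono-< (λ w → indicator-≤ (key w <? key u) (key w <? key v) (λ p → <-trans p lt))
    (∈-labels (proj₁ (bounded v u e)) (proj₂ (bounded v u e)))
    (subst₂ _<_ (sym (indicator-no (key u <? key u) (<-irrefl refl))) (sym (indicator-yes (key u <? key v) lt)) ≤-refl)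
    where
    lt : key u < key v
    lt = key-parent v u 1≤v v≤n e

  reaches : ∀ fl v → 1 ≤ v → v ≤ n → rank v ≤ fl → T (reachesRoot par fl v)
  reaches fl v 1≤v v≤n r with parentOf par v in e
  ... | nothing = reaches-nothing n par fl e
  reaches zero     v 1≤v v≤n r | just u = ⊥-elim (<⇒≱ (rank-parent v u 1≤v v≤n e) (≤-trans r z≤n))
  reaches (suc fl) v 1≤v v≤n r | just u = reaches-just⁺ n par fl e
    (reaches fl u (proj₁ (bounded v u e)) (proj₂ (bounded v u e)) (s≤s⁻¹ (≤-trans (rank-parent v u 1≤v v≤n e) r)))

  reachesRoot-n : ∀ v → 1 ≤ v → v ≤ n → T (reachesRoot par n v)
  reachesRoot-n v 1≤v v≤n = reaches n v 1≤v v≤n (≤-trans (sumOver-indicator-≤ (λ u → key u <? key v) (labels n)) (≤-reflexive (length-labels n)))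

  findRoot : ∀ fl v → 1 ≤ v → v ≤ n → T (reachesRoot par fl v) → Σ ℕ λ r → 1 ≤ r × r ≤ n × parentOf par r ≡ nothing
  findRoot zero     v 1≤v v≤n p = v , 1≤v , v≤n , isRootB⇒nothing n par p
  findRoot (suc fl) v 1≤v v≤n p with parentOf par v in e
  ... | nothing = v , 1≤v , v≤n , e
  ... | just u  = findRoot fl u (proj₁ (bounded v u e)) (proj₂ (bounded v u e)) p

  rootUnique : ∀ u v → 1 ≤ u → u ≤ n → 1 ≤ v → v ≤ n → parentOf par u ≡ nothing → parentOf par v ≡ nothing → u ≡ v
  rootUnique u v 1≤u u≤n 1≤v v≤n pu pv with view u 1≤u u≤n nothing pu | view v 1≤v v≤n nothing pv
  ... | top eu nu | top ev nv with <-cmp u v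
  ...   | tri< u<v _ _ = ⊥-elim (nu v u<v v≤n ev)
  ...   | tri≈ _ e _   = e
  ...   | tri> _ _ v<u = ⊥-elim (nv u v<u u≤n eu)

  tree : 1 ≤ n → T (isTree n par)
  tree 1≤n with findRoot n 1 ≤-refl 1≤n (reachesRoot-n 1 ≤-refl 1≤n)
  ... | r , 1≤r , r≤n , e = T-∧⁺
    (≡⇒≡ᵇ (countB (isRootB par) (labels n)) 1 (countB-one⁺ n (isRootB par) r 1≤r r≤n (isRootB-nothing n par e)
      (λ v 1≤v v≤n p → rootUnique v r 1≤v v≤n 1≤r r≤n (isRootB⇒nothing n par p) e)))
    (T-foldr⁺ (reachesRoot par n) (All-labels n reachesRoot-n))

  chain⇒dec : ∀ fl v → 1 ≤ v → v ≤ n → t v ≡ 0 → n ∸ v ≤ fl → T (inDecSub par fl v)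
  chain⇒dec fl v 1≤v v≤n z le with parentOf par v in e
  ... | nothing = inDecSub-nothing n par fl e
  ... | just u with view v 1≤v v≤n (just u) e
  ...   | child ev _ _ = ⊥-elim (0≢1+n (trans (sym z) ev))
  ...   | other ev _   = ⊥-elim (0≢1+n (trans (sym z) ev))
  chain⇒dec zero     v 1≤v v≤n z le | just u | chain _ eu v<u _ = ⊥-elim (<⇒≱ v<u (≤-trans (proj₂ (bounded v u e)) (m∸n≡0⇒m≤n (n≤0⇒n≡0 le))))
  chain⇒dec (suc fl) v 1≤v v≤n z le | just u | chain _ eu v<u _ = inDecSub-just⁺ n par fl e v<u
    (chain⇒dec fl u (proj₁ (bounded v u e)) (proj₂ (bounded v u e)) eu (s≤s⁻¹ (≤-trans (∸-monoʳ-< v<u (proj₂ (bounded v u e))) le)))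

  -- A vertex of tag 1 hangs below a smaller one, so the decreasing path breaks there, and with it
  -- the path of every vertex further below.
  dec⇒chain : ∀ fl v → 1 ≤ v → v ≤ n → T (inDecSub par fl v) → t v ≡ 0
  dec⇒chain fl v 1≤v v≤n p with parentOf par v in e
  ... | nothing with view v 1≤v v≤n nothing e
  ...   | top ev _ = ev
  dec⇒chain zero v 1≤v v≤n p | just u = ⊥-elim (absurd (trans (sym e) (isRootB⇒nothing n par p)))
    where
    absurd : just u ≢ nothing
    absurd ()
  dec⇒chain (suc fl) v 1≤v v≤n p | just u with view v 1≤v v≤n (just u) e
  ... | chain ev _ _ _  = ev
  ... | child _ _ u<v   = ⊥-elim (<-asym u<v (proj₁ (inDecSub-just⁻ n par fl e p)))
  ... | other {s = s} _ eu = ⊥-elim (0≢1+n (trans (sym (dec⇒chain fl u (proj₁ (bounded v u e)) (proj₂ (bounded v u e))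
                            (proj₂ (inDecSub-just⁻ n par fl e p)))) eu))

  -- Two siblings in the decreasing subtree have tag 0, and their common parent is the next larger
  -- vertex of tag 0 for both; but the larger sibling lies between the smaller one and the parent.
  isChain : T (decSubIsChain n par)
  isChain = T-foldr⁺ _ (All-labels n (λ u 1≤u u≤n → T-foldr⁺ _ (All-labels n (λ v 1≤v v≤n → T-not⁺ (λ s → notSiblings u v 1≤u u≤n 1≤v v≤n s)))))
    where
    notSiblings : ∀ u v → 1 ≤ u → u ≤ n → 1 ≤ v → v ≤ n → ¬ T (siblings n par u v)
    notSiblings u v 1≤u u≤n 1≤v v≤n s with siblings⇒ n par u v s
    ... | a , pu , pv , u≢v , Ku , Kv with view u 1≤u u≤n (just a) pu | view v 1≤v v≤n (just a) pv
        | dec⇒chain n u 1≤u u≤n Ku | dec⇒chain n v 1≤v v≤n Kv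
    ...   | chain _ _ u<a nu | chain _ _ v<a nv | zu | zv with <-cmp u v
    ...     | tri< u<v _ _ = nu v u<v v<a zv
    ...     | tri≈ _ e _   = u≢v e
    ...     | tri> _ _ v<u = nv u v<u u<a zu
    notSiblings u v 1≤u u≤n 1≤v v≤n s | a , pu , pv , u≢v , Ku , Kv | child eu _ _ | _ | zu | _ = 0≢1+n (trans (sym zu) eu)
    notSiblings u v 1≤u u≤n 1≤v v≤n s | a , pu , pv , u≢v , Ku , Kv | other eu _ | _ | zu | _ = 0≢1+n (trans (sym zu) eu)
    notSiblings u v 1≤u u≤n 1≤v v≤n s | a , pu , pv , u≢v , Ku , Kv | chain _ _ _ _ | child ev _ _ | _ | zv = 0≢1+n (trans (sym zv) ev)
    notSiblings u v 1≤u u≤n 1≤v v≤n s | a , pu , pv , u≢v , Ku , Kv | chain _ _ _ _ | other ev _ | _ | zv = 0≢1+n (trans (sym zv) ev)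

  -- This determines a fitting tagging from the parent map alone, so that no map is counted twice.
  tag-level : ∀ fl v → 1 ≤ v → v ≤ n → T (reachesRoot par fl v) → t v ≡ level n par fl v
  tag-level fl v 1≤v v≤n r with t v in e
  ... | zero  = sym (level-chain n par fl (chain⇒dec n v 1≤v v≤n e (m∸n≤m n v)))
  tag-level fl v 1≤v v≤n r | suc s with parentOf par v in pe
  tag-level fl v 1≤v v≤n r | suc s | nothing with view v 1≤v v≤n nothing pe
  ... | top ev _ = ⊥-elim (0≢1+n (trans (sym ev) e))
  tag-level zero v 1≤v v≤n r | suc s | just u = ⊥-elim (absurd (trans (sym pe) (isRootB⇒nothing n par r)))
    where
    absurd : just u ≢ nothing
    absurd ()
  tag-level (suc fl) v 1≤v v≤n r | suc s | just u = sym (trans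
    (level-step n par fl (λ p → 0≢1+n (trans (sym (dec⇒chain n v 1≤v v≤n p)) e)) pe)
    (cong suc (trans (sym (tag-level fl u (proj₁ (bounded v u pe)) (proj₂ (bounded v u pe)) (reaches-just⁻ n par fl pe r))) parentTag)))
    where
    parentTag : t u ≡ s
    parentTag with view v 1≤v v≤n (just u) pe
    ... | chain ev _ _ _ = ⊥-elim (0≢1+n (trans (sym ev) e))
    ... | child ev eu _  = trans eu (suc-injective (trans (sym ev) e))
    ... | other ev eu    = trans eu (suc-injective (trans (sym ev) e))

  tag≡level : ∀ v → 1 ≤ v → v ≤ n → t v ≡ level n par n v
  tag≡level v 1≤v v≤n = tag-level n v 1≤v v≤n (reachesRoot-n v 1≤v v≤n)

module ChainTree (m : ℕ) (par : List (Maybe ℕ)) (bounded : BoundedParents (suc m) par)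
  (isT : T (isTree (suc m) par)) (isC : T (decSubIsChain (suc m) par))
  (t : ℕ → ℕ) (t≡level : ∀ v → 1 ≤ v → v ≤ suc m → t v ≡ level (suc m) par (suc m) v) where

  private
    n : ℕ
    n = suc m

    K : ℕ → Set
    K v = 1 ≤ v × v ≤ n × T (inDecSub par n v)

  rootsEqual : ∀ u v → 1 ≤ u → u ≤ n → 1 ≤ v → v ≤ n → parentOf par u ≡ nothing → parentOf par v ≡ nothing → u ≡ v
  rootsEqual u v 1≤u u≤n 1≤v v≤n pu pv = countB-one⁻ n (isRootB par) (≡ᵇ⇒≡ _ 1 (proj₁ (T-∧⁻ {countB (isRootB par) (labels n) ≡ᵇ 1} isT)))
    u v 1≤u u≤n 1≤v v≤n (isRootB-nothing n par pu) (isRootB-nothing n par pv)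

  reach : ∀ v → 1 ≤ v → v ≤ n → T (reachesRoot par n v)
  reach = All-labels⁻ n (T-foldr⁻ (reachesRoot par n) (labels n) (proj₂ (T-∧⁻ {countB (isRootB par) (labels n) ≡ᵇ 1} isT)))

  noSiblings : ∀ {u v a} → K u → K v → parentOf par u ≡ just a → parentOf par v ≡ just a → u ≡ v
  noSiblings {u} {v} (1≤u , u≤n , Ku) (1≤v , v≤n , Kv) pu pv with u ≟ v
  ... | yes e   = e
  ... | no  u≢v = ⊥-elim (T-not⁻ (All-labels⁻ n (T-foldr⁻ _ (labels n) (All-labels⁻ n (T-foldr⁻ _ (labels n) isC) u 1≤u u≤n)) v 1≤v v≤n)
    (⇒siblings n par pu pv u≢v Ku Kv))

  -- The labels grow along a decreasing path towards the root, so such a path from v has at most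
  -- `n ∸ v` edges and any fuel of that size will do.
  dec-fuel : ∀ fl fl′ v → T (inDecSub par fl v) → n ∸ v ≤ fl′ → T (inDecSub par fl′ v)
  dec-fuel fl fl′ v p le with parentOf par v in e
  ... | nothing = inDecSub-nothing n par fl′ e
  dec-fuel zero     fl′       v p le | just u = ⊥-elim (absurd (trans (sym e) (isRootB⇒nothing n par p)))
    where
    absurd : just u ≢ nothing
    absurd ()
  dec-fuel (suc fl) zero      v p le | just u = ⊥-elim (<⇒≱ (proj₁ (inDecSub-just⁻ n par fl e p)) (≤-trans (proj₂ (bounded v u e)) (m∸n≡0⇒m≤n (n≤0⇒n≡0 le))))
  dec-fuel (suc fl) (suc fl′) v p le | just u = inDecSub-just⁺ n par fl′ e v<u (dec-fuel fl fl′ u (proj₂ (inDecSub-just⁻ n par fl e p))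
    (s≤s⁻¹ (≤-trans (∸-monoʳ-< v<u (proj₂ (bounded v u e))) le)))
    where
    v<u : v < u
    v<u = proj₁ (inDecSub-just⁻ n par fl e p)

  K-up : ∀ {v u} → K v → parentOf par v ≡ just u → v < u × K u
  K-up {v} {u} (_ , _ , Kv) e = let v<u , Ku = inDecSub-just⁻ n par m e Kv in
    v<u , proj₁ (bounded v u e) , proj₂ (bounded v u e) , dec-fuel m n u Ku (m∸n≤m n u)

  K-down : ∀ {v u} → K u → parentOf par v ≡ just u → v < u → T (inDecSub par n v)
  -- One step of fuel is spent on the edge to the parent. The remaining m is enough because the
  -- parent is a positive label.
  K-down {v} {suc u} (_ , _ , Ku) e v<u = inDecSub-just⁺ n par m e v<u (dec-fuel n m (suc u) Ku (m∸n≤m m u))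

  ∸-decreasing : ∀ {v u h} → v < u → u ≤ n → n ∸ v ≤ suc h → n ∸ u ≤ h
  ∸-decreasing v<u u≤n le = s≤s⁻¹ (≤-trans (∸-monoʳ-< v<u u≤n) le)

  exhausted : ∀ {v u} → v < u → u ≤ n → ¬ (n ∸ v ≤ 0)
  exhausted v<u u≤n le = <⇒≱ v<u (≤-trans u≤n (m∸n≡0⇒m≤n (n≤0⇒n≡0 le)))

  -- The path from a chain vertex to the root has growing labels; h bounds `n ∸ v`, which drops with
  -- every step.
  K-≤root : ∀ h {v r} → n ∸ v ≤ h → K v → 1 ≤ r → r ≤ n → parentOf par r ≡ nothing → v ≤ r
  K-≤root h {v} {r} le Kv 1≤r r≤n pr = go h le (parentOf par v) refl
    where
    go : ∀ h → n ∸ v ≤ h → ∀ x → parentOf par v ≡ x → v ≤ r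
    go h       le nothing  e = ≤-reflexive (rootsEqual v r (proj₁ Kv) (proj₁ (proj₂ Kv)) 1≤r r≤n e pr)
    go zero    le (just u) e with K-up Kv e
    ... | v<u , Ku = ⊥-elim (exhausted v<u (proj₁ (proj₂ Ku)) le)
    go (suc h) le (just u) e with K-up Kv e
    ... | v<u , Ku = ≤-trans (<⇒≤ v<u) (K-≤root h (∸-decreasing v<u (proj₁ (proj₂ Ku)) le) Ku 1≤r r≤n pr)

  -- The path from a smaller chain vertex to the root does not jump over u.
  ParentBelow : ℕ → Set
  ParentBelow u = ∀ {v} → K v → v < u → Σ ℕ λ a → parentOf par v ≡ just a × a ≤ u

  -- Climbing from w, the chain reaches q through a child w′ with u < w′, contradicting noSiblings.
  nothingBetween : ∀ h {u q w} → n ∸ w ≤ h → K u → parentOf par u ≡ just q → ParentBelow q → K w → u < w → w < q → ⊥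
  nothingBetween h {u} {q} {w} le Ku pu below Kw u<w w<q with below Kw w<q
  ... | a , pw , a≤q with a ≟ q | K-up Kw pw
  ...   | yes refl | _ = <-irrefl (noSiblings Ku Kw pu pw) u<w
  nothingBetween zero    le Ku pu below Kw u<w w<q | a , pw , a≤q | no a≢q | w<a , Ka = exhausted w<a (proj₁ (proj₂ Ka)) le
  nothingBetween (suc h) le Ku pu below Kw u<w w<q | a , pw , a≤q | no a≢q | w<a , Ka =
    nothingBetween h (∸-decreasing w<a (proj₁ (proj₂ Ka)) le) Ku pu below Ka (<-trans u<w w<a) (≤∧≢⇒< a≤q a≢q)

  -- Induction down from the root. If q is the parent of u, the parent a of v is at most q. In case
  -- a > u, either a = q and u, v are siblings, or a lies strictly between u and q, which
  -- `nothingBetween` excludes.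
  parentBelow : ∀ h {u} → n ∸ u ≤ h → K u → ParentBelow u
  parentBelow h {u} le Ku {v} Kv v<u = go h le (parentOf par u) refl
    where
    go : ∀ h → n ∸ u ≤ h → ∀ x → parentOf par u ≡ x → Σ ℕ λ a → parentOf par v ≡ just a × a ≤ u
    go h       le nothing  pu = root (parentOf par v) refl
      where
      root : ∀ y → parentOf par v ≡ y → Σ ℕ λ a → parentOf par v ≡ just a × a ≤ u
      root nothing  pv = ⊥-elim (<-irrefl (rootsEqual v u (proj₁ Kv) (proj₁ (proj₂ Kv)) (proj₁ Ku) (proj₁ (proj₂ Ku)) pv pu) v<u)
      root (just a) pv = a , pv , K-≤root n (m∸n≤m n a) (proj₂ (K-up Kv pv)) (proj₁ Ku) (proj₁ (proj₂ Ku)) pu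
    go zero    le (just q) pu with K-up Ku pu
    ... | u<q , Kq = ⊥-elim (exhausted u<q (proj₁ (proj₂ Kq)) le)
    go (suc h) le (just q) pu with K-up Ku pu
    ... | u<q , Kq with parentBelow h (∸-decreasing u<q (proj₁ (proj₂ Kq)) le) Kq Kv (<-trans v<u u<q)
    ...   | a , pv , a≤q with a ≤? u
    ...     | yes a≤u = a , pv , a≤u
    ...     | no  a≰u with a ≟ q
    ...       | yes refl = ⊥-elim (<-irrefl (noSiblings Kv Ku pv pu) v<u)
    ...       | no  a≢q  = ⊥-elim (nothingBetween n (m∸n≤m n a) Ku pu (parentBelow h (∸-decreasing u<q (proj₁ (proj₂ Kq)) le) Kq)
                             (proj₂ (K-up Kv pv)) (≰⇒> a≰u) (≤∧≢⇒< a≤q a≢q))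

  tag-K : ∀ {v} → K v → t v ≡ 0
  tag-K {v} (1≤v , v≤n , Kv) = trans (t≡level v 1≤v v≤n) (level-chain n par n Kv)

  tag-parent : ∀ {v u} → 1 ≤ v → v ≤ n → ¬ T (inDecSub par n v) → parentOf par v ≡ just u → t v ≡ suc (t u)
  tag-parent {v} {u} 1≤v v≤n ¬Kv e = trans (t≡level v 1≤v v≤n) (trans (level-step n par m ¬Kv e)
    (cong suc (trans (level-stable n par m (reaches-just⁻ n par m e (reach v 1≤v v≤n))) (sym (t≡level u (proj₁ (bounded v u e)) (proj₂ (bounded v u e)))))))

  0⇒K : ∀ {v} → 1 ≤ v → v ≤ n → t v ≡ 0 → K v
  0⇒K {v} 1≤v v≤n z = 1≤v , v≤n , dec (T? (inDecSub par n v)) (parentOf par v) refl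
    where
    dec : Dec (T (inDecSub par n v)) → ∀ x → parentOf par v ≡ x → T (inDecSub par n v)
    dec (yes p) _        _ = p
    dec (no ¬p) nothing  e = inDecSub-nothing n par n e
    dec (no ¬p) (just u) e = ⊥-elim (0≢1+n (trans (sym z) (tag-parent 1≤v v≤n ¬p e)))

  -- The next vertex of tag 0 cannot lie before the parent, by `nothingBetween`, nor after it, since
  -- the parent has tag 0 itself; and above the root there is none, as the root is the largest chain
  -- vertex.
  fits-chain : ∀ {v} → K v → ∀ x → parentOf par v ≡ x → ∀ y → nextZero t (n ∸ v) v ≡ y → x ≡ y
  fits-chain Kv nothing  e nothing  f = refl
  fits-chain {v} Kv@(1≤v , v≤n , _) nothing  e (just a) f with nextZero-just t (n ∸ v) v f
  ... | v<a , a≤ , z , _ = ⊥-elim (<⇒≱ v<a (K-≤root n (m∸n≤m n a) (0⇒K (≤-trans 1≤v (<⇒≤ v<a)) (subst (a ≤_) (m+[n∸m]≡n v≤n) a≤) z) 1≤v v≤n e))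
  fits-chain {v} Kv@(1≤v , v≤n , _) (just q) e nothing  f with K-up Kv e
  ... | v<q , Kq@(_ , q≤n , _) = ⊥-elim (nextZero-nothing t (n ∸ v) v f q v<q (subst (q ≤_) (sym (m+[n∸m]≡n v≤n)) q≤n) (tag-K Kq))
  fits-chain {v} Kv@(1≤v , v≤n , _) (just q) e (just a) f with K-up Kv e | nextZero-just t (n ∸ v) v f
  ... | v<q , Kq | v<a , a≤ , z , none with <-cmp a q
  ...   | tri≈ _ refl _ = refl
  ...   | tri> _ _ q<a  = ⊥-elim (none q v<q q<a (tag-K Kq))
  ...   | tri< a<q _ _  = ⊥-elim (nothingBetween n (m∸n≤m n a) Kv e (parentBelow n (m∸n≤m n q) Kq)
                            (0⇒K (≤-trans 1≤v (<⇒≤ v<a)) (subst (a ≤_) (m+[n∸m]≡n v≤n) a≤) z) v<a a<q)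

  fits-other : ∀ {v} → 1 ≤ v → v ≤ n → ¬ T (inDecSub par n v) → ∀ x → parentOf par v ≡ x → ∀ s → t v ≡ suc s → Fits t n v (suc s) x
  fits-other 1≤v v≤n ¬Kv nothing  e s       es = ⊥-elim (¬Kv (inDecSub-nothing n par n e))
  fits-other {v} 1≤v v≤n ¬Kv (just u) e zero    es with trans (sym es) (tag-parent 1≤v v≤n ¬Kv e)
  ... | eq with <-cmp u v
  ...   | tri< u<v _ _  = u<v , suc-injective (sym eq)
  ...   | tri≈ _ refl _ = ⊥-elim (0≢1+n (trans (suc-injective eq) es))
  -- A larger parent on the chain would put v on the chain.
  ...   | tri> _ _ v<u  = ⊥-elim (¬Kv (K-down (0⇒K (proj₁ (bounded v u e)) (proj₂ (bounded v u e)) (suc-injective (sym eq))) e v<u))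
  fits-other 1≤v v≤n ¬Kv (just u) e (suc s) es = suc-injective (trans (sym (tag-parent 1≤v v≤n ¬Kv e)) es)

  allFit : AllFit t n par
  allFit v 1≤v v≤n = go (t v) refl
    where
    go : ∀ s → t v ≡ s → Fits t n v s (parentOf par v)
    go zero    e = fits-chain (0⇒K 1≤v v≤n e) (parentOf par v) refl _ refl
    go (suc s) e = fits-other 1≤v v≤n (λ p → 0≢1+n (trans (sym (tag-K (1≤v , v≤n , p))) e)) (parentOf par v) refl s e

-- Double counting of parent maps and taggings

prodAt-indicator : ∀ {P : ℕ → Maybe ℕ → Set} (P? : ∀ v x → Dec (P v x)) par →
  (prodAt (λ v x → indicator (P? v x)) par ≡ 1 × (∀ v → 1 ≤ v → v ≤ length par → P v (parentOf par v))) ⊎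
  (prodAt (λ v x → indicator (P? v x)) par ≡ 0 × ¬ (∀ v → 1 ≤ v → v ≤ length par → P v (parentOf par v)))
prodAt-indicator P? []        = inj₁ (refl , λ { (suc v) _ () })
prodAt-indicator P? (x ∷ par) with P? 1 x | prodAt-indicator (λ v → P? (suc v)) par
... | no ¬p | _              = inj₂ (refl , λ f → ¬p (f 1 ≤-refl (s≤s z≤n)))
... | yes p | inj₁ (e , f)   = inj₁ (trans (+-identityʳ _) e , λ { (suc zero) _ _ → p ; (suc (suc v)) _ (s≤s le) → f (suc v) (s≤s z≤n) le })
... | yes p | inj₂ (e , ¬f)  = inj₂ (trans (+-identityʳ _) e , λ f → ¬f (λ { (suc v) _ le → f (suc (suc v)) (s≤s z≤n) (s≤s le) }))

indicator-× : ∀ {P Q R : Set} (P? : Dec P) (Q? : Dec Q) (R? : Dec R) → (P → Q × R) → (Q → R → P) →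
  indicator P? ≡ indicator Q? * indicator R?
indicator-× P? (no ¬q) R?      f g = indicator-no P? (¬q ∘ proj₁ ∘ f)
indicator-× P? (yes _) (no ¬r) f g = indicator-no P? (¬r ∘ proj₂ ∘ f)
indicator-× P? (yes q) (yes r) f g = indicator-yes P? (g q r)

sum-tuples-pick : ∀ (X : List ℕ) w → All (λ a → sumOver X (λ x → indicator (x ≟ a)) ≡ 1) w →
  sumOver (tuples X (length w)) (λ v → indicator (≡-dec _≟_ v w)) ≡ 1
sum-tuples-pick X []      []       = refl
sum-tuples-pick X (a ∷ w) (p ∷ ps) = begin
  sumOver (tuples X (suc (length w))) (λ v → indicator (≡-dec _≟_ v (a ∷ w)))
    ≡⟨ sumOver-tuples X (length w) _ ⟩
  sumOver W (λ v → sumOver X (λ x → indicator (≡-dec _≟_ (x ∷ v) (a ∷ w))))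
    ≡⟨ sumOver-cong W (λ v → trans (sumOver-cong X (λ x → split x v)) (trans (sumOver-*ˡ X (indicator (≡-dec _≟_ v w)) _) (trans (cong (indicator (≡-dec _≟_ v w) *_) p) (*-identityʳ _)))) ⟩
  sumOver W (λ v → indicator (≡-dec _≟_ v w))
    ≡⟨ sum-tuples-pick X w ps ⟩
  1 ∎
  where
  open ≡-Reasoning
  W : List (List ℕ)
  W = tuples X (length w)
  split : ∀ x v → indicator (≡-dec _≟_ (x ∷ v) (a ∷ w)) ≡ indicator (≡-dec _≟_ v w) * indicator (x ≟ a)
  split x v = indicator-× (≡-dec _≟_ (x ∷ v) (a ∷ w)) (≡-dec _≟_ v w) (x ≟ a) (λ { refl → refl , refl }) (λ { refl refl → refl })

sum-tags-pick : ∀ b a → a ≤ suc b → sumOver (tags b) (λ x → indicator (x ≟ a)) ≡ 1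
sum-tags-pick b zero          _ = cong suc (trans (sumOver-map suc (labels b) _) (sumOver-zero (labels b)))
sum-tags-pick b (suc zero)    _ = cong suc (trans (sumOver-map suc (labels b) _)
  (trans (sum-labels-cong b {g = λ _ → 0} (λ { (suc v) _ _ → refl })) (sumOver-zero (labels b))))
sum-tags-pick b (suc (suc a)) (s≤s a≤b) = trans (sumOver-map suc (labels b) _) (trans
  (sum-labels-cong b (λ v _ _ → indicator-⇔ (suc v ≟ suc (suc a)) (v ≟ suc a) suc-injective (cong suc)))
  (sum-labels-pick b (suc a) (s≤s z≤n) a≤b))

tagOf-map-labels : ∀ n (f : ℕ → ℕ) v → 1 ≤ v → v ≤ n → tagOf (map f (labels n)) v ≡ f v
tagOf-map-labels zero    f v 1≤v v≤0 = ⊥-elim (<⇒≱ 1≤v v≤0)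
tagOf-map-labels (suc n) f v 1≤v v≤n = trans (cong (λ l → tagOf (map f l) v) (labels-suc n)) (go v 1≤v v≤n)
  where
  go : ∀ v → 1 ≤ v → v ≤ suc n → tagOf (f 1 ∷ map f (map suc (labels n))) v ≡ f v
  go (suc zero)    _ _         = refl
  go (suc (suc v)) _ (s≤s v≤n) = trans (cong (λ l → tagOf l (suc v)) (sym (map-∘ (labels n))))
    (tagOf-map-labels n (f ∘ suc) (suc v) (s≤s z≤n) v≤n)

map-tagOf-labels : ∀ l → map (tagOf l) (labels (length l)) ≡ l
map-tagOf-labels []      = refl
map-tagOf-labels (x ∷ l) = trans (cong (map (tagOf (x ∷ l))) (labels-suc (length l))) (cong (x ∷_) (trans (sym (map-∘ (labels (length l))))
  (trans (trans (sym (map-∘ (upTo (length l)))) (map-∘ (upTo (length l)))) (map-tagOf-labels l))))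

parents : ℕ → List (Maybe ℕ)
parents n = nothing ∷ map (λ l → just (suc l)) (upTo n)

allParentMaps-tuples : ∀ n m → allParentMaps n m ≡ tuples (parents n) m
allParentMaps-tuples n zero    = refl
allParentMaps-tuples n (suc m) = cong (concatMap (λ w → map (_∷ w) (parents n))) (allParentMaps-tuples n m)

sum-parents : ∀ n (f : Maybe ℕ → ℕ) → sumOver (parents n) f ≡ f nothing + sumOver (labels n) (f ∘ just)
sum-parents n f = cong (f nothing +_) (trans (sumOver-map _ (upTo n) f) (sym (sumOver-map suc (upTo n) (f ∘ just))))

InRange : ℕ → Maybe ℕ → Set
InRange n x = ∀ u → x ≡ just u → 1 ≤ u × u ≤ n

parents-inRange : ∀ n → All (InRange n) (parents n)
parents-inRange n = (λ _ ()) ∷ AllP.map⁺ (AllP.applyUpTo⁺₁ id n (λ i<n → λ { _ refl → s≤s z≤n , i<n }))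

bounded-parents : ∀ n {par} → All (InRange n) par → BoundedParents n par
bounded-parents n (p ∷ ps) (suc zero)    u e = p u e
bounded-parents n (p ∷ ps) (suc (suc v)) u e = bounded-parents n ps (suc v) u e

fitIndicator : ℕ → List ℕ → ℕ → Maybe ℕ → ℕ
fitIndicator n l v x = indicator (fits? (tagOf l) n v (tagOf l v) x)

isChainTree : ℕ → List (Maybe ℕ) → Bool
isChainTree n par = isTree n par ∧ decSubIsChain n par

-- The list of levels is the only candidate for a fitting tagging. It fits when the map is a tree
-- whose decreasing subtree is a chain, and conversely any fitting tagging forces the map to be such
-- a tree.
sum-fitting-tags : ∀ n → 1 ≤ n → ∀ par → length par ≡ n → BoundedParents n par →
  sumOver (tuples (tags n) n) (λ l → prodAt (fitIndicator n l) par) ≡ indicator (isChainTree n par Bool.≟ true)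
sum-fitting-tags n@(suc m) 1≤n par len bounded = begin
  sumOver (tuples (tags n) n) (λ l → prodAt (fitIndicator n l) par)
    ≡⟨ sumOver-cong-All (All.map (λ {l} p → pointwise l (proj₁ p)) (All-tuples {P = λ _ → ⊤} (All.universal _ (tags n)) n)) ⟩
  sumOver (tuples (tags n) n) (λ l → indicator chain? * indicator (≡-dec _≟_ l l₀))
    ≡⟨ sumOver-*ˡ (tuples (tags n) n) (indicator chain?) _ ⟩
  indicator chain? * sumOver (tuples (tags n) n) (λ l → indicator (≡-dec _≟_ l l₀))
    ≡⟨ cong (indicator chain? *_) (trans (cong (λ k → sumOver (tuples (tags n) k) (λ l → indicator (≡-dec _≟_ l l₀)))
         (sym (trans (length-map _ (labels n)) (length-labels n))))
         (sum-tuples-pick (tags n) l₀ (AllP.map⁺ (All.universal (λ v → sum-tags-pick n _ (m≤n⇒m≤1+n (level-≤ n par n v))) (labels n))))) ⟩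
  indicator chain? * 1
    ≡⟨ *-identityʳ _ ⟩
  indicator chain? ∎
  where
  open ≡-Reasoning
  chain? : Dec (isChainTree n par ≡ true)
  chain? = isChainTree n par Bool.≟ true
  l₀ : List ℕ
  l₀ = map (level n par n) (labels n)
  pointwise : ∀ l → length l ≡ n → prodAt (fitIndicator n l) par ≡ indicator chain? * indicator (≡-dec _≟_ l l₀)
  pointwise l ll with prodAt-indicator (λ v x → fits? (tagOf l) n v (tagOf l v) x) par
  ... | inj₁ (e , f) = trans e (sym (cong₂ _*_ (indicator-yes chain? (Equivalence.to T-≡ (T-∧⁺ (F.tree 1≤n) F.isChain)))
                         (indicator-yes (≡-dec _≟_ l l₀) l≡l₀)))
    where
    module F = FitTree n par bounded (tagOf l) (λ v 1≤v v≤n → f v 1≤v (subst (v ≤_) (sym len) v≤n))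
    l≡l₀ : l ≡ l₀
    l≡l₀ = trans (sym (map-tagOf-labels l)) (trans (cong (λ k → map (tagOf l) (labels k)) ll)
      (map-cong-local (All-labels n F.tag≡level)))
  ... | inj₂ (e , ¬f) = trans e (sym (vanish chain? (≡-dec _≟_ l l₀)))
    where
    vanish : (c : Dec (isChainTree n par ≡ true)) (d : Dec (l ≡ l₀)) → indicator c * indicator d ≡ 0
    vanish (no _)  _          = refl
    vanish (yes _) (no _)     = refl
    vanish (yes p) (yes refl) = ⊥-elim (¬f (λ v 1≤v v≤ → ChainTree.allFit m par bounded (proj₁ both) (proj₂ both) (tagOf l₀)
      (tagOf-map-labels n (level n par n)) v 1≤v (subst (v ≤_) len v≤)))
      where
      both : T (isTree n par) × T (decSubIsChain n par)
      both = T-∧⁻ (Equivalence.from T-≡ p)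

levelsOf-positive : ∀ l → All (1 ≤_) (levelsOf l)
levelsOf-positive []                = []
levelsOf-positive (0 ∷ l)           = levelsOf-positive l
levelsOf-positive (1 ∷ l)           = levelsOf-positive l
levelsOf-positive (suc (suc t) ∷ l) = s≤s z≤n ∷ levelsOf-positive l

levelsOf-bounded : ∀ b {l} → All (_≤ suc b) l → All (_≤ b) (levelsOf l)
levelsOf-bounded b {[]}              []       = []
levelsOf-bounded b {0 ∷ l}           (_ ∷ ps) = levelsOf-bounded b ps
levelsOf-bounded b {1 ∷ l}           (_ ∷ ps) = levelsOf-bounded b ps
levelsOf-bounded b {suc (suc t) ∷ l} (p ∷ ps) = s≤s⁻¹ p ∷ levelsOf-bounded b ps

occ-levelsOf : ∀ a l → occ (2 + a) l ≡ occ (1 + a) (levelsOf l)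
occ-levelsOf a []                = refl
occ-levelsOf a (0 ∷ l)           = occ-levelsOf a l
occ-levelsOf a (1 ∷ l)           = occ-levelsOf a l
occ-levelsOf a (suc (suc t) ∷ l) = cong₂ _+_ (indicator-⇔ (2 + t ≟ 2 + a) (1 + t ≟ 1 + a) suc-injective (cong suc)) (occ-levelsOf a l)

sum-fitting-parents : ∀ l v → 1 ≤ v → v ≤ length l →
  sumOver (parents (length l)) (fitIndicator (length l) l v) ≡ parentChoices (zerosBefore l) (λ a → occ a l) v (tagOf l v)
sum-fitting-parents l v 1≤v v≤n = trans (sum-parents n (fitIndicator n l v)) (go (tagOf l v))
  where
  n : ℕ
  n = length l
  F : ℕ → Maybe ℕ → ℕ
  F s x = indicator (fits? (tagOf l) n v s x)
  go : ∀ s → F s nothing + sumOver (labels n) (F s ∘ just) ≡ parentChoices (zerosBefore l) (λ a → occ a l) v s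
  go (suc zero)    = zerosBefore-sum l v 1≤v
  go (suc (suc s)) = sum-labels-tagOf l (λ x → indicator (x ≟ suc s))
  -- The forced parent of a chain vertex occurs exactly once in `parents`: as `nothing`, or as a
  -- label u ≤ n.
  go zero with nextZero (tagOf l) (n ∸ v) v in e
  ... | nothing = cong suc (sumOver-zero (labels n))
  ... | just u  = let v<u , u≤ , _ = nextZero-just (tagOf l) (n ∸ v) v e in
    trans (sum-labels-cong n (λ w _ _ → indicator-⇔ (MaybeP.≡-dec _≟_ (just w) (just u)) (w ≟ u) MaybeP.just-injective (cong just)))
      (sum-labels-pick n u (≤-trans 1≤v (<⇒≤ v<u)) (subst (u ≤_) (m+[n∸m]≡n v≤n) u≤))

-- Pairs of a parent map and a fitting tagging are counted in two ways: by maps, each tree of the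
-- required kind occurs once; by taggings, the number of maps is the product of the parent choices.
treesChainCount-chains : ∀ n → 1 ≤ n → treesChainCount n ≡ chains n
treesChainCount-chains n 1≤n = begin
  treesChainCount n
    ≡⟨ length-filter-sum (λ par → isChainTree n par Bool.≟ true) (allParentMaps n n) ⟩
  sumOver (allParentMaps n n) (λ par → indicator (isChainTree n par Bool.≟ true))
    ≡⟨ cong (λ L → sumOver L (λ par → indicator (isChainTree n par Bool.≟ true))) (allParentMaps-tuples n n) ⟩
  sumOver (tuples (parents n) n) (λ par → indicator (isChainTree n par Bool.≟ true))
    ≡⟨ sumOver-cong-All (All.map (λ {par} p → sym (sum-fitting-tags n 1≤n par (proj₁ p) (bounded-parents n (proj₂ p)))) (All-tuples (parents-inRange n) n)) ⟩
  sumOver (tuples (parents n) n) (λ par → sumOver (tuples (tags n) n) (λ l → prodAt (fitIndicator n l) par))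
    ≡⟨ sumOver-swap (tuples (parents n) n) (tuples (tags n) n) (λ par l → prodAt (fitIndicator n l) par) ⟩
  sumOver (tuples (tags n) n) (λ l → sumOver (tuples (parents n) n) (prodAt (fitIndicator n l)))
    ≡⟨ sumOver-cong-All (All.map (λ {l} p → choices l (proj₁ p) (proj₂ p)) (All-tuples tags-bounded n)) ⟩
  sumOver (tuples (tags n) n) (λ l → rootChoices 0 l * hang n (occ 1 l) (levelsOf l))
    ≡⟨ sum-tags-hang n ⟩
  chains n ∎
  where
  open ≡-Reasoning
  tags-bounded : All (_≤ suc n) (tags n)
  tags-bounded = z≤n ∷ s≤s z≤n ∷ AllP.map⁺ (All-labels n (λ v _ v≤n → s≤s v≤n))
  choices : ∀ l → length l ≡ n → All (_≤ suc n) l →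
    sumOver (tuples (parents n) n) (prodAt (fitIndicator n l)) ≡ rootChoices 0 l * hang n (occ 1 l) (levelsOf l)
  choices l refl bd = trans (sum-prodAt (parents n) n (fitIndicator n l))
    (trans (prodTo-cong n (sum-fitting-parents l))
    (trans (prodTo-tagOf (parentChoices (zerosBefore l) (λ a → occ a l)) l)
    (trans (prodAt-parentChoices l 0 (zerosBefore l) (λ a → occ a l) (λ _ → refl))
    (cong (rootChoices 0 l *_) (prodOver-hang n (levelsOf l) (λ a → occ a l) (levelsOf-positive l) (levelsOf-bounded n bd) (λ a → occ-levelsOf a l))))))

-- Words and columns

Unique-resp-↭ : ∀ {a} {A : Set a} {xs ys : List A} → xs ↭ ys → Unique xs → Unique ys
Unique-resp-↭ p = SetoidPermP.Unique-resp-↭ (setoid _) (Perm.↭⇒↭ₛ p)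

labels-increasing : ∀ n → AllPairs _<_ (labels n)
labels-increasing n = AllPairsP.map⁺ (AllPairsP.applyUpTo⁺₁ id n (λ i<j _ → s≤s i<j))

labels-unique : ∀ n → Unique (labels n)
labels-unique n = AllPairs.map <⇒≢ (labels-increasing n)

sorted-↭⇒≡ : ∀ {a} {A : Set a} (f : A → ℕ) {xs ys} → AllPairs (λ x y → f x < f y) xs → AllPairs (λ x y → f x < f y) ys → xs ↭ ys → xs ≡ ys
sorted-↭⇒≡ f {[]}     {ys}     _        _        p = sym (PermP.↭-empty-inv (↭-sym p))
sorted-↭⇒≡ f {x ∷ xs} {[]}     _        _        p = ⊥-elim (PermP.¬x∷xs↭[] p)
sorted-↭⇒≡ f {x ∷ xs} {y ∷ ys} (q ∷ qs) (r ∷ rs) p with PermP.∈-resp-↭ p (here refl)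
... | here refl = cong (x ∷_) (sorted-↭⇒≡ f qs rs (PermP.drop-∷ p))
... | there x∈  with PermP.∈-resp-↭ (↭-sym p) (here refl)
...   | here refl = cong (y ∷_) (sorted-↭⇒≡ f qs rs (PermP.drop-∷ p))
...   | there y∈  = ⊥-elim (<-asym (All.lookup r x∈) (All.lookup q y∈))

increasing⇒ : ∀ {L} → StrictlyIncreasing L → AllPairs _<_ L
increasing⇒ si-[]         = []
increasing⇒ si-[x]        = [] ∷ []
increasing⇒ (si-∷ x<y si) with increasing⇒ si
... | q ∷ qs = (x<y ∷ All.map (<-trans x<y) q) ∷ q ∷ qs

⇒increasing : ∀ {L} → AllPairs _<_ L → StrictlyIncreasing L
⇒increasing []                     = si-[]
⇒increasing ([] ∷ [])              = si-[x]
⇒increasing ((x<y ∷ _) ∷ (q ∷ qs)) = si-∷ x<y (⇒increasing (q ∷ qs))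

module _ {A B : Set} where

  map-proj₁-zip : ∀ (xs : List A) (ys : List B) → length ys ≡ length xs → map proj₁ (zip xs ys) ≡ xs
  map-proj₁-zip []       []       e = refl
  map-proj₁-zip (x ∷ xs) (y ∷ ys) e = cong (x ∷_) (map-proj₁-zip xs ys (suc-injective e))

  map-proj₂-zip : ∀ (xs : List A) (ys : List B) → length ys ≡ length xs → map proj₂ (zip xs ys) ≡ ys
  map-proj₂-zip []       []       e = refl
  map-proj₂-zip (x ∷ xs) (y ∷ ys) e = cong (y ∷_) (map-proj₂-zip xs ys (suc-injective e))

  zip-map-self : ∀ (f : A → B) xs → zip xs (map f xs) ≡ map (λ x → x , f x) xs
  zip-map-self f []       = refl
  zip-map-self f (x ∷ xs) = cong ((x , f x) ∷_) (zip-map-self f xs)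

lookupAssoc-∈ : ∀ {p v} X → Unique (map proj₁ X) → (p , v) ∈ X → lookupAssoc p X ≡ v
lookupAssoc-∈ {p} ((q , v) ∷ X) (_ ∷ _) (here refl) with p ≡ᵇ p in e
... | true  = refl
... | false = ⊥-elim (subst T e (≡⇒≡ᵇ p p refl))
lookupAssoc-∈ {p} ((q , w) ∷ X) (q∉ ∷ u) (there p∈) with p ≡ᵇ q in e
... | false = lookupAssoc-∈ X u p∈
... | true  = ⊥-elim (All.lookup q∉ (∈-map⁺ proj₁ p∈) (sym (≡ᵇ⇒≡ p q (subst T (sym e) tt))))

NonEmpty : Column → Set
NonEmpty c = 1 ≤ length (proj₁ c)

-- Sequences without empty columns; `Φ` maps those with label set [n] bijectively onto the parking
-- functions of length n.
Good : List Column → Set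
Good cols = All (λ c → ValidColumn c × NonEmpty c) cols

valid : ∀ {cols} → Good cols → All ValidColumn cols
valid = All.map proj₁

labelsOf : List Column → List ℕ
labelsOf cols = concat (map proj₁ cols)

total : List Column → ℕ
total cols = length (labelsOf cols)

-- The letters of the word in the order of the columns instead of the positions; counts of letters
-- can be read off column by column.
letters : ℕ → List Column → Word
letters off []             = []
letters off ((L , M) ∷ cs) = map (λ a → a + off) M ++ letters (off + normL L) cs

assign-keys : ∀ off {cols} → All ValidColumn cols → map proj₁ (assign off cols) ≡ labelsOf cols
assign-keys off {[]}            []       = refl
assign-keys off {(L , M) ∷ cs} ((_ , len , _) ∷ vs) = trans (map-++ proj₁ (zip L (map (_+ off) M)) _)
  (cong₂ _++_ (map-proj₁-zip L _ (trans (length-map (_+ off) M) len)) (assign-keys (off + normL L) vs))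

assign-letters : ∀ off {cols} → All ValidColumn cols → map proj₂ (assign off cols) ≡ letters off cols
assign-letters off {[]}            []       = refl
assign-letters off {(L , M) ∷ cs} ((_ , len , _) ∷ vs) = trans (map-++ proj₂ (zip L (map (_+ off) M)) _)
  (cong₂ _++_ (map-proj₂-zip L _ (trans (length-map (_+ off) M) len)) (assign-letters (off + normL L) vs))

length-letters : ∀ off {cols} → All ValidColumn cols → length (letters off cols) ≡ total cols
length-letters off {cols} vs = trans (cong length (sym (assign-letters off vs))) (trans (length-map proj₂ (assign off cols))
  (trans (sym (length-map proj₁ (assign off cols))) (cong length (assign-keys off vs))))

length-Φ : ∀ n cols → length (Φ n cols) ≡ n
length-Φ n cols = trans (length-map _ (labels n)) (length-labels n)

Φ-assign : ∀ n {cols} → ValidBW n cols → zip (labels n) (Φ n cols) ↭ assign 0 cols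
Φ-assign n {cols} (vs , p) = ↭-trans (↭-reflexive (zip-map-self f (labels n)))
  (↭-trans (PermP.map⁺ (λ q → q , f q) (↭-sym keys))
    (↭-reflexive (trans (sym (map-∘ (assign 0 cols))) (map-id-local (All.tabulate (λ {a} a∈ →
      cong (proj₁ a ,_) (lookupAssoc-∈ (assign 0 cols) (Unique-resp-↭ (↭-sym keys) (labels-unique n)) a∈)))))))
  where
  f : ℕ → ℕ
  f q = lookupAssoc q (assign 0 cols)
  keys : map proj₁ (assign 0 cols) ↭ labels n
  keys = ↭-trans (↭-reflexive (assign-keys 0 vs)) p

Φ-letters : ∀ n {cols} → ValidBW n cols → Φ n cols ↭ letters 0 cols
Φ-letters n {cols} v@(vs , _) = ↭-trans (↭-reflexive (sym (map-proj₂-zip (labels n) (Φ n cols) (trans (length-Φ n cols) (sym (length-labels n))))))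
  (↭-trans (PermP.map⁺ proj₂ (Φ-assign n v)) (↭-reflexive (assign-letters 0 vs)))

total-valid : ∀ n {cols} → ValidBW n cols → total cols ≡ n
total-valid n (_ , p) = trans (PermP.↭-length p) (length-labels n)

normL-nonEmpty : ∀ (L : List ℕ) → 1 ≤ length L → normL L ≡ length L
normL-nonEmpty (x ∷ L) _ = refl

countLe-shift : ∀ off i M → countLe (off + i) (map (λ a → a + off) M) ≡ countLe i M
countLe-shift off i []      = refl
countLe-shift off i (a ∷ M) with a ≤? i
... | yes p = trans (countLe-accept (subst (a + off ≤_) (+-comm i off) (+-monoˡ-≤ off p))) (trans (cong suc (countLe-shift off i M)) (sym (countLe-accept p)))
... | no ¬p = trans (countLe-reject (λ q → ¬p (+-cancelʳ-≤ off a i (subst (a + off ≤_) (+-comm off i) q)))) (trans (countLe-shift off i M) (sym (countLe-reject ¬p)))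

prime-bounded : ∀ {M} → IsPrime M → All (_≤ length M) M
prime-bounded {M} ((_ , c) , _) = countLe-full (length M) M (c (length M) ≤-refl)

countLe-prime-≥ : ∀ {M i} → IsPrime M → length M ≤ i → countLe i M ≡ length M
countLe-prime-≥ pr le = countLe-all (All.map (λ p → ≤-trans p le) (prime-bounded pr))

letters-above : ∀ off {cols} → All ValidColumn cols → All (off <_) (letters off cols)
letters-above off {[]}            []                     = []
letters-above off {(L , M) ∷ cs} ((_ , _ , pr) ∷ vs) = AllP.++⁺
  (AllP.map⁺ (All.map (λ {a} 1≤a → +-monoˡ-≤ off 1≤a) (proj₁ (proj₁ (isPrimePF⇒prime M pr)))))
  (All.map (λ lt → ≤-<-trans (m≤m+n off (normL L)) lt) (letters-above (off + normL L) vs))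

countLe-column-head : ∀ off L M {cs} → ValidColumn (L , M) → 1 ≤ length L → All ValidColumn cs → ∀ i → i ≤ length L →
  countLe (off + i) (letters off ((L , M) ∷ cs)) ≡ countLe i M
countLe-column-head off L M {cs} (_ , len , pr) ne vs i i≤ = trans (countLe-++ (off + i) (map (_+ off) M) _)
  (trans (cong₂ _+_ (countLe-shift off i M) (countLe-none (All.map (λ lt → ≤-<-trans (+-monoʳ-≤ off (subst (i ≤_) (sym (normL-nonEmpty L ne)) i≤)) lt)
    (letters-above (off + normL L) vs)))) (+-identityʳ _))

-- Up to the size of the first column its own parking condition applies; beyond it, all its letters
-- are counted and the remaining columns supply the rest.
countLe-letters : ∀ off {cols} → Good cols → ∀ i → i ≤ total cols → i ≤ countLe (off + i) (letters off cols)
countLe-letters off {[]}            []                   i le = ≤-trans le z≤n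
countLe-letters off {(L , M) ∷ cs} ((v@(_ , len , pr) , ne) ∷ gs) i le with ≤-total i (length L)
... | inj₁ i≤L = subst (i ≤_) (sym (countLe-column-head off L M v ne (valid gs) i i≤L))
                   (proj₂ (proj₁ (isPrimePF⇒prime M pr)) i (subst (i ≤_) (sym len) i≤L))
... | inj₂ L≤i = begin
  i
    ≡⟨ m+[n∸m]≡n L≤i ⟨
  length L + (i ∸ length L)
    ≤⟨ +-mono-≤ (≤-reflexive (trans (sym len) (sym (countLe-prime-≥ (isPrimePF⇒prime M pr) (subst (_≤ i) (sym len) L≤i)))))
         (countLe-letters (off + normL L) gs (i ∸ length L) (subst (i ∸ length L ≤_) (trans (cong (_∸ length L) (length-++ L)) (m+n∸m≡n (length L) _)) (∸-monoˡ-≤ (length L) le))) ⟩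
  countLe i M + countLe (off + normL L + (i ∸ length L)) (letters (off + normL L) cs)
    ≡⟨ cong₂ _+_ (sym (countLe-shift off i M)) (cong (λ k → countLe k (letters (off + normL L) cs))
         (trans (+-assoc off (normL L) _) (cong (off +_) (trans (cong (_+ (i ∸ length L)) (normL-nonEmpty L ne)) (m+[n∸m]≡n L≤i))))) ⟩
  countLe (off + i) (map (_+ off) M) + countLe (off + i) (letters (off + normL L) cs)
    ≡⟨ countLe-++ (off + i) (map (_+ off) M) _ ⟨
  countLe (off + i) (letters off ((L , M) ∷ cs)) ∎
  where open ≤-Reasoning

letters-below : ∀ off {cols} → Good cols → All (_≤ off + total cols) (letters off cols)
letters-below off {cols} gs = countLe-full (off + total cols) (letters off cols)
  (≤-trans (≤-reflexive (length-letters off (valid gs))) (countLe-letters off gs (total cols) ≤-refl))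

Φ-parking : ∀ n {cols} → Good cols → labelsOf cols ↭ labels n → IsParking (Φ n cols)
Φ-parking n {cols} gs p = PermP.All-resp-↭ (↭-sym perm) (letters-above 0 (valid gs)) , λ i i≤ → subst (i ≤_) (sym (countLe-↭ i perm))
  (countLe-letters 0 gs i (subst (i ≤_) (trans (length-Φ n cols) (sym (total-valid n (valid gs , p)))) i≤))
  where
  perm : Φ n cols ↭ letters 0 cols
  perm = Φ-letters n (valid gs , p)

-- Parkization

dSearch-found : ∀ fl s w d → s ≤ d → d < s + fl → (∀ i → s ≤ i → i < d → i ≤ countLe i w) → countLe d w < d → dSearch fl s w ≡ d
dSearch-found zero     s w d s≤d d< _  _  = ⊥-elim (<⇒≱ d< (subst (_≤ d) (sym (+-identityʳ s)) s≤d))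
dSearch-found (suc fl) s w d s≤d d< lo hi with countLe s w <ᵇ s in e | s ≟ d
... | true  | yes refl = refl
... | false | yes refl = ⊥-elim (subst T e (<⇒<ᵇ hi))
... | true  | no s≢d   = ⊥-elim (<⇒≱ (<ᵇ⇒< (countLe s w) s (subst T (sym e) tt)) (lo s ≤-refl (≤∧≢⇒< s≤d s≢d)))
... | false | no s≢d   = dSearch-found fl (suc s) w d (≤∧≢⇒< s≤d s≢d) (subst (d <_) (+-suc s fl) d<) (λ i s<i → lo i (<⇒≤ s<i)) hi

dW-found : ∀ w s → s ≤ length w → (∀ i → i ≤ s → i ≤ countLe i w) → countLe (suc s) w ≤ s → dW w ≡ suc s
dW-found w s s≤ lo hi = dSearch-found (suc (length w)) 1 w (suc s) (s≤s z≤n) (s≤s (s≤s s≤)) (λ i _ i<s → lo i (s≤s⁻¹ i<s)) (s≤s hi)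

decreaseAbove : ℕ → ℕ → ℕ
decreaseAbove d a = if d <ᵇ a then a ∸ 1 else a

decreaseAbove-≤ : ∀ {d a} → a ≤ d → decreaseAbove d a ≡ a
decreaseAbove-≤ {d} {a} le with d <ᵇ a in e
... | false = refl
... | true  = ⊥-elim (<⇒≱ (<ᵇ⇒< d a (subst T (sym e) tt)) le)

decreaseAbove-> : ∀ {d a} → d < a → decreaseAbove d a ≡ a ∸ 1
decreaseAbove-> {d} {a} lt with d <ᵇ a in e
... | true  = refl
... | false = ⊥-elim (subst T e (<⇒<ᵇ lt))

sum-decAbove-≤ : ∀ d w → sum (decAbove d w) ≤ sum w
sum-decAbove-≤ d []      = z≤n
sum-decAbove-≤ d (a ∷ w) with a ≤? d
... | yes p = +-mono-≤ (≤-reflexive (decreaseAbove-≤ p)) (sum-decAbove-≤ d w)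
... | no ¬p = +-mono-≤ (≤-trans (≤-reflexive (decreaseAbove-> (≰⇒> ¬p))) (m∸n≤m a 1)) (sum-decAbove-≤ d w)

sum-decAbove-< : ∀ d w → countLe d w < length w → sum (decAbove d w) < sum w
sum-decAbove-< d (a ∷ w) lt with a ≤? d
... | yes p = +-mono-≤-< (≤-reflexive (decreaseAbove-≤ p)) (sum-decAbove-< d w (s≤s⁻¹ (subst (_< suc (length w)) (countLe-accept p) lt)))
sum-decAbove-< d (zero ∷ w)  lt | no ¬p = ⊥-elim (¬p z≤n)
sum-decAbove-< d (suc a ∷ w) lt | no ¬p = +-mono-<-≤ (subst (_< suc a) (sym (decreaseAbove-> (≰⇒> ¬p))) ≤-refl) (sum-decAbove-≤ d w)

-- The condition on f 0 covers the default value 0 of a failed lookup.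
lookupAssoc-map : ∀ (f : ℕ → ℕ) → f 0 ≡ 0 → ∀ p X → f (lookupAssoc p X) ≡ lookupAssoc p (map (λ x → proj₁ x , f (proj₂ x)) X)
lookupAssoc-map f f0 p []            = f0
lookupAssoc-map f f0 p ((q , v) ∷ X) with p ≡ᵇ q
... | true  = refl
... | false = lookupAssoc-map f f0 p X

offset : List Column → ℕ
offset []             = 0
offset ((L , M) ∷ cs) = normL L + offset cs

offset-good : ∀ {cols} → Good cols → offset cols ≡ total cols
offset-good {[]}           []              = refl
offset-good {(L , M) ∷ cs} ((_ , ne) ∷ gs) = trans (cong₂ _+_ (normL-nonEmpty L ne) (offset-good gs)) (sym (length-++ L))

assign-++ : ∀ off A B → assign off (A ++ B) ≡ assign off A ++ assign (off + offset A) B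
assign-++ off []             B = cong (λ k → assign k B) (sym (+-identityʳ off))
assign-++ off ((L , M) ∷ A) B = trans (cong (zip L (map (_+ off) M) ++_) (trans (assign-++ (off + normL L) A B)
  (cong (λ k → assign (off + normL L) A ++ assign k B) (+-assoc off (normL L) (offset A)))))
  (sym (++-assoc (zip L (map (_+ off) M)) _ _))

letters-++ : ∀ off A B → letters off (A ++ B) ≡ letters off A ++ letters (off + offset A) B
letters-++ off []             B = cong (λ k → letters k B) (sym (+-identityʳ off))
letters-++ off ((L , M) ∷ A) B = trans (cong (map (_+ off) M ++_) (trans (letters-++ (off + normL L) A B)
  (cong (λ k → letters (off + normL L) A ++ letters k B) (+-assoc off (normL L) (offset A)))))
  (sym (++-assoc (map (_+ off) M) _ _))

decreasePairs : ℕ → List (ℕ × ℕ) → List (ℕ × ℕ)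
decreasePairs d = map (λ x → proj₁ x , decreaseAbove d (proj₂ x))

decrease-below : ∀ d X → All (_≤ d) (map proj₂ X) → decreasePairs d X ≡ X
decrease-below d []            []       = refl
decrease-below d ((p , v) ∷ X) (q ∷ qs) = cong₂ _∷_ (cong (p ,_) (decreaseAbove-≤ q)) (decrease-below d X qs)

decrease-column : ∀ d off L M → d ≤ suc off → All (1 ≤_) M →
  decreasePairs d (zip L (map (λ a → a + suc off) M)) ≡ zip L (map (λ a → a + off) M)
decrease-column d off []      M       le ps       = refl
decrease-column d off (x ∷ L) []      le ps       = refl
decrease-column d off (x ∷ L) (a ∷ M) le (p ∷ ps) = cong₂ _∷_ (cong (x ,_)
  (trans (decreaseAbove-> (≤-trans (s≤s le) (+-monoˡ-≤ (suc off) p))) (cong (_∸ 1) (+-suc a off)))) (decrease-column d off L M le ps)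

decrease-above : ∀ d off {B} → d ≤ suc off → All ValidColumn B → decreasePairs d (assign (suc off) B) ≡ assign off B
decrease-above d off {[]}           le []                  = refl
decrease-above d off {(L , M) ∷ B} le ((_ , _ , pr) ∷ vs) = trans (map-++ _ (zip L (map (_+ suc off) M)) _)
  (cong₂ _++_ (decrease-column d off L M le (proj₁ (proj₁ (isPrimePF⇒prime M pr))))
    (decrease-above d (off + normL L) (≤-trans le (s≤s (m≤m+n off _))) vs))

dropEmpty : List Column → List Column
dropEmpty []                  = []
dropEmpty (([] , M) ∷ cs)     = dropEmpty cs
dropEmpty ((x ∷ L , M) ∷ cs) = (x ∷ L , M) ∷ dropEmpty cs

labelsOf-dropEmpty : ∀ cols → labelsOf (dropEmpty cols) ≡ labelsOf cols
labelsOf-dropEmpty []                  = refl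
labelsOf-dropEmpty (([] , M) ∷ cs)     = labelsOf-dropEmpty cs
labelsOf-dropEmpty ((x ∷ L , M) ∷ cs) = cong ((x ∷ L) ++_) (labelsOf-dropEmpty cs)

good-dropEmpty : ∀ {cols} → All ValidColumn cols → Good (dropEmpty cols)
good-dropEmpty {[]}                []       = []
good-dropEmpty {([] , M) ∷ cs}    (v ∷ vs) = good-dropEmpty vs
good-dropEmpty {(x ∷ L , M) ∷ cs} (v ∷ vs) = (v , s≤s z≤n) ∷ good-dropEmpty vs

dropEmpty-good : ∀ {cols} → Good cols → dropEmpty cols ≡ cols
dropEmpty-good {[]}                []       = refl
dropEmpty-good {(x ∷ L , M) ∷ cs} (_ ∷ gs) = cong ((x ∷ L , M) ∷_) (dropEmpty-good gs)

dropEmpty-++ : ∀ A B → dropEmpty (A ++ B) ≡ dropEmpty A ++ dropEmpty B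
dropEmpty-++ []                 B = refl
dropEmpty-++ (([] , M) ∷ A)     B = dropEmpty-++ A B
dropEmpty-++ ((x ∷ L , M) ∷ A) B = cong ((x ∷ L , M) ∷_) (dropEmpty-++ A B)

data FirstEmpty : List Column → Set where
  none : ∀ {cols} → Good cols → FirstEmpty cols
  at   : ∀ {A B} → Good A → All ValidColumn B → FirstEmpty (A ++ emptyCol ∷ B)

firstEmpty : ∀ {cols} → All ValidColumn cols → FirstEmpty cols
firstEmpty {[]}                    []                 = none []
firstEmpty {([] , []) ∷ cs}       (v ∷ vs)            = at [] vs
firstEmpty {([] , _ ∷ _) ∷ cs}    ((_ , () , _) ∷ vs)
firstEmpty {(x ∷ L , M) ∷ cs}     (v ∷ vs) with firstEmpty vs
... | none gs  = none ((v , s≤s z≤n) ∷ gs)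
... | at gs bs = at ((v , s≤s z≤n) ∷ gs) bs

labelsOf-++ : ∀ A B → labelsOf (A ++ B) ≡ labelsOf A ++ labelsOf B
labelsOf-++ A B = trans (cong concat (map-++ proj₁ A B)) (sym (concat-++ (map proj₁ A) (map proj₁ B)))

no-labels : ∀ off {B} → All ValidColumn B → total B ≡ 0 → assign off B ≡ [] × dropEmpty B ≡ []
no-labels off {[]}                []       e = refl , refl
no-labels off {([] , M) ∷ B}     (v ∷ vs) e = no-labels (off + 1) vs e

-- Let s be the total size of the columns before the first empty one. Their letters satisfy the
-- parking condition up to s and no letter equals s + 1, so d(w) = s + 1, and lowering the larger
-- letters deletes exactly this empty column. The sum of the letters drops, which the fuel has to
-- cover.
parkFuel-Φ : ∀ n fl {cols} → ValidBW n cols → sum (Φ n cols) ≤ fl → parkFuel fl (Φ n cols) ≡ Φ n (dropEmpty cols)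
parkFuel-Φ zero    zero     v le = refl
parkFuel-Φ (suc n) zero {cols} v@(vs , _) le = ⊥-elim (0≢1+n (trans
  (sym (sum-0 (Φ (suc n) cols) (PermP.All-resp-↭ (↭-sym (Φ-letters (suc n) v)) (letters-above 0 vs)) le)) (length-Φ (suc n) cols)))
  where
  sum-0 : ∀ w → All (1 ≤_) w → sum w ≤ 0 → length w ≡ 0
  sum-0 []      _         _  = refl
  sum-0 (a ∷ w) (1≤a ∷ _) le = ⊥-elim (<⇒≱ 1≤a (≤-trans (m≤m+n a (sum w)) le))
parkFuel-Φ n (suc fl) {cols} v@(vs , p) le with firstEmpty vs
... | none gs = trans (stop (dW-found w n (≤-reflexive (sym len)) (λ i i≤n → proj₂ (Φ-parking n gs p) i (subst (i ≤_) (sym len) i≤n))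
                  (subst (countLe (suc n) w ≤_) len (countLe-≤length (suc n) w)))) (cong (Φ n) (sym (dropEmpty-good gs)))
  where
  w : Word
  w = Φ n cols
  len : length w ≡ n
  len = length-Φ n cols
  stop : dW w ≡ suc n → parkFuel (suc fl) w ≡ w
  stop e rewrite e | len with n ≡ᵇ n in q
  ... | true  = refl
  ... | false = ⊥-elim (subst T q (≡⇒≡ᵇ n n refl))
... | at {A} {B} gs bs = decide (s ≟ n)
  where
  w : Word
  w = Φ n cols
  len : length w ≡ n
  len = length-Φ n cols
  s : ℕ
  s = total A
  os : offset A ≡ s
  os = offset-good gs
  split : letters 0 cols ≡ letters 0 A ++ letters (suc s) B
  split = trans (letters-++ 0 A (emptyCol ∷ B)) (cong (λ k → letters 0 A ++ letters k B) (trans (+-comm (offset A) 1) (cong suc os)))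
  total-split : s + total B ≡ n
  total-split = trans (sym (length-++ (labelsOf A))) (trans (cong length (sym (labelsOf-++ A (emptyCol ∷ B)))) (total-valid n v))
  count : ∀ i → countLe i w ≡ countLe i (letters 0 A) + countLe i (letters (suc s) B)
  count i = trans (countLe-↭ i (Φ-letters n v)) (trans (cong (countLe i) split) (countLe-++ i (letters 0 A) _))
  count-s : countLe (suc s) w ≡ s
  count-s = trans (count (suc s)) (trans (cong₂ _+_ (trans (countLe-all (All.map m≤n⇒m≤1+n (letters-below 0 gs))) (length-letters 0 (valid gs)))
    (countLe-none (letters-above (suc s) bs))) (+-identityʳ s))
  d : dW w ≡ suc s
  d = dW-found w s (subst (s ≤_) (trans total-split (sym len)) (m≤m+n s (total B)))
    (λ i i≤s → subst (i ≤_) (sym (count i)) (≤-trans (countLe-letters 0 gs i i≤s) (m≤m+n _ _))) (≤-reflexive count-s)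
  removed : decreasePairs (suc s) (assign 0 cols) ≡ assign 0 (A ++ B)
  removed = trans (cong (decreasePairs (suc s)) (trans (assign-++ 0 A (emptyCol ∷ B))
      (cong (λ k → assign 0 A ++ assign k B) (trans (+-comm (offset A) 1) (cong suc os)))))
    (trans (map-++ _ (assign 0 A) _) (trans (cong₂ _++_
      (decrease-below (suc s) (assign 0 A) (subst (All (_≤ suc s)) (sym (assign-letters 0 (valid gs))) (All.map m≤n⇒m≤1+n (letters-below 0 gs))))
      (decrease-above (suc s) s ≤-refl bs))
    (trans (cong (λ k → assign 0 A ++ assign k B) (sym os)) (sym (assign-++ 0 A B)))))
  step : decAbove (suc s) w ≡ Φ n (A ++ B)
  step = trans (sym (map-∘ (labels n))) (map-cong (λ q → trans (lookupAssoc-map (decreaseAbove (suc s)) refl q (assign 0 cols)) (cong (lookupAssoc q) removed)) (labels n))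
  valid′ : ValidBW n (A ++ B)
  valid′ = AllP.++⁺ (valid gs) bs , ↭-trans (↭-reflexive (trans (labelsOf-++ A B) (sym (labelsOf-++ A (emptyCol ∷ B))))) p
  decide : Dec (s ≡ n) → parkFuel (suc fl) w ≡ Φ n (dropEmpty cols)
  -- No label is left after `A`, so all further columns are empty: parkization stops, and removing
  -- them does not change the word.
  decide (yes s≡n) rewrite d | len | s≡n with n ≡ᵇ n in q
  ... | false = ⊥-elim (subst T q (≡⇒≡ᵇ n n refl))
  ... | true  = cong (λ X → map (λ r → lookupAssoc r X) (labels n)) (trans (assign-++ 0 A (emptyCol ∷ B))
      (trans (cong (assign 0 A ++_) (trans (proj₁ (no-labels (offset A + 1) bs B≡0)) (sym (cong (assign (offset A)) (proj₂ (no-labels 0 bs B≡0))))))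
      (trans (sym (assign-++ 0 A (dropEmpty B))) (cong (assign 0) (sym (trans (dropEmpty-++ A (emptyCol ∷ B)) (cong (_++ dropEmpty B) (dropEmpty-good gs))))))))
    where
    B≡0 : total B ≡ 0
    B≡0 = m+n≡0⇒n≡0 0 (+-cancelˡ-≡ n (total B) 0 (trans (cong (_+ total B) (sym s≡n)) (trans total-split (sym (+-identityʳ n)))))
  decide (no s≢n) rewrite d | len with s ≡ᵇ n in q
  ... | true  = ⊥-elim (s≢n (≡ᵇ⇒≡ s n (subst T (sym q) tt)))
  ... | false = trans (cong (parkFuel fl) step) (trans (parkFuel-Φ n fl valid′ (s≤s⁻¹ (≤-trans (subst (λ x → sum x < sum w) step
      (sum-decAbove-< (suc s) w (subst₂ _<_ (sym count-s) (sym len) (≤∧≢⇒< (subst (s ≤_) total-split (m≤m+n s _)) s≢n)))) le)))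
      (cong (Φ n) (trans (dropEmpty-++ A B) (sym (dropEmpty-++ A (emptyCol ∷ B))))))

Park-Φ : ∀ n {cols} → ValidBW n cols → Park (Φ n cols) ≡ Φ n (dropEmpty cols)
Park-Φ n {cols} v = parkFuel-Φ n (sum (Φ n cols)) v ≤-refl

-- The decomposition of a parking function

filter-split-↭ : ∀ {a p} {A : Set a} {P : Pred A p} (P? : Decidable P) xs → xs ↭ filter P? xs ++ filter (¬? ∘ P?) xs
filter-split-↭ P? []       = ↭-refl
filter-split-↭ P? (x ∷ xs) with P? x
... | yes _ = prep x (filter-split-↭ P? xs)
... | no  _ = ↭-trans (prep x (filter-split-↭ P? xs)) (↭-sym (PermP.shift x (filter P? xs) _))

countLe-map-proj₂ : ∀ i (X : List (ℕ × ℕ)) → length (filter (λ x → proj₂ x ≤? i) X) ≡ countLe i (map proj₂ X)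
countLe-map-proj₂ i []      = refl
countLe-map-proj₂ i (x ∷ X) with proj₂ x ≤? i
... | yes p = trans (cong length (filter-accept (λ x → proj₂ x ≤? i) p)) (trans (cong suc (countLe-map-proj₂ i X)) (sym (countLe-accept p)))
... | no ¬p = trans (cong length (filter-reject (λ x → proj₂ x ≤? i) ¬p)) (trans (countLe-map-proj₂ i X) (sym (countLe-reject ¬p)))

column : ℕ → Column → List (ℕ × ℕ)
column off (L , M) = zip L (map (λ a → a + off) M)

column-sorted : ∀ off {c} → ValidColumn c → AllPairs (λ x y → proj₁ x < proj₁ y) (column off c)
column-sorted off {L , M} (si , len , _) = AllPairsP.map⁻ (subst (AllPairs _<_) (sym (map-proj₁-zip L _ (trans (length-map (_+ off) M) len))) (increasing⇒ si))

column-below : ∀ off {c} → ValidColumn c → All (λ x → proj₂ x ≤ off + length (proj₁ c)) (column off c)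
column-below off {L , M} (_ , len , pr) = AllP.map⁻ (subst (All (_≤ off + length L)) (sym (map-proj₂-zip L _ (trans (length-map (_+ off) M) len)))
  (AllP.map⁺ (All.map (λ {a} a≤ → subst (a + off ≤_) (trans (+-comm _ off) (cong (off +_) len)) (+-monoˡ-≤ off a≤)) (prime-bounded (isPrimePF⇒prime M pr)))))

assign-above : ∀ off {cols} → All ValidColumn cols → All (λ x → off < proj₂ x) (assign off cols)
assign-above off vs = AllP.map⁻ (subst (All (off <_)) (sym (assign-letters off vs)) (letters-above off vs))

column-injective : ∀ off {L M L′ M′} → length M ≡ length L → length M′ ≡ length L′ → column off (L , M) ≡ column off (L′ , M′) → (L , M) ≡ (L′ , M′)
column-injective off {L} {M} {L′} {M′} len len′ e = cong₂ _,_
  (trans (sym (map-proj₁-zip L _ (trans (length-map (_+ off) M) len))) (trans (cong (map proj₁) e) (map-proj₁-zip L′ _ (trans (length-map (_+ off) M′) len′))))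
  (map-injective (λ {a} {b} → +-cancelʳ-≡ off a b)
    (trans (sym (map-proj₂-zip L _ (trans (length-map (_+ off) M) len))) (trans (cong (map proj₂) e) (map-proj₂-zip L′ _ (trans (length-map (_+ off) M′) len′)))))

filter-assign-head : ∀ off {c cs} → ValidColumn c → NonEmpty c → All ValidColumn cs →
  filter (λ x → proj₂ x ≤? off + length (proj₁ c)) (assign off (c ∷ cs)) ≡ column off c
filter-assign-head off {L , M} {cs} v ne vs = trans (filter-++ P? (column off (L , M)) _)
  (trans (cong₂ _++_ (filter-all P? (column-below off v)) (filter-none P? (All.map <⇒≱ (subst (λ k → All (λ x → off + k < proj₂ x) (assign (off + normL L) cs)) (normL-nonEmpty L ne) (assign-above (off + normL L) vs)))))
    (++-identityʳ _))
  where
  P? : Decidable (λ (x : ℕ × ℕ) → proj₂ x ≤ off + length L)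
  P? x = proj₂ x ≤? off + length L

filter-assign-tail : ∀ off {c cs} → ValidColumn c → NonEmpty c → All ValidColumn cs →
  filter (λ x → ¬? (proj₂ x ≤? off + length (proj₁ c))) (assign off (c ∷ cs)) ≡ assign (off + length (proj₁ c)) cs
filter-assign-tail off {L , M} {cs} v ne vs rewrite normL-nonEmpty L ne = trans (filter-++ P? (column off (L , M)) _)
  (cong₂ _++_ (filter-none P? (All.map (λ p ¬p → ¬p p) (column-below off v))) (filter-all P? (All.map <⇒≱ (assign-above (off + length L) vs))))
  where
  P? : Decidable (λ (x : ℕ × ℕ) → ¬ (proj₂ x ≤ off + length L))
  P? x = ¬? (proj₂ x ≤? off + length L)

-- The first column of a good sequence has the size of the first breakpoint of its letters.
first-size-≤ : ∀ off {c cs c′ cs′} → Good (c ∷ cs) → Good (c′ ∷ cs′) → assign off (c ∷ cs) ↭ assign off (c′ ∷ cs′) →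
  length (proj₁ c′) ≤ length (proj₁ c)
first-size-≤ off {L , M} {cs} {L′ , M′} {cs′} g@((v , ne) ∷ gs) g′@((v′ , ne′) ∷ gs′) p with length L′ ≤? length L
... | yes le = le
... | no ¬le = ⊥-elim (<-irrefl (sym count) (proj₂ (isPrimePF⇒prime M′ (proj₂ (proj₂ v′))) (length L) ne (subst (length L <_) (sym (proj₁ (proj₂ v′))) (≰⇒> ¬le))))
  where
  count : countLe (length L) M′ ≡ length L
  count = begin
    countLe (length L) M′
      ≡⟨ countLe-column-head off L′ M′ v′ ne′ (valid gs′) (length L) (<⇒≤ (≰⇒> ¬le)) ⟨
    countLe (off + length L) (letters off ((L′ , M′) ∷ cs′))
      ≡⟨ countLe-↭ (off + length L) (↭-trans (↭-reflexive (sym (assign-letters off (valid g′)))) (↭-trans (PermP.map⁺ proj₂ (↭-sym p)) (↭-reflexive (assign-letters off (valid g))))) ⟩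
    countLe (off + length L) (letters off ((L , M) ∷ cs))
      ≡⟨ countLe-column-head off L M v ne (valid gs) (length L) ≤-refl ⟩
    countLe (length L) M
      ≡⟨ countLe-prime-≥ (isPrimePF⇒prime M (proj₂ (proj₂ v))) (≤-reflexive (proj₁ (proj₂ v))) ⟩
    length M
      ≡⟨ proj₁ (proj₂ v) ⟩
    length L ∎
    where open ≡-Reasoning

assign-nonEmpty : ∀ off {c cs} → Good (c ∷ cs) → ¬ (assign off (c ∷ cs) ↭ [])
assign-nonEmpty off {c} {cs} g@((_ , ne) ∷ _) p = <⇒≱ ne (≤-trans (m≤m+n (length (proj₁ c)) (length (labelsOf cs)))
  (≤-reflexive (trans (sym (length-++ (proj₁ c))) (trans (cong length (sym (assign-keys off (valid g)))) (PermP.↭-length (PermP.map⁺ proj₁ p))))))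

-- The size of the first column is determined by the letters, and the column consists of the pairs
-- with values up to that size. Sorting by labels recovers it exactly, and the other pairs belong to
-- the rest.
assign-injective : ∀ off {cols cols′} → Good cols → Good cols′ → assign off cols ↭ assign off cols′ → cols ≡ cols′
assign-injective off {[]} {[]} _ _ _ = refl
assign-injective off {[]} {c ∷ cs} _ g p = ⊥-elim (assign-nonEmpty off g (↭-sym p))
assign-injective off {c ∷ cs} {[]} g _ p = ⊥-elim (assign-nonEmpty off g p)
assign-injective off {c@(L , M) ∷ cs} {c′@(L′ , M′) ∷ cs′} g@((v , ne) ∷ gs) g′@((v′ , ne′) ∷ gs′) p = cong₂ _∷_
  (column-injective off (proj₁ (proj₂ v)) (proj₁ (proj₂ v′)) (sorted-↭⇒≡ proj₁ (column-sorted off v) (column-sorted off v′) heads))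
  (assign-injective (off + length L) gs gs′ remaining)
  where
  size : length L ≡ length L′
  size = ≤-antisym (first-size-≤ off g′ g (↭-sym p)) (first-size-≤ off g g′ p)
  heads : column off c ↭ column off c′
  heads = ↭-trans (↭-reflexive (sym (filter-assign-head off v ne (valid gs)))) (↭-trans (PermP.filter-↭ (λ x → proj₂ x ≤? off + length L) p)
    (↭-reflexive (trans (cong (λ k → filter (λ x → proj₂ x ≤? off + k) (assign off (c′ ∷ cs′))) size) (filter-assign-head off v′ ne′ (valid gs′)))))
  remaining : assign (off + length L) cs ↭ assign (off + length L) cs′
  remaining = ↭-trans (↭-reflexive (sym (filter-assign-tail off v ne (valid gs)))) (↭-trans (PermP.filter-↭ (λ x → ¬? (proj₂ x ≤? off + length L)) p)
    (↭-reflexive (trans (cong (λ k → filter (λ x → ¬? (proj₂ x ≤? off + k)) (assign off (c′ ∷ cs′))) size)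
      (trans (filter-assign-tail off v′ ne′ (valid gs′)) (cong (λ k → assign (off + k) cs′) (sym size))))))

Φ-injective : ∀ n {cols cols′} → Good cols → Good cols′ → labelsOf cols ↭ labels n → labelsOf cols′ ↭ labels n → Φ n cols ≡ Φ n cols′ → cols ≡ cols′
Φ-injective n {cols} {cols′} g g′ p p′ e = assign-injective 0 g g′
  (↭-trans (↭-sym (Φ-assign n (valid g , p))) (↭-trans (↭-reflexive (cong (zip (labels n)) e)) (Φ-assign n (valid g′ , p′))))

firstFixed : ∀ (c : ℕ → ℕ) fl k → c (k + fl) ≡ k + fl → (∀ i → 1 ≤ i → i < k → c i ≢ i) →
  Σ ℕ λ a → k ≤ a × a ≤ k + fl × c a ≡ a × (∀ i → 1 ≤ i → i < a → c i ≢ i)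
firstFixed c fl k e lo with c k ≟ k
... | yes ck = k , ≤-refl , m≤m+n k fl , ck , lo
firstFixed c zero     k e lo | no ¬ck = ⊥-elim (¬ck (subst (λ j → c j ≡ j) (+-identityʳ k) e))
firstFixed c (suc fl) k e lo | no ¬ck with firstFixed c fl (suc k) (subst (λ j → c j ≡ j) (+-suc k fl) e) lo′
  where
  lo′ : ∀ i → 1 ≤ i → i < suc k → c i ≢ i
  lo′ i 1≤i i<1+k with i ≟ k
  ... | yes refl = ¬ck
  ... | no i≢k   = lo i 1≤i (≤∧≢⇒< (s≤s⁻¹ i<1+k) i≢k)
... | a , k<a , a≤ , ca , lo″ = a , <⇒≤ k<a , subst (a ≤_) (sym (+-suc k fl)) a≤ , ca , lo″

countLe-filter : ∀ {b} i (X : List (ℕ × ℕ)) → i ≤ b → countLe i (map proj₂ (filter (λ x → proj₂ x ≤? b) X)) ≡ countLe i (map proj₂ X)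
countLe-filter {b} i []      le = refl
countLe-filter {b} i (x ∷ X) le with proj₂ x ≤? b | proj₂ x ≤? i
... | yes p | yes q = trans (cong (countLe i ∘ map proj₂) (filter-accept (λ x → proj₂ x ≤? b) p))
                        (trans (countLe-accept q) (trans (cong suc (countLe-filter i X le)) (sym (countLe-accept q))))
... | yes p | no ¬q = trans (cong (countLe i ∘ map proj₂) (filter-accept (λ x → proj₂ x ≤? b) p))
                        (trans (countLe-reject ¬q) (trans (countLe-filter i X le) (sym (countLe-reject ¬q))))
... | no ¬p | yes q = ⊥-elim (¬p (≤-trans q le))
... | no ¬p | no ¬q = trans (cong (countLe i ∘ map proj₂) (filter-reject (λ x → proj₂ x ≤? b) ¬p)) (trans (countLe-filter i X le) (sym (countLe-reject ¬q)))

-- The cut is made at the least a ≥ 1 such that exactly a letters are at most off + a. Minimality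
-- makes the part below the cut prime, and exactness leaves a remainder that again satisfies the
-- parking condition.
decompose : ∀ N off X → length X ≤ N → AllPairs (λ x y → proj₁ x < proj₁ y) X → All (λ x → off < proj₂ x) X →
  (∀ i → i ≤ length X → i ≤ countLe (off + i) (map proj₂ X)) → Σ (List Column) λ cols → Good cols × assign off cols ↭ X
decompose N       off []         _  _      _     _    = [] , [] , ↭-refl
decompose (suc N) off X@(x ∷ X₀) le sorted above park = (L , M) ∷ proj₁ rest , (validLM , nonEmpty) ∷ proj₁ (proj₂ rest) ,
  ↭-trans (↭-reflexive (cong₂ _++_ column≡Y (cong (λ k → assign (off + k) (proj₁ rest)) (trans (normL-nonEmpty L nonEmpty) lenL))))
    (↭-trans (PermP.++⁺ˡ Y (proj₂ (proj₂ rest))) (↭-sym (filter-split-↭ P? X)))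
  where
  n : ℕ
  n = length X
  c : ℕ → ℕ
  c i = countLe (off + i) (map proj₂ X)
  fixed : Σ ℕ λ a → 1 ≤ a × a ≤ n × c a ≡ a × (∀ i → 1 ≤ i → i < a → c i ≢ i)
  -- The search ends at n at the latest: `c n` is at least n by the parking condition and cannot
  -- exceed the number of letters.
  fixed = firstFixed c (length X₀) 1
    (≤-antisym (≤-trans (countLe-≤length (off + n) (map proj₂ X)) (≤-reflexive (length-map proj₂ X))) (park n ≤-refl)) (λ i 1≤i i<1 → ⊥-elim (<⇒≱ i<1 1≤i))
  a : ℕ
  a = proj₁ fixed
  1≤a : 1 ≤ a
  1≤a = proj₁ (proj₂ fixed)
  a≤n : a ≤ n
  a≤n = proj₁ (proj₂ (proj₂ fixed))
  ca≡a : c a ≡ a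
  ca≡a = proj₁ (proj₂ (proj₂ (proj₂ fixed)))
  P? : Decidable (λ (x : ℕ × ℕ) → proj₂ x ≤ off + a)
  P? x = proj₂ x ≤? off + a
  Y X′ : List (ℕ × ℕ)
  Y  = filter P? X
  X′ = filter (¬? ∘ P?) X
  lenY : length Y ≡ a
  lenY = trans (countLe-map-proj₂ (off + a) X) ca≡a
  L M : List ℕ
  L = map proj₁ Y
  M = map (λ x → proj₂ x ∸ off) Y
  lenL : length L ≡ a
  lenL = trans (length-map proj₁ Y) lenY
  lenM : length M ≡ a
  lenM = trans (length-map _ Y) lenY
  nonEmpty : 1 ≤ length L
  nonEmpty = subst (1 ≤_) (sym lenL) 1≤a
  aboveY : All (λ x → off < proj₂ x) Y
  aboveY = AllP.filter⁺ P? above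
  shifted : map (λ a → a + off) M ≡ map proj₂ Y
  shifted = trans (sym (map-∘ Y)) (map-cong-local (All.map (λ lt → m∸n+n≡m (<⇒≤ lt)) aboveY))
  column≡Y : column off (L , M) ≡ Y
  column≡Y = trans (cong (zip L) shifted) (zip-projections Y)
    where
    zip-projections : ∀ (Z : List (ℕ × ℕ)) → zip (map proj₁ Z) (map proj₂ Z) ≡ Z
    zip-projections []      = refl
    zip-projections (z ∷ Z) = cong (z ∷_) (zip-projections Z)
  countM : ∀ i → i ≤ a → countLe i M ≡ c i
  countM i i≤a = trans (sym (countLe-shift off i M)) (trans (cong (countLe (off + i)) shifted) (countLe-filter (off + i) X (+-monoʳ-≤ off i≤a)))
  primeM : IsPrime M
  primeM = (AllP.map⁺ (All.map m<n⇒0<n∸m aboveY) ,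
      λ i i≤ → let i≤a = subst (i ≤_) lenM i≤ in subst (i ≤_) (sym (countM i i≤a)) (park i (≤-trans i≤a a≤n))) ,
    λ i 1≤i i< → let i<a = subst (i <_) lenM i< in subst (i <_) (sym (countM i (<⇒≤ i<a)))
      (≤∧≢⇒< (park i (≤-trans (<⇒≤ i<a) a≤n)) (λ e → proj₂ (proj₂ (proj₂ (proj₂ fixed))) i 1≤i i<a (sym e)))
  validLM : ValidColumn (L , M)
  validLM = ⇒increasing (AllPairsP.map⁺ (AllPairsP.filter⁺ P? sorted)) , trans lenM (sym lenL) , prime⇒isPrimePF M primeM
  lenX : a + length X′ ≡ n
  lenX = trans (cong (_+ length X′) (sym lenY)) (trans (sym (length-++ Y)) (PermP.↭-length (↭-sym (filter-split-↭ P? X))))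
  park′ : ∀ i → i ≤ length X′ → i ≤ countLe (off + a + i) (map proj₂ X′)
  park′ i i≤ = +-cancelˡ-≤ a i _ (begin
    a + i
      ≤⟨ park (a + i) (≤-trans (+-monoʳ-≤ a i≤) (≤-reflexive lenX)) ⟩
    countLe (off + (a + i)) (map proj₂ X)
      ≡⟨ cong (λ k → countLe k (map proj₂ X)) (sym (+-assoc off a i)) ⟩
    countLe (off + a + i) (map proj₂ X)
      ≡⟨ countLe-↭ (off + a + i) (↭-trans (PermP.map⁺ proj₂ (filter-split-↭ P? X)) (↭-reflexive (map-++ proj₂ Y X′))) ⟩
    countLe (off + a + i) (map proj₂ Y ++ map proj₂ X′)
      ≡⟨ countLe-++ (off + a + i) (map proj₂ Y) _ ⟩
    countLe (off + a + i) (map proj₂ Y) + countLe (off + a + i) (map proj₂ X′)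
      ≤⟨ +-monoˡ-≤ _ (≤-trans (countLe-≤length (off + a + i) (map proj₂ Y)) (≤-reflexive (trans (length-map proj₂ Y) lenY))) ⟩
    a + countLe (off + a + i) (map proj₂ X′) ∎)
    where open ≤-Reasoning
  rest : Σ (List Column) λ cols → Good cols × assign (off + a) cols ↭ X′
  rest = decompose N (off + a) X′ (s≤s⁻¹ (≤-trans (≤-trans (+-monoˡ-≤ (length X′) 1≤a) (≤-reflexive lenX)) le))
    (AllPairsP.filter⁺ (¬? ∘ P?) sorted) (All.map ≰⇒> (AllP.all-filter (¬? ∘ P?) X)) park′

zip-labels-sorted : ∀ n (u : Word) → length u ≡ n → AllPairs (λ x y → proj₁ x < proj₁ y) (zip (labels n) u)
zip-labels-sorted n u len = AllPairsP.map⁻ (subst (AllPairs _<_) (sym (map-proj₁-zip (labels n) u (trans len (sym (length-labels n))))) (labels-increasing n))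

Φ-surjective : ∀ n u → length u ≡ n → IsParking u → Σ (List Column) λ cols → Good cols × (labelsOf cols ↭ labels n) × (Φ n cols ≡ u)
Φ-surjective n u len (pos , park) = cols , g , perm , trans (sym (map-proj₂-zip (labels n) (Φ n cols) (trans (length-Φ n cols) (sym (length-labels n)))))
    (trans (cong (map proj₂) (sorted-↭⇒≡ proj₁ (zip-labels-sorted n (Φ n cols) (length-Φ n cols)) (zip-labels-sorted n u len)
      (↭-trans (Φ-assign n (valid g , perm)) p))) letters≡u)
  where
  lenu : length u ≡ length (labels n)
  lenu = trans len (sym (length-labels n))
  X : List (ℕ × ℕ)
  X = zip (labels n) u
  letters≡u : map proj₂ X ≡ u
  letters≡u = map-proj₂-zip (labels n) u lenu
  lenX : length X ≡ length u
  lenX = trans (sym (length-map proj₂ X)) (cong length letters≡u)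
  dec : Σ (List Column) λ cols → Good cols × assign 0 cols ↭ X
  dec = decompose (length X) 0 X ≤-refl (zip-labels-sorted n u len) (AllP.map⁻ (subst (All (0 <_)) (sym letters≡u) pos))
    (λ i i≤ → subst (λ w → i ≤ countLe i w) (sym letters≡u) (park i (subst (i ≤_) lenX i≤)))
  cols : List Column
  cols = proj₁ dec
  g : Good cols
  g = proj₁ (proj₂ dec)
  p : assign 0 cols ↭ X
  p = proj₂ (proj₂ dec)
  perm : labelsOf cols ↭ labels n
  perm = ↭-trans (↭-reflexive (sym (assign-keys 0 (valid g)))) (↭-trans (PermP.map⁺ proj₁ p) (↭-reflexive (map-proj₁-zip (labels n) u lenu)))

-- Orbits

splits : List ℕ → List (List ℕ × List ℕ)
splits []      = ([] , []) ∷ []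
splits (x ∷ V) = map (λ s → x ∷ proj₁ s , proj₂ s) (splits V) ++ map (λ s → proj₁ s , x ∷ proj₂ s) (splits V)

sum-splits : ∀ V (h : ℕ → ℕ → ℕ) → sumOver (splits V) (λ s → h (length (proj₁ s)) (length (proj₂ s))) ≡ binom (length V) h
sum-splits []      h = +-identityʳ _
sum-splits (x ∷ V) h = trans (sumOver-++ (map _ (splits V)) (map _ (splits V)) _) (cong₂ _+_
  (trans (sumOver-map _ (splits V) _) (sum-splits V (λ i j → h (suc i) j)))
  (trans (sumOver-map _ (splits V) _) (sum-splits V (λ i j → h i (suc j)))))

IsSplit : List ℕ → List ℕ × List ℕ → Set
IsSplit V (S , S′) = (S ++ S′ ↭ V) × AllPairs _<_ S × AllPairs _<_ S′

All-split : ∀ {P : ℕ → Set} {V} S {S′} → S ++ S′ ↭ V → All P V → All P S × All P S′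
All-split S p ps = AllP.++⁻ S (PermP.All-resp-↭ (↭-sym p) ps)

splits-sound : ∀ V → AllPairs _<_ V → All (IsSplit V) (splits V)
splits-sound []      []       = (↭-refl , [] , []) ∷ []
splits-sound (x ∷ V) (q ∷ qs) = AllP.++⁺
  (AllP.map⁺ (All.map (λ { {S , S′} (p , sS , sS′) → prep x p , proj₁ (All-split S p q) ∷ sS , sS′ }) (splits-sound V qs)))
  (AllP.map⁺ (All.map (λ { {S , S′} (p , sS , sS′) → ↭-trans (PermP.shift x S S′) (prep x p) , sS , proj₂ (All-split S p q) ∷ sS′ }) (splits-sound V qs)))

splits-distinct : ∀ V → AllPairs _<_ V → AllPairs (λ s s′ → proj₁ s ≢ proj₁ s′) (splits V)
splits-distinct []      []       = [] ∷ []
splits-distinct (x ∷ V) (q ∷ qs) = AllPairsP.++⁺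
  (AllPairsP.map⁺ (AllPairs.map (λ ne e → ne (∷-injectiveʳ e)) (splits-distinct V qs)))
  (AllPairsP.map⁺ (splits-distinct V qs))
  (AllP.map⁺ (All.universal (λ s → AllP.map⁺ (All.map (λ { {S , S′} (p , _) e → absent S (proj₁ (All-split S p q)) e }) (splits-sound V qs))) (splits V)))
  where
  absent : ∀ S {T} → All (x <_) S → ¬ (x ∷ T ≡ S)
  absent (_ ∷ _) (x<x ∷ _) refl = <-irrefl refl x<x

-- Only S is prescribed as a list; the complement is listed in increasing order and hence agrees
-- with R up to permutation.
splits-complete : ∀ V S R → AllPairs _<_ V → AllPairs _<_ S → S ++ R ↭ V → Σ (List ℕ) λ S′ → (S , S′) ∈ splits V × S′ ↭ R
splits-complete []      []      R _        _  p = [] , here refl , ↭-sym p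
splits-complete []      (s ∷ S) R _        _  p = ⊥-elim (PermP.¬x∷xs↭[] p)
splits-complete (y ∷ V) S       R (q ∷ qs) sS p with PermP.∈-resp-↭ (↭-sym p) (here refl)
... | y∈ with ∈-++⁻ S y∈
splits-complete (y ∷ V) (s ∷ S) R (q ∷ qs) (_ ∷ sS) p | y∈ | inj₁ (here refl) with splits-complete V S R qs sS (PermP.drop-∷ p)
... | S′ , m , r = S′ , ∈-++⁺ˡ (∈-map⁺ _ m) , r
splits-complete (y ∷ V) (s ∷ S) R (q ∷ qs) (lt ∷ sS) p | y∈ | inj₁ (there y∈S) with PermP.∈-resp-↭ p (here refl)
... | here refl = ⊥-elim (<-irrefl refl (All.lookup lt y∈S))
... | there s∈V = ⊥-elim (<-asym (All.lookup lt y∈S) (All.lookup q s∈V))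
splits-complete (y ∷ V) S R (q ∷ qs) sS p | y∈ | inj₂ y∈R with ∈-∃++ y∈R
... | R₁ , R₂ , refl with splits-complete V S (R₁ ++ R₂) qs sS (PermP.drop-∷ (↭-trans (↭-sym move) p))
  where
  move : S ++ R₁ ++ y ∷ R₂ ↭ y ∷ S ++ R₁ ++ R₂
  move = ↭-trans (PermP.++⁺ˡ S (PermP.shift y R₁ R₂)) (PermP.shift y S (R₁ ++ R₂))
... | S′ , m , r = y ∷ S′ , ∈-++⁺ʳ (map (λ s → y ∷ proj₁ s , proj₂ s) (splits V)) (∈-map⁺ _ m) , ↭-trans (prep y r) (↭-sym (PermP.shift y R₁ R₂))

tuples-unique : ∀ {A : Set} {X : List A} → Unique X → ∀ r → Unique (tuples X r)
tuples-unique         u zero    = [] ∷ []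
tuples-unique {X = X} u (suc r) = AllPairsP.concat⁺
  (AllP.map⁺ (All.universal (λ w → UniqueP.map⁺ ∷-injectiveˡ u) (tuples X r)))
  (AllPairsP.map⁺ (AllPairs.map (λ ne → AllP.map⁺ (All.universal (λ x → AllP.map⁺ (All.universal (λ y e → ne (∷-injectiveʳ e)) X)) X)) (tuples-unique u r)))

∈-tuples : ∀ {A : Set} {X : List A} {w} → All (_∈ X) w → w ∈ tuples X (length w)
∈-tuples []       = here refl
∈-tuples (p ∷ ps) = ∈-concatMap⁺ _ (lose (∈-tuples ps) (∈-map⁺ _ p))

primeWords-unique : ∀ m → Unique (primeWords m)
primeWords-unique m = UniqueP.filter⁺ (λ w → T? (isPrimePF w)) (tuples-unique (labels-unique m) m)

primeWords-sound : ∀ m → All (λ M → length M ≡ m × T (isPrimePF M)) (primeWords m)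
primeWords-sound m = All.zip (AllP.filter⁺ (λ w → T? (isPrimePF w)) (All.map proj₁ (All-tuples {P = λ _ → ⊤} (All.universal _ (labels m)) m)) ,
  AllP.all-filter (λ w → T? (isPrimePF w)) (tuples (labels m) m))

primeWords-complete : ∀ {M} → T (isPrimePF M) → M ∈ primeWords (length M)
primeWords-complete {M} pr = ∈-filter⁺ (λ w → T? (isPrimePF w)) (∈-tuples (All.zipWith (λ { (1≤a , a≤) → ∈-labels 1≤a a≤ })
  (proj₁ (proj₁ prime) , prime-bounded prime))) pr
  where
  prime : IsPrime M
  prime = isPrimePF⇒prime M pr

-- One representative of each orbit of good column sequences with label set V,
-- the columns ordered by their least labels (f ≥ |V| is fuel).
orbits : ℕ → List ℕ → List (List Column)
orbits f       []      = [] ∷ []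
orbits zero    (x ∷ V) = []
orbits (suc f) (x ∷ V) = concatMap (λ s → concatMap (λ M → map ((x ∷ proj₁ s , M) ∷_) (orbits f (proj₂ s)))
  (primeWords (suc (length (proj₁ s))))) (splits V)

-- The column of the least label is given by the i other labels in it and a prime word of length i +
-- 1; the remaining labels carry an orbit of their own. This is the recursion `chains-suc`.
length-orbits : ∀ f V → length V ≤ f → AllPairs _<_ V → length (orbits f V) ≡ chains (length V)
length-orbits f       []      _        _        = refl
length-orbits (suc f) (x ∷ V) (s≤s le) (q ∷ qs) = begin
  length (orbits (suc f) (x ∷ V))
    ≡⟨ length-concatMap-sum _ (splits V) ⟩
  sumOver (splits V) (λ s → length (concatMap (λ M → map ((x ∷ proj₁ s , M) ∷_) (orbits f (proj₂ s))) (primeWords (suc (length (proj₁ s))))))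
    ≡⟨ sumOver-cong-All (All.map (λ { {S , S′} sp → block S S′ sp }) (splits-sound V qs)) ⟩
  sumOver (splits V) (λ s → primes (suc (length (proj₁ s))) * chains (length (proj₂ s)))
    ≡⟨ sum-splits V (λ i j → primes (suc i) * chains j) ⟩
  binom (length V) (λ i j → primes (suc i) * chains j)
    ≡⟨ chains-suc (length V) ⟨
  chains (suc (length V)) ∎
  where
  open ≡-Reasoning
  sumOver-const : ∀ {A : Set} (xs : List A) c → sumOver xs (λ _ → c) ≡ length xs * c
  sumOver-const []       c = refl
  sumOver-const (_ ∷ xs) c = cong (c +_) (sumOver-const xs c)
  block : ∀ S S′ → IsSplit V (S , S′) → length (concatMap (λ M → map ((x ∷ S , M) ∷_) (orbits f S′)) (primeWords (suc (length S)))) ≡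
    primes (suc (length S)) * chains (length S′)
  block S S′ (p , _ , sS′) = trans (length-concatMap-sum _ W) (trans (sumOver-cong W (λ M → trans (length-map _ (orbits f S′))
      (length-orbits f S′ (≤-trans (≤-trans (m≤n+m (length S′) (length S)) (≤-reflexive (trans (sym (length-++ S)) (PermP.↭-length p)))) le) sS′)))
    (trans (sumOver-const W (chains (length S′))) (cong (_* chains (length S′)) (length-primeWords (length S)))))
    where
    W : List Word
    W = primeWords (suc (length S))

IsOrbit : List ℕ → List Column → Set
IsOrbit V c = Good c × (labelsOf c ↭ V)

orbits-sound : ∀ f V → AllPairs _<_ V → All (IsOrbit V) (orbits f V)
orbits-sound f       []      _        = ([] , ↭-refl) ∷ []
orbits-sound zero    (x ∷ V) _        = []
orbits-sound (suc f) (x ∷ V) (q ∷ qs) = AllP.concat⁺ (AllP.map⁺ (All.map (λ { {S , S′} (p , sS , sS′) →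
  AllP.concat⁺ (AllP.map⁺ (All.map (λ { {M} (len , pr) → AllP.map⁺ (All.map (λ { {c} (g , pc) →
    ((⇒increasing (proj₁ (All-split S p q) ∷ sS) , len , pr) , s≤s z≤n) ∷ g , prep x (↭-trans (PermP.++⁺ˡ S pc) p) })
    (orbits-sound f S′ sS′)) }) (primeWords-sound (suc (length S))))) }) (splits-sound V qs)))

∈-labelsOf : ∀ {x c cols} → c ∈ cols → x ∈ proj₁ c → x ∈ labelsOf cols
∈-labelsOf {cols = c ∷ cols} (here refl) x∈ = ∈-++⁺ˡ x∈
∈-labelsOf {cols = c ∷ cols} (there c∈)  x∈ = ∈-++⁺ʳ (proj₁ c) (∈-labelsOf c∈ x∈)

-- Since x is smaller than every label of r₂, the column containing x can only be matched with the
-- head.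
head-unique : ∀ {x S M r S₂ M₂ r₂} → All (x <_) (labelsOf r₂) → (x ∷ S , M) ∷ r ↭ (x ∷ S₂ , M₂) ∷ r₂ → (x ∷ S , M) ≡ (x ∷ S₂ , M₂)
head-unique above p with PermP.∈-resp-↭ p (here refl)
... | here e   = e
... | there c∈ = ⊥-elim (<-irrefl refl (All.lookup above (∈-labelsOf c∈ (here refl))))

orbits-distinct : ∀ f V → AllPairs _<_ V → AllPairs (λ c c′ → ¬ (c ↭ c′)) (orbits f V)
orbits-distinct f       []      _        = [] ∷ []
orbits-distinct zero    (x ∷ V) _        = []
orbits-distinct (suc f) (x ∷ V) (q ∷ qs) = AllPairsP.concat⁺
  (AllP.map⁺ (All.map (λ { {S , S′} sp → sameSplit S S′ sp }) (splits-sound V qs)))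
  (AllPairsP.map⁺ (pairs (splits-sound V qs) (splits-distinct V qs)))
  where
  above : ∀ S S′ → IsSplit V (S , S′) → All (λ r → All (x <_) (labelsOf r)) (orbits f S′)
  above S S′ (p , _ , sS′) = All.map (λ { (_ , pr) → PermP.All-resp-↭ (↭-sym pr) (proj₂ (All-split S p q)) }) (orbits-sound f S′ sS′)
  F : List ℕ × List ℕ → List (List Column)
  F s = concatMap (λ M → map ((x ∷ proj₁ s , M) ∷_) (orbits f (proj₂ s))) (primeWords (suc (length (proj₁ s))))
  sameSplit : ∀ S S′ → IsSplit V (S , S′) → AllPairs (λ c c′ → ¬ (c ↭ c′)) (F (S , S′))
  sameSplit S S′ sp = AllPairsP.concat⁺
    (AllP.map⁺ (All.universal (λ M → AllPairsP.map⁺ (AllPairs.map (λ ne p → ne (PermP.drop-∷ p)) (orbits-distinct f S′ (proj₂ (proj₂ sp))))) W))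
    (AllPairsP.map⁺ (AllPairs.map (λ ne → AllP.map⁺ (All.universal (λ r → AllP.map⁺ (All.map (λ ab p → ne (cong proj₂ (head-unique ab p)))
      (above S S′ sp))) (orbits f S′))) (primeWords-unique (suc (length S)))))
    where
    W : List Word
    W = primeWords (suc (length S))
  cross : ∀ {s s′} → IsSplit V s → IsSplit V s′ → proj₁ s ≢ proj₁ s′ → All (λ c → All (λ c′ → ¬ (c ↭ c′)) (F s′)) (F s)
  cross {S , S′} {S₂ , S₂′} sp sp′ ne = AllP.concat⁺ (AllP.map⁺ (All.universal (λ M → AllP.map⁺ (All.universal (λ r →
    AllP.concat⁺ (AllP.map⁺ (All.universal (λ M₂ → AllP.map⁺ (All.map (λ ab p → ne (∷-injectiveʳ (cong proj₁ (head-unique ab p))))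
      (above S₂ S₂′ sp′))) (primeWords (suc (length S₂)))))) (orbits f S′))) (primeWords (suc (length S)))))
  pairs : ∀ {ss} → All (IsSplit V) ss → AllPairs (λ s s′ → proj₁ s ≢ proj₁ s′) ss → AllPairs (λ s s′ → All (λ c → All (λ c′ → ¬ (c ↭ c′)) (F s′)) (F s)) ss
  pairs []         []         = []
  pairs (sp ∷ sps) (ne ∷ nes) = All.zipWith (λ { (sp′ , n) → cross sp sp′ n }) (sps , ne) ∷ pairs sps nes

labelsOf-↭ : ∀ {c c′} → c ↭ c′ → labelsOf c ↭ labelsOf c′
labelsOf-↭ Perm.refl         = ↭-refl
labelsOf-↭ (prep x p)        = PermP.++⁺ˡ (proj₁ x) (labelsOf-↭ p)
labelsOf-↭ (Perm.swap x y p) = ↭-trans (PermP.shifts (proj₁ x) (proj₁ y)) (PermP.++⁺ˡ (proj₁ y) (PermP.++⁺ˡ (proj₁ x) (labelsOf-↭ p)))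
labelsOf-↭ (Perm.trans p q)  = ↭-trans (labelsOf-↭ p) (labelsOf-↭ q)

least-head : ∀ {x L} → StrictlyIncreasing L → x ∈ L → All (x ≤_) L → Σ (List ℕ) λ S → L ≡ x ∷ S
least-head {L = y ∷ L} si (here refl) _         = L , refl
least-head {L = y ∷ L} si (there x∈)  (x≤y ∷ _) with increasing⇒ si
... | q ∷ _ = ⊥-elim (<⇒≱ (All.lookup q x∈) x≤y)

extract : ∀ {x V cols} → AllPairs _<_ (x ∷ V) → Good cols → labelsOf cols ↭ x ∷ V →
  Σ (List ℕ) λ S → Σ Word λ M → Σ (List Column) λ r → (x ∷ S , M) ∷ r ↭ cols
extract {x} {V} {cols} (q ∷ _) g p with ∈-concat⁻′ (map proj₁ cols) (PermP.∈-resp-↭ (↭-sym p) (here refl))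
... | L , x∈L , L∈ with ∈-map⁻ proj₁ L∈
... | (_ , M) , c∈ , refl with least-head (proj₁ (proj₁ (All.lookup g c∈))) x∈L
        (All.tabulate (λ y∈ → All.lookup (≤-refl ∷ All.map <⇒≤ q) (PermP.∈-resp-↭ p (∈-labelsOf c∈ y∈)))) | ∈-∃++ c∈
... | S , refl | cs₁ , cs₂ , refl = S , M , cs₁ ++ cs₂ , ↭-sym (PermP.shift (x ∷ S , M) cs₁ cs₂)

orbits-complete : ∀ f V cols → length V ≤ f → AllPairs _<_ V → Good cols → labelsOf cols ↭ V → Σ (List Column) λ c → c ∈ orbits f V × c ↭ cols
orbits-complete f       []      []                   le _        _              p = [] , here refl , ↭-refl
orbits-complete f       []      ((x ∷ L , M) ∷ cols) le _        _              p = ⊥-elim (PermP.¬x∷xs↭[] p)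
orbits-complete f       []      (([] , M) ∷ cols)    le _        ((_ , ()) ∷ _) p
orbits-complete (suc f) (x ∷ V) cols (s≤s le) sV@(q ∷ qs) g p with extract sV g p
... | S , M , r , e with PermP.All-resp-↭ (↭-sym e) g
... | ((si , len , pr) , _) ∷ gr with splits-complete V S (labelsOf r) qs (AllPairs.tail (increasing⇒ si)) (PermP.drop-∷ (↭-trans (labelsOf-↭ e) p))
... | S′ , m , S′↭ with orbits-complete f S′ r (≤-trans (shorter (All.lookup (splits-sound V qs) m)) le) (proj₂ (proj₂ (All.lookup (splits-sound V qs) m))) gr (↭-sym S′↭)
  where
  shorter : IsSplit V (S , S′) → length S′ ≤ length V
  shorter (p , _) = ≤-trans (m≤n+m (length S′) (length S)) (≤-reflexive (trans (sym (length-++ S)) (PermP.↭-length p)))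
... | c , c∈ , c↭ = (x ∷ S , M) ∷ c , ∈-concatMap⁺ _ (lose m (∈-concatMap⁺ _ (lose (subst (λ k → M ∈ primeWords k) len (primeWords-complete pr)) (∈-map⁺ _ c∈)))) ,
    ↭-trans (prep _ c↭) e

distinct-lookup : ∀ {a r} {A : Set a} {R : A → A → Set r} → (∀ {x y} → R x y → R y x) →
  ∀ {xs} → AllPairs (λ x y → ¬ R x y) xs → ∀ i j → R (lookup xs i) (lookup xs j) → i ≡ j
distinct-lookup R-sym {x ∷ xs} (q ∷ qs) Fin.zero    Fin.zero    r = refl
distinct-lookup R-sym {x ∷ xs} (q ∷ qs) Fin.zero    (Fin.suc j) r = ⊥-elim (All.lookup q (∈-lookup j) r)
distinct-lookup R-sym {x ∷ xs} (q ∷ qs) (Fin.suc i) Fin.zero    r = ⊥-elim (All.lookup q (∈-lookup i) (R-sym r))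
distinct-lookup R-sym {x ∷ xs} (q ∷ qs) (Fin.suc i) (Fin.suc j) r = cong Fin.suc (distinct-lookup R-sym qs i j r)

dropEmpty-swapCols : ∀ k cols → dropEmpty (swapCols k cols) ↭ dropEmpty cols
dropEmpty-swapCols zero    []                                  = ↭-refl
dropEmpty-swapCols zero    (a ∷ [])                            = ↭-refl
dropEmpty-swapCols zero    (([] , _) ∷ ([] , _) ∷ cs)          = ↭-refl
dropEmpty-swapCols zero    (([] , _) ∷ (_ ∷ _ , _) ∷ cs)       = ↭-refl
dropEmpty-swapCols zero    ((_ ∷ _ , _) ∷ ([] , _) ∷ cs)       = ↭-refl
dropEmpty-swapCols zero    (a@(_ ∷ _ , _) ∷ b@(_ ∷ _ , _) ∷ cs) = Perm.swap b a ↭-refl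
dropEmpty-swapCols (suc k) []                                  = ↭-refl
dropEmpty-swapCols (suc k) (([] , _) ∷ cs)                     = dropEmpty-swapCols k cs
dropEmpty-swapCols (suc k) (c@(_ ∷ _ , _) ∷ cs)                = prep c (dropEmpty-swapCols k cs)

valid-swapCols : ∀ k {cols} → All ValidColumn cols → All ValidColumn (swapCols k cols)
valid-swapCols zero    []           = []
valid-swapCols zero    (v ∷ [])     = (si-[] , refl , tt) ∷ v ∷ []
valid-swapCols zero    (v ∷ u ∷ vs) = u ∷ v ∷ vs
valid-swapCols (suc k) []           = []
valid-swapCols (suc k) (v ∷ vs)     = v ∷ valid-swapCols k vs

validBW-swapCols : ∀ n k {cols} → ValidBW n cols → ValidBW n (swapCols k cols)
validBW-swapCols n k {cols} (vs , p) = valid-swapCols k vs , ↭-trans (↭-reflexive (sym (labelsOf-dropEmpty (swapCols k cols))))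
  (↭-trans (labelsOf-↭ (dropEmpty-swapCols k cols)) (↭-trans (↭-reflexive (labelsOf-dropEmpty cols)) p))

swapCols-++ : ∀ A x y B → swapCols (length A) (A ++ x ∷ y ∷ B) ≡ A ++ y ∷ x ∷ B
swapCols-++ []      x y B = refl
swapCols-++ (a ∷ A) x y B = cong (a ∷_) (swapCols-++ A x y B)

Park-good : ∀ n {cols} → Good cols → labelsOf cols ↭ labels n → Park (Φ n cols) ≡ Φ n cols
Park-good n g p = trans (Park-Φ n (valid g , p)) (cong (Φ n) (dropEmpty-good g))

-- The dimension

module _ {c ℓ} (K : Field0 c ℓ) where

  private module F = Field0 K
  open F using (_≈_; 0#; 1#; Carrier)

  δ : ∀ {N} → Fin N → Fin N → Carrier
  δ i j = if does (i FinP.≟ j) then 1# else 0#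

  ∑-cong : ∀ N {f g : Fin N → Carrier} → (∀ j → f j ≈ g j) → ∑ K N f ≈ ∑ K N g
  ∑-cong zero    e = F.refl
  ∑-cong (suc N) e = F.+-cong (e Fin.zero) (∑-cong N (λ j → e (Fin.suc j)))

  ∑-zero : ∀ N (a : Fin N → Carrier) → ∑ K N (λ j → a j F.* 0#) ≈ 0#
  ∑-zero zero    a = F.refl
  ∑-zero (suc N) a = F.trans (F.+-cong (F.zeroʳ (a Fin.zero)) (∑-zero N (λ j → a (Fin.suc j)))) (F.+-identityˡ 0#)

  ∑-δ : ∀ N (a : Fin N → Carrier) i → ∑ K N (λ j → a j F.* δ i j) ≈ a i
  ∑-δ (suc N) a Fin.zero    = F.trans (F.+-cong (F.*-identityʳ (a Fin.zero)) (∑-zero N (λ j → a (Fin.suc j)))) (F.+-identityʳ (a Fin.zero))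
  ∑-δ (suc N) a (Fin.suc i) = F.trans (F.+-cong (F.zeroʳ (a Fin.zero)) (∑-δ N (λ j → a (Fin.suc j)) i)) (F.+-identityˡ (a (Fin.suc i)))

  module _ (n : ℕ) where

    representatives : List (List Column)
    representatives = orbits n (labels n)

    dimension : ℕ
    dimension = length representatives

    rep : Fin dimension → List Column
    rep = lookup representatives

    rep-orbit : ∀ j → IsOrbit (labels n) (rep j)
    rep-orbit j = All.lookup (orbits-sound n (labels n) (labels-increasing n)) (∈-lookup j)

    rep-injective : ∀ i j → rep i ↭ rep j → i ≡ j
    rep-injective = distinct-lookup ↭-sym (orbits-distinct n (labels n) (labels-increasing n))

    orbitOf : ∀ cols → IsOrbit (labels n) cols → Σ (Fin dimension) λ j → rep j ↭ cols
    orbitOf cols (g , p) with orbits-complete n (labels n) cols (≤-reflexive (length-labels n)) (labels-increasing n) g p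
    ... | c , c∈ , c↭ = index c∈ , subst (_↭ cols) (lookup-index c∈) c↭

    isPF? : ∀ u → Dec (T (isPF u) × length u ≡ n)
    isPF? u = T? (isPF u) ×-dec (length u ≟ n)

    orbitOfWord : ∀ u → T (isPF u) × length u ≡ n →
      Σ (Fin dimension) λ j → Σ (List Column) λ cols → IsOrbit (labels n) cols × Φ n cols ≡ u × rep j ↭ cols
    orbitOfWord u (pf , len) with Φ-surjective n u len (isPF⇒parking u pf)
    ... | cols , g , p , e with orbitOf cols (g , p)
    ...   | j , r = j , cols , (g , p) , e , r

    -- The indicator function of the j-th orbit; the orbit of a parking function is found by
    -- decomposing it into columns.
    basis : Fin dimension → Word → Carrier
    basis j u with isPF? u
    ... | yes pf = δ (proj₁ (orbitOfWord u pf)) j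
    ... | no _   = 0#

    -- By injectivity of `Φ` the decomposition found by `orbitOfWord` is `cols` itself, and distinct
    -- representatives are not permutations of each other.
    basis-Φ : ∀ {cols} → IsOrbit (labels n) cols → ∀ i → rep i ↭ cols → ∀ j → basis j (Φ n cols) ≡ δ i j
    basis-Φ {cols} (g , p) i r j with isPF? (Φ n cols)
    ... | no ¬pf = ⊥-elim (¬pf (parking⇒isPF (Φ n cols) (Φ-parking n g p) , length-Φ n cols))
    ... | yes pf = let i′ , cols′ , (g′ , p′) , e , r′ = orbitOfWord (Φ n cols) pf in cong (λ k → δ k j) (rep-injective i′ i
            (↭-trans r′ (↭-trans (↭-reflexive (Φ-injective n g′ g p′ p e)) (↭-sym r))))

    basis-inPQSym : ∀ j → InPQSym K n (basis j)
    basis-inPQSym j u ¬pf with isPF? u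
    ... | yes pf = ⊥-elim (¬pf pf)
    ... | no _   = F.refl

    basis-invariant : ∀ j → Invariant K n (basis j)
    basis-invariant j cols v@(vs , p) k = F.reflexive (trans (cong (basis j) (Park-Φ n v′))
      (trans (basis-Φ orbit′ i (↭-trans r (↭-sym (dropEmpty-swapCols k cols))) j)
      (sym (trans (cong (basis j) (Park-Φ n v)) (basis-Φ orbit i r j)))))
      where
      v′ : ValidBW n (swapCols k cols)
      v′ = validBW-swapCols n k v
      orbit : IsOrbit (labels n) (dropEmpty cols)
      orbit = good-dropEmpty vs , ↭-trans (↭-reflexive (labelsOf-dropEmpty cols)) p
      orbit′ : IsOrbit (labels n) (dropEmpty (swapCols k cols))
      orbit′ = good-dropEmpty (proj₁ v′) , ↭-trans (↭-reflexive (labelsOf-dropEmpty (swapCols k cols))) (proj₂ v′)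
      i : Fin dimension
      i = proj₁ (orbitOf (dropEmpty cols) orbit)
      r : rep i ↭ dropEmpty cols
      r = proj₂ (orbitOf (dropEmpty cols) orbit)

    -- Evaluation at the word of the i-th representative isolates the coefficient `a i`.
    basis-independent : ∀ (a : Fin dimension → Carrier) → (∀ u → ∑ K dimension (λ j → a j F.* basis j u) ≈ 0#) → ∀ j → a j ≈ 0#
    basis-independent a vanish i = F.trans (F.sym (∑-δ dimension a i)) (F.trans
      (∑-cong dimension (λ j → F.*-congˡ (F.reflexive (sym (basis-Φ (rep-orbit i) i ↭-refl j))))) (vanish (Φ n (rep i))))

    module _ (f : Word → Carrier) (inv : Invariant K n f) where

      -- Invariance is a statement about f after `Park`; as `Park` fixes the words of good
      -- sequences, it becomes one about f itself.
      swap-invariant : ∀ A x y B → IsOrbit (labels n) (A ++ x ∷ y ∷ B) → IsOrbit (labels n) (A ++ y ∷ x ∷ B) →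
        f (Φ n (A ++ x ∷ y ∷ B)) ≈ f (Φ n (A ++ y ∷ x ∷ B))
      swap-invariant A x y B (g , p) (g′ , p′) = F.sym (F.trans (F.reflexive (cong f
          (trans (sym (Park-good n g′ p′)) (cong (Park ∘ Φ n) (sym (swapCols-++ A x y B))))))
        (F.trans (inv (A ++ x ∷ y ∷ B) (valid g , p) (length A)) (F.reflexive (cong f (Park-good n g p)))))

      orbit-resp-↭ : ∀ {cols cols′} → cols ↭ cols′ → IsOrbit (labels n) cols → IsOrbit (labels n) cols′
      orbit-resp-↭ r (g , p) = PermP.All-resp-↭ r g , ↭-trans (↭-sym (labelsOf-↭ r)) p

      -- The prefix A records the columns already passed in the induction over the permutation; a
      -- swap directly behind it is the generator `swapCols (length A)`.
      ↭-invariant : ∀ A {B B′} → B ↭ B′ → IsOrbit (labels n) (A ++ B) → f (Φ n (A ++ B)) ≈ f (Φ n (A ++ B′))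
      ↭-invariant A Perm.refl o = F.refl
      ↭-invariant A {x ∷ B} {x ∷ B′} (prep x r) o = subst₂ (λ l l′ → f (Φ n l) ≈ f (Φ n l′)) (++-assoc A (x ∷ []) B) (++-assoc A (x ∷ []) B′)
        (↭-invariant (A ++ x ∷ []) r (subst (IsOrbit (labels n)) (sym (++-assoc A (x ∷ []) B)) o))
      ↭-invariant A {x ∷ y ∷ B} {y ∷ x ∷ B′} (Perm.swap x y r) o = F.trans (swap-invariant A x y B o o′)
        (subst₂ (λ l l′ → f (Φ n l) ≈ f (Φ n l′)) (++-assoc A (y ∷ x ∷ []) B) (++-assoc A (y ∷ x ∷ []) B′)
          (↭-invariant (A ++ y ∷ x ∷ []) r (subst (IsOrbit (labels n)) (sym (++-assoc A (y ∷ x ∷ []) B)) o′)))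
        where
        o′ : IsOrbit (labels n) (A ++ y ∷ x ∷ B)
        o′ = orbit-resp-↭ (PermP.++⁺ˡ A (Perm.swap x y ↭-refl)) o
      ↭-invariant A (Perm.trans r r′) o = F.trans (↭-invariant A r o) (↭-invariant A r′ (orbit-resp-↭ (PermP.++⁺ˡ A r) o))

    basis-spans : ∀ f → InPQSymInf K n f → Σ (Fin dimension → Carrier) λ a → ∀ u → f u ≈ ∑ K dimension (λ j → a j F.* basis j u)
    basis-spans f (inPQ , inv) = a , expand
      where
      a : Fin dimension → Carrier
      a j = f (Φ n (rep j))
      expand : ∀ u → f u ≈ ∑ K dimension (λ j → a j F.* basis j u)
      expand u with isPF? u
      ... | no ¬pf = F.trans (inPQ u ¬pf) (F.sym (∑-zero dimension a))
      ... | yes pf = let i , cols , o , e , r = orbitOfWord u pf in F.trans (F.reflexive (cong f (sym e))) (F.trans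
              (F.sym (↭-invariant f inv [] r (rep-orbit i))) (F.sym (∑-δ dimension a i)))

    hasDim : HasDim K n dimension
    hasDim = basis , (λ j → basis-inPQSym j , basis-invariant j) , basis-independent , basis-spans

mainTheorem4 : ∀ {c ℓ : Level} (K : Field0 c ℓ) (n : ℕ) → 1 ≤ n →
    HasDim K n (sumFrom1 n (Ainf n)) × (sumFrom1 n (Ainf n) ≡ treesChainCount n)
mainTheorem4 K n 1≤n = subst (HasDim K n) dim≡ (hasDim K n) , trans (sum-Ainf n 1≤n) (sym (treesChainCount-chains n 1≤n))
  where
  dim≡ : dimension K n ≡ sumFrom1 n (Ainf n)
  dim≡ = trans (length-orbits n (labels n) (≤-reflexive (length-labels n)) (labels-increasing n))
    (trans (cong chains (length-labels n)) (sym (sum-Ainf n 1≤n)))
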